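{- Let $q,b$ be complex numbers with $|q|<1$ and $b\neq -q^{ -N}$ for any positive integer $N$. Then for all positive integers $m$ and $n$, $$\sum_{0\leq a_1\leq a_2\leq \dots \leq a_n}^{''}\frac{q^{m(a_1+a_2+\dots +a_n)}}{\prod_{j=0}^{n-1}\prod_{k=0}^{m}\left(1+bq^{jm+k+a_{j+1}}\right)}=\frac{1}{(q^m;q^m)_n\,(-bq;q)_{mn}},$$ where the sum is over all $n$-tuples $(a_1,\dots,a_n)$ of integers satisfying $0\leq a_1\leq a_2\leq\dots\leq a_n$, and the notation $\sum^{''}$ means that, for each $i$ with $1\le i\le n-1$ and $a_{i+1}=a_i$, the factor $1+bq^{im+a_i}$ (which arises in the double product both from $(j,k)=(i-1,m)$ and from $(j,k)=(i,0)$) is included just once in the denominator product, and in addition, if $a_1=0$, then the factor $1+b=1+bq^{0+0}$ (arising from $(j,k)=(0,0)$) does not appear in the denominator product.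
   Context: Notation: $(x;q)_0=1$ and $(x;q)_n=\prod_{j=0}^{n-1}(1-xq^{j})$ for $n\ge 1$; thus $(q^m;q^m)_n=\prod_{j=1}^{n}(1-q^{mj})$ and $(-bq;q)_{mn}=\prod_{j=1}^{mn}(1+bq^{j})$. The condition $b\ne -q^{ -N}$ means $1+bq^N\neq 0$. The omitted factors are deleted from the denominator product before the quotient is formed (so $b=-1$ is allowed). -}

module Defs where

open import Algebra.Apartness.Bundles using (HeytingField)
import Algebra.Apartness.Properties.HeytingCommutativeRing as HeytingProperties
open import Algebra.Bundles using (Semiring; CommutativeRing)
import Algebra.Definitions.RawSemiring as RawSemiringDefinitions
import Algebra.Structures
open import Data.Bool.Base using (Bool; true; false; if_then_else_)
open import Data.Empty using (⊥-elim)
open import Data.Fin.Base using (Fin; zero; suc; toℕ; inject₁)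
open import Data.List.Base using (List; map; foldr)
open import Data.List.Relation.Binary.Subset.Propositional using (_⊆_)
open import Data.List.Relation.Unary.All using (All)
open import Data.List.Relation.Unary.Unique.Propositional using (Unique)
import Data.Integer.Base as ℤ
open import Data.Nat.Base as ℕ using (ℕ; zero; suc; NonZero)
import Data.Nat.Properties as ℕ
open import Data.Product.Base using (∃; _×_; _,_; proj₁; proj₂)
open import Data.Rational.Base as ℚ using (ℚ; 0ℚ; 1ℚ; ½)
import Data.Rational.Properties as ℚ
import Data.Rational.Unnormalised.Base as ℚᵘ
import Data.Rational.Unnormalised.Properties as ℚᵘ
open import Data.Rational.Solver using (module +-*-Solver)
open import Data.Sum.Base as Sum using (_⊎_; inj₁; inj₂; [_,_]′)
open import Data.Vec.Base using (Vec; lookup)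
open import Function.Base using (_∘_; id)
open import Level using (0ℓ)
open import Relation.Binary.PropositionalEquality
open import Relation.Nullary using (Dec; ¬_; yes; no; does)

module RationalFacts where

  open import Data.Rational.Base using (_+_; _*_; _-_; -_; _<_; _≤_; ∣_∣; 1/_)
  open import Data.Rational.Properties
  open +-*-Solver

  0<½ : 0ℚ < ½
  0<½ = positive⁻¹ ½

  0<1 : 0ℚ < 1ℚ
  0<1 = positive⁻¹ 1ℚ

  0<+ : ∀ {p q} → 0ℚ < p → 0ℚ < q → 0ℚ < p + q
  0<+ {p} {q} 0<p 0<q = subst (_< p + q) (+-identityˡ 0ℚ) (+-mono-< 0<p 0<q)

  0≤+ : ∀ {p q} → 0ℚ ≤ p → 0ℚ ≤ q → 0ℚ ≤ p + q
  0≤+ {p} {q} 0≤p 0≤q = subst (_≤ p + q) (+-identityˡ 0ℚ) (+-mono-≤ 0≤p 0≤q)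

  0<* : ∀ {p q} → 0ℚ < p → 0ℚ < q → 0ℚ < p * q
  0<* {p} {q} 0<p 0<q = positive⁻¹ (p * q)
    where
    instance
      _ = ℚ.positive 0<p
      _ = ℚ.positive 0<q
      _ = pos*pos⇒pos p q

  0≤* : ∀ {p q} → 0ℚ ≤ p → 0ℚ ≤ q → 0ℚ ≤ p * q
  0≤* {p} {q} 0≤p 0≤q = nonNegative⁻¹ (p * q)
    where
    instance
      _ = ℚ.nonNegative 0≤p
      _ = ℚ.nonNegative 0≤q
      _ = nonNeg*nonNeg⇒nonNeg p q

  *-monoˡ-≤ : ∀ {r p q} → 0ℚ ≤ r → p ≤ q → r * p ≤ r * q
  *-monoˡ-≤ {r} 0≤r = *-monoˡ-≤-nonNeg r {{ℚ.nonNegative 0≤r}}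

  *-monoʳ-≤ : ∀ {r p q} → 0ℚ ≤ r → p ≤ q → p * r ≤ q * r
  *-monoʳ-≤ {r} 0≤r = *-monoʳ-≤-nonNeg r {{ℚ.nonNegative 0≤r}}

  *-monoˡ-< : ∀ {r p q} → 0ℚ < r → p < q → r * p < r * q
  *-monoˡ-< {r} 0<r = *-monoʳ-<-pos r {{ℚ.positive 0<r}}

  halve : ∀ ε → 0ℚ < ε → ∃ λ δ → 0ℚ < δ × δ + δ ≡ ε
  halve ε 0<ε = ½ * ε , 0<* 0<½ 0<ε ,
    solve 1 (λ e → con ½ :* e :+ con ½ :* e := e) refl ε

  quarter : ∀ ε → 0ℚ < ε → ∃ λ δ → 0ℚ < δ × (δ + δ) + (δ + δ) ≡ ε
  quarter ε 0<ε =
    let η , 0<η , 2η≡ε = halve ε 0<ε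
        δ , 0<δ , 2δ≡η = halve η 0<η
    in δ , 0<δ , trans (cong₂ _+_ 2δ≡η 2δ≡η) 2η≡ε

  divide : ∀ {B} ε → 0ℚ < B → 0ℚ < ε → ∃ λ δ → 0ℚ < δ × B * δ ≡ ε
  divide {B} ε 0<B 0<ε = 1/ B * ε , 0<* (positive⁻¹ (1/ B)) 0<ε , (begin
    B * (1/ B * ε)  ≡⟨ sym (*-assoc B (1/ B) ε) ⟩
    B * 1/ B * ε    ≡⟨ cong (_* ε) (*-inverseʳ B) ⟩
    1ℚ * ε          ≡⟨ *-identityˡ ε ⟩
    ε               ∎)
    where
    open ≡-Reasoning
    instance
      _ = ℚ.positive 0<B
      _ = pos⇒nonZero B
      _ = 1/pos⇒pos B

  <⇒0<- : ∀ {p q} → p < q → 0ℚ < q - p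
  <⇒0<- {p} {q} p<q =
    subst (_< q - p) (+-inverseʳ p) (+-monoˡ-< (- p) p<q)

  ≤⇒0≤- : ∀ {p q} → p ≤ q → 0ℚ ≤ q - p
  ≤⇒0≤- {p} {q} p≤q =
    subst (_≤ q - p) (+-inverseʳ p) (+-monoˡ-≤ (- p) p≤q)

  0<-⇒< : ∀ {p q} → 0ℚ < q - p → p < q
  0<-⇒< {p} {q} h = subst₂ _<_ (+-identityˡ p)
    (solve 2 (λ p q → (q :- p) :+ p := q) refl p q) (+-monoˡ-< p h)

  0≤-⇒≤ : ∀ {p q} → 0ℚ ≤ q - p → p ≤ q
  0≤-⇒≤ {p} {q} h = subst₂ _≤_ (+-identityˡ p)
    (solve 2 (λ p q → (q :- p) :+ p := q) refl p q) (+-monoˡ-≤ p h)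

  p≤∣p∣ : ∀ p → p ≤ ∣ p ∣
  p≤∣p∣ p with ≤-total 0ℚ p
  ... | inj₁ 0≤p = ≤-reflexive (sym (0≤p⇒∣p∣≡p 0≤p))
  ... | inj₂ p≤0 = ≤-trans p≤0 (0≤∣p∣ p)

  -p≤∣p∣ : ∀ p → - p ≤ ∣ p ∣
  -p≤∣p∣ p = subst (- p ≤_) (∣-p∣≡∣p∣ p) (p≤∣p∣ (- p))

  ∣-∣-comm : ∀ p q → ∣ p - q ∣ ≡ ∣ q - p ∣
  ∣-∣-comm p q = trans (sym (∣-p∣≡∣p∣ (p - q)))
    (cong ∣_∣ (solve 2 (λ p q → :- (p :- q) := q :- p) refl p q))

  ∣∣-triangle : ∀ p q → ∣ p ∣ ≤ ∣ q ∣ + ∣ p - q ∣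
  ∣∣-triangle p q = subst (λ r → ∣ r ∣ ≤ ∣ q ∣ + ∣ p - q ∣)
    (solve 2 (λ p q → q :+ (p :- q) := p) refl p q)
    (∣p+q∣≤∣p∣+∣q∣ q (p - q))

  0≤p² : ∀ p → 0ℚ ≤ p * p
  0≤p² p with ≤-total 0ℚ p
  ... | inj₁ 0≤p = 0≤* 0≤p 0≤p
  ... | inj₂ p≤0 = subst (0ℚ ≤_) (solve 1 (λ p → (:- p) :* (:- p) := p :* p) refl p)
                     (0≤* (neg-antimono-≤ p≤0) (neg-antimono-≤ p≤0))

  square-cancel-< : ∀ {p q} → 0ℚ ≤ q → p * p < q * q → p < q
  square-cancel-< {p} {q} 0≤q p²<q² with p <? q
  ... | yes p<q = p<q
  ... | no  p≮q = ⊥-elim (<-irrefl refl (<-≤-trans p²<q²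
      (≤-trans (*-monoˡ-≤ 0≤q q≤p) (*-monoʳ-≤ (≤-trans 0≤q q≤p) q≤p))))
    where q≤p = ≮⇒≥ p≮q

  ∣a-b∣²≤∣a²-b²∣ : ∀ {a b} → 0ℚ ≤ a → 0ℚ ≤ b → ∣ a - b ∣ * ∣ a - b ∣ ≤ ∣ a * a - b * b ∣
  ∣a-b∣²≤∣a²-b²∣ {a} {b} 0≤a 0≤b = begin
    ∣ a - b ∣ * ∣ a - b ∣  ≤⟨ *-monoˡ-≤ (0≤∣p∣ (a - b)) ∣a-b∣≤a+b ⟩
    ∣ a - b ∣ * (a + b)    ≡⟨ cong (∣ a - b ∣ *_) (sym (0≤p⇒∣p∣≡p (0≤+ 0≤a 0≤b))) ⟩
    ∣ a - b ∣ * ∣ a + b ∣  ≡⟨ sym (∣p*q∣≡∣p∣*∣q∣ (a - b) (a + b)) ⟩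
    ∣ (a - b) * (a + b) ∣  ≡⟨ cong ∣_∣ (solve 2 (λ a b → (a :- b) :* (a :+ b) := a :* a :- b :* b) refl a b) ⟩
    ∣ a * a - b * b ∣      ∎
    where
    open ≤-Reasoning
    ∣a-b∣≤a+b : ∣ a - b ∣ ≤ a + b
    ∣a-b∣≤a+b = subst₂ (λ s t → ∣ a - b ∣ ≤ s + t) (0≤p⇒∣p∣≡p 0≤a) (0≤p⇒∣p∣≡p 0≤b)
                  (∣p-q∣≤∣p∣+∣q∣ a b)

  +-difference : ∀ a b c d → (a + b) - (c + d) ≡ (a - c) + (b - d)
  +-difference = solve 4 (λ a b c d → (a :+ b) :- (c :+ d) := (a :- c) :+ (b :- d)) refl

  *-difference : ∀ a b c d → a * b - c * d ≡ a * (b - d) + d * (a - c)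
  *-difference = solve 4 (λ a b c d → a :* b :- c :* d := a :* (b :- d) :+ d :* (a :- c)) refl

  neg-difference : ∀ a b → - a - - b ≡ - (a - b)
  neg-difference = solve 2 (λ a b → (:- a) :- (:- b) := :- (a :- b)) refl

  swap-difference : ∀ a b → b - a ≡ - (a - b)
  swap-difference = solve 2 (λ a b → b :- a := :- (a :- b)) refl

  telescope : ∀ a b c → (a - b) + (b - c) ≡ a - c
  telescope = solve 3 (λ a b c → (a :- b) :+ (b :- c) := a :- c) refl

  +-cancel : ∀ a b → (a + b) - b ≡ a
  +-cancel = solve 2 (λ a b → (a :+ b) :- b := a) refl

  regroup₄ : ∀ a b c d → a - b ≡ ((a - c) + - (b - d)) + (c - d)
  regroup₄ = solve 4 (λ a b c d → a :- b := ((a :- c) :+ (:- (b :- d))) :+ (c :- d)) refl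

  regroup : ∀ d t → (t + d) - (d + d) ≡ t - d
  regroup = solve 2 (λ d t → (t :+ d) :- (d :+ d) := t :- d) refl

  inv-difference : ∀ u v a b → a * b * - (u - v) ≡ a * (v * b) - b * (u * a)
  inv-difference = solve 4 (λ u v a b → a :* b :* (:- (u :- v)) := a :* (v :* b) :- b :* (u :* a)) refl

  normℚ : ℚ → ℚ → ℚ
  normℚ a b = a * a + b * b

  0≤normℚ : ∀ a b → 0ℚ ≤ normℚ a b
  0≤normℚ a b = 0≤+ (0≤p² a) (0≤p² b)

  normℚ-* : ∀ a b c d → normℚ (a * c - b * d) (a * d + b * c) ≡ normℚ a b * normℚ c d
  normℚ-* = solve 4 (λ a b c d →
    (a :* c :- b :* d) :* (a :* c :- b :* d) :+ (a :* d :+ b :* c) :* (a :* d :+ b :* c)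
      := (a :* a :+ b :* b) :* (c :* c :+ d :* d)) refl

  *-assoc-re : ∀ a b c d e f →
    (a * c - b * d) * e - (a * d + b * c) * f ≡ a * (c * e - d * f) - b * (c * f + d * e)
  *-assoc-re = solve 6 (λ a b c d e f →
    (a :* c :- b :* d) :* e :- (a :* d :+ b :* c) :* f
      := a :* (c :* e :- d :* f) :- b :* (c :* f :+ d :* e)) refl

  *-assoc-im : ∀ a b c d e f →
    (a * c - b * d) * f + (a * d + b * c) * e ≡ a * (c * f + d * e) + b * (c * e - d * f)
  *-assoc-im = solve 6 (λ a b c d e f →
    (a :* c :- b :* d) :* f :+ (a :* d :+ b :* c) :* e
      := a :* (c :* f :+ d :* e) :+ b :* (c :* e :- d :* f)) refl

  *-comm-re : ∀ a b c d → a * c - b * d ≡ c * a - d * b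
  *-comm-re = solve 4 (λ a b c d → a :* c :- b :* d := c :* a :- d :* b) refl

  *-comm-im : ∀ a b c d → a * d + b * c ≡ c * b + d * a
  *-comm-im = solve 4 (λ a b c d → a :* d :+ b :* c := c :* b :+ d :* a) refl

  *-identity-re : ∀ a b → 1ℚ * a - 0ℚ * b ≡ a
  *-identity-re = solve 2 (λ a b → con 1ℚ :* a :- con 0ℚ :* b := a) refl

  *-identity-im : ∀ a b → 1ℚ * b + 0ℚ * a ≡ b
  *-identity-im = solve 2 (λ a b → con 1ℚ :* b :+ con 0ℚ :* a := b) refl

  distrib-re : ∀ a b c d e f → a * (c + e) - b * (d + f) ≡ (a * c - b * d) + (a * e - b * f)
  distrib-re = solve 6 (λ a b c d e f →
    a :* (c :+ e) :- b :* (d :+ f) := (a :* c :- b :* d) :+ (a :* e :- b :* f)) refl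

  distrib-im : ∀ a b c d e f → a * (d + f) + b * (c + e) ≡ (a * d + b * c) + (a * f + b * e)
  distrib-im = solve 6 (λ a b c d e f →
    a :* (d :+ f) :+ b :* (c :+ e) := (a :* d :+ b :* c) :+ (a :* f :+ b :* e)) refl

  inv-re : ∀ a b r → a * (a * r) - b * (- b * r) ≡ normℚ a b * r
  inv-re = solve 3 (λ a b r → a :* (a :* r) :- b :* ((:- b) :* r) := (a :* a :+ b :* b) :* r) refl

  inv-im : ∀ a b r → a * (- b * r) + b * (a * r) ≡ 0ℚ
  inv-im = solve 3 (λ a b r → a :* ((:- b) :* r) :+ b :* (a :* r) := con 0ℚ) refl

  normℚ-apartˡ : ∀ {ε} a b → 0ℚ < ε → ε < ∣ a ∣ → ε * ε < ∣ normℚ a b ∣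
  normℚ-apartˡ {ε} a b 0<ε ε<∣a∣ = begin-strict
    ε * ε          <⟨ *-monoˡ-< 0<ε ε<∣a∣ ⟩
    ε * ∣ a ∣      ≤⟨ *-monoʳ-≤ (0≤∣p∣ a) (<⇒≤ ε<∣a∣) ⟩
    ∣ a ∣ * ∣ a ∣  ≡⟨ sym (∣p*q∣≡∣p∣*∣q∣ a a) ⟩
    ∣ a * a ∣      ≡⟨ 0≤p⇒∣p∣≡p (0≤p² a) ⟩
    a * a          ≡⟨ sym (+-identityʳ (a * a)) ⟩
    a * a + 0ℚ     ≤⟨ +-monoʳ-≤ (a * a) (0≤p² b) ⟩
    normℚ a b      ≤⟨ p≤∣p∣ (normℚ a b) ⟩
    ∣ normℚ a b ∣  ∎
    where open ≤-Reasoning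

  normℚ-apartʳ : ∀ {ε} a b → 0ℚ < ε → ε < ∣ b ∣ → ε * ε < ∣ normℚ a b ∣
  normℚ-apartʳ {ε} a b 0<ε ε<∣b∣ =
    subst (λ r → ε * ε < ∣ r ∣) (+-comm (b * b) (a * a)) (normℚ-apartˡ b a 0<ε ε<∣b∣)

  -- 2 (1 - a) = (1 - a²) + (1 - a)²
  1-norm⇒1-re : ∀ {δ η} a b → η + η ≡ δ → δ < 1ℚ - normℚ a b → η < ∣ 1ℚ - a ∣
  1-norm⇒1-re {δ} {η} a b 2η≡δ δ< with η <? ∣ 1ℚ - a ∣
  ... | yes h = h
  ... | no ≮η = ⊥-elim (<-irrefl refl (begin-strict
    δ                              <⟨ δ< ⟩
    1ℚ - normℚ a b                 ≡⟨ sym (+-identityʳ _) ⟩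
    1ℚ - normℚ a b + 0ℚ            ≤⟨ +-monoʳ-≤ (1ℚ - normℚ a b) (0≤normℚ (1ℚ - a) b) ⟩
    1ℚ - normℚ a b + normℚ (1ℚ - a) b
      ≡⟨ solve 2 (λ a b → (con 1ℚ :- (a :* a :+ b :* b)) :+ ((con 1ℚ :- a) :* (con 1ℚ :- a) :+ b :* b)
            := (con 1ℚ :- a) :+ (con 1ℚ :- a)) refl a b ⟩
    (1ℚ - a) + (1ℚ - a)            ≤⟨ +-mono-≤ 1-a≤η 1-a≤η ⟩
    η + η                          ≡⟨ 2η≡δ ⟩
    δ                              ∎))
    where
    open ≤-Reasoning
    1-a≤η : 1ℚ - a ≤ η
    1-a≤η = ≤-trans (p≤∣p∣ (1ℚ - a)) (≮⇒≥ ≮η)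

  1-s⇒1-p : ∀ {s p δ ε} → 0ℚ ≤ s → δ + δ ≡ ε → ε < 1ℚ - s → ∣ s * s - p ∣ < δ → δ < 1ℚ - p
  1-s⇒1-p {s} {p} {δ} {ε} 0≤s 2δ≡ε ε< e< = 0<-⇒< (begin-strict
    0ℚ                                            ≡⟨ sym (+-identityˡ 0ℚ) ⟩
    0ℚ + 0ℚ                                       <⟨ +-mono-< (<⇒0<- ε<1-s²) (<⇒0<- p-s²<δ) ⟩
    ((1ℚ - s * s) - ε) + (δ - - (s * s - p))      ≡⟨ cong (λ e → ((1ℚ - s * s) - e) + (δ - - (s * s - p))) (sym 2δ≡ε) ⟩
    ((1ℚ - s * s) - (δ + δ)) + (δ - - (s * s - p))
      ≡⟨ solve 3 (λ s p d → ((con 1ℚ :- s :* s) :- (d :+ d)) :+ (d :- (:- (s :* s :- p)))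
            := (con 1ℚ :- p) :- d) refl s p δ ⟩
    (1ℚ - p) - δ                                  ∎)
    where
    open ≤-Reasoning
    s≤1 : s ≤ 1ℚ
    s≤1 = <⇒≤ (0<-⇒< (<-trans 0<ε ε<))
      where
      0<δ : 0ℚ < δ
      0<δ = ≤-<-trans (0≤∣p∣ (s * s - p)) e<
      0<ε : 0ℚ < ε
      0<ε = subst (0ℚ <_) 2δ≡ε (0<+ 0<δ 0<δ)
    s²≤s : s * s ≤ s
    s²≤s = subst (s * s ≤_) (*-identityʳ s) (*-monoˡ-≤ 0≤s s≤1)
    ε<1-s² : ε < 1ℚ - s * s
    ε<1-s² = <-≤-trans ε< (+-monoʳ-≤ 1ℚ (neg-antimono-≤ s²≤s))
    p-s²<δ : - (s * s - p) < δ
    p-s²<δ = ≤-<-trans (-p≤∣p∣ (s * s - p)) e<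

if-elim : ∀ {A X : Set} (P : X → Set) (d : Dec A) {x y} →
          (A → P x) → (¬ A → P y) → P (if does d then x else y)
if-elim P (yes a) f g = f a
if-elim P (no ¬a) f g = g ¬a

module SquareRoot where

  open import Data.Rational.Base using (_+_; _*_; _-_; -_; _<_; _≤_; ∣_∣)
  open import Data.Rational.Properties
  open RationalFacts
  open +-*-Solver using (solve; _:=_; _:+_; _:*_; _:-_; con)

  width : ℚ → ℕ → ℚ
  width p zero    = p + 1ℚ
  width p (suc k) = ½ * width p k

  -- k steps of bisection for √p in [0 , p + 1]: the lower endpoint.
  sqrtApprox : ℚ → ℕ → ℚ
  sqrtApprox p zero    = 0ℚ
  sqrtApprox p (suc k) = if does (m * m ≤? p) then m else sqrtApprox p k
    where m = sqrtApprox p k + width p (suc k)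

  record Bracket (p s w : ℚ) : Set where
    field
      0≤s   : 0ℚ ≤ s
      0≤w   : 0ℚ ≤ w
      s²≤p  : s * s ≤ p
      p≤    : p ≤ (s + w) * (s + w)
      s+w≤  : s + w ≤ p + 1ℚ

  bracket : ∀ p → 0ℚ ≤ p → ∀ k → Bracket p (sqrtApprox p k) (width p k)
  bracket p 0≤p zero = record
    { 0≤s  = ≤-refl
    ; 0≤w  = 0≤p+1
    ; s²≤p = 0≤p
    ; p≤   = 0≤-⇒≤ (subst (0ℚ ≤_)
        (solve 1 (λ p → p :* p :+ (p :+ con 1ℚ) :=
          (con 0ℚ :+ (p :+ con 1ℚ)) :* (con 0ℚ :+ (p :+ con 1ℚ)) :- p) refl p)
        (0≤+ (0≤p² p) 0≤p+1))
    ; s+w≤ = ≤-reflexive (+-identityˡ (p + 1ℚ))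
    }
    where
    0≤p+1 : 0ℚ ≤ p + 1ℚ
    0≤p+1 = 0≤+ 0≤p (<⇒≤ 0<1)
  bracket p 0≤p (suc k) = if-elim (λ s → Bracket p s w′) (m * m ≤? p)
    (λ m²≤p → record
      { 0≤s  = 0≤+ 0≤s 0≤w′
      ; 0≤w  = 0≤w′
      ; s²≤p = m²≤p
      ; p≤   = subst (λ r → p ≤ r * r) (sym m+w′) p≤
      ; s+w≤ = subst (_≤ p + 1ℚ) (sym m+w′) s+w≤
      })
    (λ m²≰p → record
      { 0≤s  = 0≤s
      ; 0≤w  = 0≤w′
      ; s²≤p = s²≤p
      ; p≤   = <⇒≤ (≰⇒> m²≰p)
      ; s+w≤ = ≤-trans (subst₂ _≤_ (+-identityʳ m) m+w′ (+-monoʳ-≤ m 0≤w′)) s+w≤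
      })
    where
    open Bracket (bracket p 0≤p k)
    w′ = width p (suc k)
    m  = sqrtApprox p k + w′
    0≤w′ : 0ℚ ≤ w′
    0≤w′ = 0≤* (<⇒≤ 0<½) 0≤w
    m+w′ : m + w′ ≡ sqrtApprox p k + width p k
    m+w′ = solve 2 (λ s w → (s :+ con ½ :* w) :+ con ½ :* w := s :+ w) refl (sqrtApprox p k) (width p k)

  halves : ℕ → ℚ
  halves zero    = 1ℚ
  halves (suc k) = ½ * halves k

  width-halves : ∀ p k → width p k ≡ halves k * (p + 1ℚ)
  width-halves p zero    = sym (*-identityˡ (p + 1ℚ))
  width-halves p (suc k) = trans (cong (½ *_) (width-halves p k)) (sym (*-assoc ½ (halves k) (p + 1ℚ)))

  error : ∀ p → 0ℚ ≤ p → ∀ k → ∣ sqrtApprox p k * sqrtApprox p k - p ∣ ≤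
          ∣ (p + 1ℚ) * ((p + 1ℚ) + (p + 1ℚ)) * halves k ∣
  error p 0≤p k = begin
    ∣ s * s - p ∣                       ≡⟨ ∣-∣-comm (s * s) p ⟩
    ∣ p - s * s ∣                       ≡⟨ 0≤p⇒∣p∣≡p (≤⇒0≤- s²≤p) ⟩
    p - s * s                           ≤⟨ +-monoˡ-≤ (- (s * s)) p≤ ⟩
    (s + w) * (s + w) - s * s
      ≡⟨ solve 2 (λ s w → (s :+ w) :* (s :+ w) :- s :* s := w :* (s :+ (s :+ w))) refl s w ⟩
    w * (s + (s + w))                   ≤⟨ *-monoˡ-≤ 0≤w (+-mono-≤ s≤ s+w≤) ⟩
    w * ((p + 1ℚ) + (p + 1ℚ))           ≡⟨ cong (_* ((p + 1ℚ) + (p + 1ℚ))) (width-halves p k) ⟩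
    halves k * (p + 1ℚ) * ((p + 1ℚ) + (p + 1ℚ))
      ≡⟨ solve 3 (λ h a b → h :* a :* b := a :* b :* h) refl (halves k) (p + 1ℚ) ((p + 1ℚ) + (p + 1ℚ)) ⟩
    (p + 1ℚ) * ((p + 1ℚ) + (p + 1ℚ)) * halves k     ≤⟨ p≤∣p∣ _ ⟩
    ∣ (p + 1ℚ) * ((p + 1ℚ) + (p + 1ℚ)) * halves k ∣ ∎
    where
    open ≤-Reasoning
    open Bracket (bracket p 0≤p k)
    s = sqrtApprox p k
    w = width p k
    s≤ : s ≤ p + 1ℚ
    s≤ = ≤-trans (subst (_≤ s + w) (+-identityʳ s) (+-monoʳ-≤ s 0≤w)) s+w≤

  0≤halves : ∀ k → 0ℚ ≤ halves k
  0≤halves zero    = <⇒≤ 0<1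
  0≤halves (suc k) = 0≤* (<⇒≤ 0<½) (0≤halves k)

  halves-≤ : ∀ k → halves k ≤ ℚ.fromℚᵘ (ℚᵘ.mkℚᵘ (ℤ.+ 1) k)
  halves-≤ zero = ≤-refl
  halves-≤ (suc k) = ≤-trans (*-monoˡ-≤ (<⇒≤ 0<½) (halves-≤ k)) (toℚᵘ-cancel-≤ (begin
    ℚ.toℚᵘ (½ * ℚ.fromℚᵘ u)           ≃⟨ toℚᵘ-homo-* ½ (ℚ.fromℚᵘ u) ⟩
    ℚᵘ.½ ℚᵘ.* ℚ.toℚᵘ (ℚ.fromℚᵘ u)     ≃⟨ ℚᵘ.*-congˡ {ℚᵘ.½} (toℚᵘ-fromℚᵘ u) ⟩
    ℚᵘ.½ ℚᵘ.* u                       ≤⟨ ℚᵘ.*≤* (ℤ.+≤+ bound) ⟩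
    v                                 ≃⟨ ℚᵘ.≃-sym (toℚᵘ-fromℚᵘ v) ⟩
    ℚ.toℚᵘ (ℚ.fromℚᵘ v)               ∎))
    where
    open ℚᵘ.≤-Reasoning
    u = ℚᵘ.mkℚᵘ (ℤ.+ 1) k
    v = ℚᵘ.mkℚᵘ (ℤ.+ 1) (suc k)
    bound : suc (suc k) ℕ.+ 0 ℕ.≤ suc (k ℕ.+ (suc k ℕ.+ 0)) ℕ.+ 0
    bound = ℕ.+-monoˡ-≤ 0 (ℕ.s≤s (ℕ.≤-trans (ℕ.≤-reflexive (sym (ℕ.+-identityʳ (suc k)))) (ℕ.m≤n+m (suc k ℕ.+ 0) k)))

  archimedean : ∀ ε → 0ℚ < ε → ∃ λ N → ∀ n → N ℕ.≤ n → ℚ.fromℚᵘ (ℚᵘ.mkℚᵘ (ℤ.+ 1) n) < ε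
  archimedean (ℚ.mkℚ (ℤ.+ zero)    d c) (ℚ.*<* (ℤ.+<+ ()))
  archimedean (ℚ.mkℚ (ℤ.-[1+ _ ])  d c) (ℚ.*<* ())
  archimedean ε@(ℚ.mkℚ (ℤ.+ (suc a)) d c) _ = suc d , λ n d<n → toℚᵘ-cancel-<
    (ℚᵘ.<-respˡ-≃ (ℚᵘ.≃-sym (toℚᵘ-fromℚᵘ (ℚᵘ.mkℚᵘ (ℤ.+ 1) n)))
      (ℚᵘ.*<* (ℤ.+<+ (ℕ.<-≤-trans
        (subst (ℕ._< suc n) (sym (ℕ.+-identityʳ (suc d))) (ℕ.s≤s d<n))
        (ℕ.m≤m+n (suc n) (a ℕ.* suc n))))))

  halves-null : ∀ ε → 0ℚ < ε → ∃ λ N → ∀ n → N ℕ.≤ n → ∣ halves n ∣ < ε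
  halves-null ε 0<ε =
    let N , h = archimedean ε 0<ε
    in N , λ n N≤n → ≤-<-trans
         (≤-trans (≤-reflexive (0≤p⇒∣p∣≡p (0≤halves n))) (halves-≤ n)) (h n N≤n)

open RationalFacts

-- Eventual properties of families of rationals over an index set with a size;
-- used both for sequences and (with size m ⊓ n) for double sequences.
module Tails {I : Set} (size : I → ℕ) where

  open import Data.Rational.Base using (_+_; _*_; _-_; -_; _<_; _≤_; ∣_∣)
  open ℚ.≤-Reasoning

  Eventually : (I → Set) → Set
  Eventually P = ∃ λ N → ∀ i → N ℕ.≤ size i → P i

  Null : (I → ℚ) → Set
  Null f = ∀ ε → 0ℚ < ε → Eventually (λ i → ∣ f i ∣ < ε)

  Bounded : (I → ℚ) → Set
  Bounded f = ∃ λ B → 0ℚ < B × Eventually (λ i → ∣ f i ∣ < B)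

  always : ∀ {P : I → Set} → (∀ i → P i) → Eventually P
  always p = 0 , λ i _ → p i

  ev-map : ∀ {P Q : I → Set} → (∀ i → P i → Q i) → Eventually P → Eventually Q
  ev-map f (N , p) = N , λ i N≤ → f i (p i N≤)

  ev-zip : ∀ {P Q R : I → Set} → (∀ i → P i → Q i → R i) →
           Eventually P → Eventually Q → Eventually R
  ev-zip f (M , p) (N , q) = M ℕ.⊔ N , λ i h →
    f i (p i (ℕ.≤-trans (ℕ.m≤m⊔n M N) h)) (q i (ℕ.≤-trans (ℕ.m≤n⊔m M N) h))

  null-dom : ∀ {f g} → Eventually (λ i → ∣ f i ∣ ≤ ∣ g i ∣) → Null g → Null f
  null-dom f≤g g ε 0<ε = ev-zip (λ i → ℚ.≤-<-trans) f≤g (g ε 0<ε)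

  null-ext : ∀ {f g} → Eventually (λ i → f i ≡ g i) → Null g → Null f
  null-ext {f} {g} eq = null-dom {f} {g} (ev-map (λ i e → ℚ.≤-reflexive (cong ∣_∣ e)) eq)

  null-≡ : ∀ {f g} → (∀ i → f i ≡ g i) → Null g → Null f
  null-≡ {f} {g} eq = null-ext {f} {g} (always eq)

  null-0 : ∀ {f} → (∀ i → f i ≡ 0ℚ) → Null f
  null-0 eq ε 0<ε = always λ i → subst (λ p → ∣ p ∣ < ε) (sym (eq i)) 0<ε

  null-+ : ∀ {f g} → Null f → Null g → Null (λ i → f i + g i)
  null-+ {f} {g} nf ng ε 0<ε =
    let δ , 0<δ , 2δ≡ε = halve ε 0<ε
    in ev-zip (λ i a b → subst (∣ f i + g i ∣ <_) 2δ≡ε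
         (ℚ.≤-<-trans (ℚ.∣p+q∣≤∣p∣+∣q∣ (f i) (g i)) (ℚ.+-mono-< a b)))
         (nf δ 0<δ) (ng δ 0<δ)

  null-neg : ∀ {f} → Null f → Null (λ i → - f i)
  null-neg {f} = null-dom {g = f} (always λ i → ℚ.≤-reflexive (ℚ.∣-p∣≡∣p∣ (f i)))

  null-* : ∀ {f g} → Bounded f → Null g → Null (λ i → f i * g i)
  null-* {f} {g} (B , 0<B , bf) ng ε 0<ε with divide ε 0<B 0<ε
  ... | δ , 0<δ , refl = ev-zip (λ i a b → begin-strict
      ∣ f i * g i ∣      ≡⟨ ℚ.∣p*q∣≡∣p∣*∣q∣ (f i) (g i) ⟩
      ∣ f i ∣ * ∣ g i ∣  ≤⟨ *-monoʳ-≤ (ℚ.0≤∣p∣ (g i)) (ℚ.<⇒≤ a) ⟩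
      B * ∣ g i ∣        <⟨ *-monoˡ-< 0<B b ⟩
      B * δ              ∎) bf (ng δ 0<δ)

  bounded-* : ∀ {f g} → Bounded f → Bounded g → Bounded (λ i → f i * g i)
  bounded-* {f} {g} (B , 0<B , bf) (C , 0<C , bg) = B * C , 0<* 0<B 0<C ,
    ev-zip (λ i a b → begin-strict
      ∣ f i * g i ∣      ≡⟨ ℚ.∣p*q∣≡∣p∣*∣q∣ (f i) (g i) ⟩
      ∣ f i ∣ * ∣ g i ∣  ≤⟨ *-monoʳ-≤ (ℚ.0≤∣p∣ (g i)) (ℚ.<⇒≤ a) ⟩
      B * ∣ g i ∣        <⟨ *-monoˡ-< 0<B b ⟩
      B * C              ∎) bf bg

  bounded-const : ∀ p → Bounded (λ _ → p)
  bounded-const p = ∣ p ∣ + 1ℚ , ℚ.≤-<-trans (ℚ.0≤∣p∣ p) <+1 , always λ _ → <+1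
    where
    <+1 : ∣ p ∣ < ∣ p ∣ + 1ℚ
    <+1 = subst (_< ∣ p ∣ + 1ℚ) (ℚ.+-identityʳ ∣ p ∣) (ℚ.+-monoʳ-< ∣ p ∣ 0<1)

  bounded-+ : ∀ {f g} → Bounded f → Bounded g → Bounded (λ i → f i + g i)
  bounded-+ {f} {g} (B , 0<B , bf) (C , 0<C , bg) = B + C , 0<+ 0<B 0<C ,
    ev-zip (λ i a b → ℚ.≤-<-trans (ℚ.∣p+q∣≤∣p∣+∣q∣ (f i) (g i)) (ℚ.+-mono-< a b)) bf bg

  null-square : ∀ {f} → Null (λ i → f i * f i) → Null f
  null-square {f} nf² ε 0<ε = ev-map
    (λ i h → square-cancel-< (ℚ.<⇒≤ 0<ε) (subst (_< ε * ε) (ℚ.∣p*q∣≡∣p∣*∣q∣ (f i) (f i)) h))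
    (nf² (ε * ε) (0<* 0<ε 0<ε))

module Real where

  open Tails {ℕ} id public
  module Pairs = Tails {ℕ × ℕ} (λ (m , n) → m ℕ.⊓ n)

  IsCauchy : (ℕ → ℚ) → Set
  IsCauchy s = ∀ ε → 0ℚ ℚ.< ε →
    ∃ λ N → ∀ m n → N ℕ.≤ m → N ℕ.≤ n → ℚ.∣ s m ℚ.- s n ∣ ℚ.< ε

  record ℝ : Set where
    no-eta-equality
    constructor mkℝ
    field
      seq    : ℕ → ℚ
      cauchy : IsCauchy seq

  open ℝ public

  infix  4 _≈_ _#_ _<_
  infixl 6 _+_ _-_
  infixl 7 _*_
  infix  8 -_

  record _≈_ (x y : ℝ) : Set where
    constructor mk≈
    field null : Null (λ n → seq x n ℚ.- seq y n)

  -- x < y: some positive rational eventually separates the two sequences.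
  record _<_ (x y : ℝ) : Set where
    constructor mk<
    field
      gap   : ℚ
      0<gap : 0ℚ ℚ.< gap
      apart : Eventually (λ n → gap ℚ.< seq y n ℚ.- seq x n)

  -- x # y: |x - y| > 0, the constructive reading of x ≠ y.
  record _#_ (x y : ℝ) : Set where
    constructor mk#
    field
      gap   : ℚ
      0<gap : 0ℚ ℚ.< gap
      apart : Eventually (λ n → gap ℚ.< ℚ.∣ seq x n ℚ.- seq y n ∣)

  cauchy⇒null : ∀ s → IsCauchy s → Pairs.Null (λ (m , n) → s m ℚ.- s n)
  cauchy⇒null s c ε 0<ε with c ε 0<ε
  ... | N , h = N , λ (m , n) N≤ →
    h m n (ℕ.≤-trans N≤ (ℕ.m⊓n≤m m n)) (ℕ.≤-trans N≤ (ℕ.m⊓n≤n m n))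

  null⇒cauchy : ∀ s → Pairs.Null (λ (m , n) → s m ℚ.- s n) → IsCauchy s
  null⇒cauchy s c ε 0<ε with c ε 0<ε
  ... | N , h = N , λ m n N≤m N≤n → h (m , n) (ℕ.⊓-glb N≤m N≤n)

  fst-bounded : ∀ {s} → Bounded s → Pairs.Bounded (s ∘ proj₁)
  fst-bounded (B , 0<B , N , h) = B , 0<B , N , λ (m , n) N≤ →
    h m (ℕ.≤-trans N≤ (ℕ.m⊓n≤m m n))

  snd-bounded : ∀ {s} → Bounded s → Pairs.Bounded (s ∘ proj₂)
  snd-bounded (B , 0<B , N , h) = B , 0<B , N , λ (m , n) N≤ →
    h n (ℕ.≤-trans N≤ (ℕ.m⊓n≤n m n))

  fst-null : ∀ {s} → Null s → Pairs.Null (s ∘ proj₁)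
  fst-null ns ε 0<ε with ns ε 0<ε
  ... | N , h = N , λ (m , n) N≤ → h m (ℕ.≤-trans N≤ (ℕ.m⊓n≤m m n))

  snd-null : ∀ {s} → Null s → Pairs.Null (s ∘ proj₂)
  snd-null ns ε 0<ε with ns ε 0<ε
  ... | N , h = N , λ (m , n) N≤ → h n (ℕ.≤-trans N≤ (ℕ.m⊓n≤n m n))

  bounded : ∀ x → Bounded (seq x)
  bounded x with cauchy x 1ℚ 0<1
  ... | N , h = ℚ.∣ seq x N ∣ ℚ.+ 1ℚ
              , ℚ.+-mono-≤-< (ℚ.0≤∣p∣ (seq x N)) 0<1
              , N , λ n N≤n → ℚ.≤-<-trans (∣∣-triangle (seq x n) (seq x N))
                      (ℚ.+-monoʳ-< ℚ.∣ seq x N ∣ (h n N N≤n ℕ.≤-refl))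

  fromℚ : ℚ → ℝ
  fromℚ p .seq _ = p
  fromℚ p .cauchy ε 0<ε = 0 , λ _ _ _ _ →
    subst (λ r → ℚ.∣ r ∣ ℚ.< ε) (sym (ℚ.+-inverseʳ p)) 0<ε

  0# 1# : ℝ
  0# = fromℚ 0ℚ
  1# = fromℚ 1ℚ

  _+_ : ℝ → ℝ → ℝ
  (x + y) .seq n = seq x n ℚ.+ seq y n
  (x + y) .cauchy = null⇒cauchy (λ n → seq x n ℚ.+ seq y n) (Pairs.null-≡
    (λ (m , n) → +-difference (seq x m) (seq y m) (seq x n) (seq y n))
    (Pairs.null-+ (cauchy⇒null (seq x) (cauchy x)) (cauchy⇒null (seq y) (cauchy y))))

  -_ : ℝ → ℝ
  (- x) .seq n = ℚ.- seq x n
  (- x) .cauchy = null⇒cauchy (λ n → ℚ.- seq x n) (Pairs.null-≡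
    (λ (m , n) → neg-difference (seq x m) (seq x n))
    (Pairs.null-neg (cauchy⇒null (seq x) (cauchy x))))

  _-_ : ℝ → ℝ → ℝ
  x - y = x + - y

  _*_ : ℝ → ℝ → ℝ
  (x * y) .seq n = seq x n ℚ.* seq y n
  (x * y) .cauchy = null⇒cauchy (λ n → seq x n ℚ.* seq y n) (Pairs.null-≡
    (λ (m , n) → *-difference (seq x m) (seq y m) (seq x n) (seq y n))
    (Pairs.null-+
      (Pairs.null-* (fst-bounded (bounded x)) (cauchy⇒null (seq y) (cauchy y)))
      (Pairs.null-* (snd-bounded (bounded y)) (cauchy⇒null (seq x) (cauchy x)))))

  pointwise : ∀ {x y} → (∀ n → seq x n ≡ seq y n) → x ≈ y
  pointwise {x} {y} eq = mk≈ (null-0 λ n →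
    trans (cong (ℚ._- seq y n) (eq n)) (ℚ.+-inverseʳ (seq y n)))

  ≈-refl : ∀ {x} → x ≈ x
  ≈-refl = pointwise λ _ → refl

  ≈-sym : ∀ {x y} → x ≈ y → y ≈ x
  ≈-sym {x} {y} (mk≈ h) = mk≈ (null-≡
    (λ n → swap-difference (seq x n) (seq y n))
    (null-neg h))

  ≈-trans : ∀ {x y z} → x ≈ y → y ≈ z → x ≈ z
  ≈-trans {x} {y} {z} (mk≈ h) (mk≈ k) = mk≈ (null-≡
    (λ n → sym (telescope (seq x n) (seq y n) (seq z n)))
    (null-+ h k))

  +-cong : ∀ {x y u v} → x ≈ y → u ≈ v → x + u ≈ y + v
  +-cong {x} {y} {u} {v} (mk≈ h) (mk≈ k) = mk≈ (null-≡
    (λ n → +-difference (seq x n) (seq u n) (seq y n) (seq v n))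
    (null-+ h k))

  -‿cong : ∀ {x y} → x ≈ y → - x ≈ - y
  -‿cong {x} {y} (mk≈ h) = mk≈ (null-≡
    (λ n → neg-difference (seq x n) (seq y n))
    (null-neg h))

  *-cong : ∀ {x y u v} → x ≈ y → u ≈ v → x * u ≈ y * v
  *-cong {x} {y} {u} {v} (mk≈ h) (mk≈ k) = mk≈ (null-≡
    (λ n → *-difference (seq x n) (seq u n) (seq y n) (seq v n))
    (null-+ (null-* (bounded x) k) (null-* (bounded v) h)))

  open Algebra.Structures _≈_ using (IsCommutativeRing)

  isCommutativeRing : IsCommutativeRing _+_ _*_ -_ 0# 1#
  isCommutativeRing = record
    { isRing = record
      { +-isAbelianGroup = record
        { isGroup = record
          { isMonoid = record
            { isSemigroup = record
              { isMagma = record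
                { isEquivalence = record { refl = ≈-refl ; sym = ≈-sym ; trans = ≈-trans }
                ; ∙-cong = +-cong
                }
              ; assoc = λ x y z → pointwise λ n → ℚ.+-assoc (seq x n) (seq y n) (seq z n)
              }
            ; identity = (λ x → pointwise λ n → ℚ.+-identityˡ (seq x n))
                       , (λ x → pointwise λ n → ℚ.+-identityʳ (seq x n))
            }
          ; inverse = (λ x → pointwise λ n → ℚ.+-inverseˡ (seq x n))
                    , (λ x → pointwise λ n → ℚ.+-inverseʳ (seq x n))
          ; ⁻¹-cong = -‿cong
          }
        ; comm = λ x y → pointwise λ n → ℚ.+-comm (seq x n) (seq y n)
        }
      ; *-cong = *-cong
      ; *-assoc = λ x y z → pointwise λ n → ℚ.*-assoc (seq x n) (seq y n) (seq z n)
      ; *-identity = (λ x → pointwise λ n → ℚ.*-identityˡ (seq x n))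
                   , (λ x → pointwise λ n → ℚ.*-identityʳ (seq x n))
      ; distrib = (λ x y z → pointwise λ n → ℚ.*-distribˡ-+ (seq x n) (seq y n) (seq z n))
                , (λ x y z → pointwise λ n → ℚ.*-distribʳ-+ (seq x n) (seq y n) (seq z n))
      }
    ; *-comm = λ x y → pointwise λ n → ℚ.*-comm (seq x n) (seq y n)
    }

  commutativeRing : CommutativeRing 0ℓ 0ℓ
  commutativeRing = record { isCommutativeRing = isCommutativeRing }

  -- A Cauchy sequence that is at least 2δ in absolute value far enough out
  -- stays above δ.
  private
    stays-apart : ∀ x δ N → (∀ m n → N ℕ.≤ m → N ℕ.≤ n → ℚ.∣ seq x m ℚ.- seq x n ∣ ℚ.< δ) →
                  ∀ K → N ℕ.≤ K → δ ℚ.+ δ ℚ.≤ ℚ.∣ seq x K ∣ →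
                  Eventually (λ n → δ ℚ.< ℚ.∣ seq x n ∣)
    stays-apart x δ N h K N≤K 2δ≤ = N , λ n N≤n →
      0<-⇒< (subst (0ℚ ℚ.<_)
        (regroup δ ℚ.∣ seq x n ∣)
        (<⇒0<- (ℚ.≤-<-trans 2δ≤ (ℚ.≤-<-trans (∣∣-triangle (seq x K) (seq x n))
          (ℚ.+-monoʳ-< ℚ.∣ seq x n ∣ (h K n N≤K N≤n))))))

  #-irrefl : ∀ {x y} → x ≈ y → ¬ x # y
  #-irrefl (mk≈ h) (mk# ε 0<ε ap) with ev-zip (λ n → ℚ.<-trans) ap (h ε 0<ε)
  ... | N , k = ℚ.<-irrefl refl (k N ℕ.≤-refl)

  #-sym : ∀ {x y} → x # y → y # x
  #-sym {x} {y} (mk# ε 0<ε ap) = mk# ε 0<ε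
    (ev-map (λ n → subst (ε ℚ.<_) (∣-∣-comm (seq x n) (seq y n))) ap)

  #-cotrans : ∀ {x y} → x # y → ∀ z → x # z ⊎ z # y
  #-cotrans {x} {y} (mk# ε 0<ε (M , ap)) z =
    let δ , 0<δ , 4δ≡ε = quarter ε 0<ε
    in go δ 0<δ 4δ≡ε (cauchy (x - z) δ 0<δ) (cauchy (z - y) δ 0<δ)
    where
    close : ∀ δ K → ¬ δ ℚ.+ δ ℚ.≤ ℚ.∣ seq (x - z) K ∣ → ¬ δ ℚ.+ δ ℚ.≤ ℚ.∣ seq (z - y) K ∣ →
            ℚ.∣ seq x K ℚ.- seq y K ∣ ℚ.< (δ ℚ.+ δ) ℚ.+ (δ ℚ.+ δ)
    close δ K p q = ℚ.≤-<-trans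
      (subst (λ r → ℚ.∣ r ∣ ℚ.≤ ℚ.∣ seq (x - z) K ∣ ℚ.+ ℚ.∣ seq (z - y) K ∣)
        (telescope (seq x K) (seq z K) (seq y K))
        (ℚ.∣p+q∣≤∣p∣+∣q∣ (seq (x - z) K) (seq (z - y) K)))
      (ℚ.+-mono-< (ℚ.≰⇒> p) (ℚ.≰⇒> q))

    go : ∀ δ → 0ℚ ℚ.< δ → (δ ℚ.+ δ) ℚ.+ (δ ℚ.+ δ) ≡ ε →
         (∃ λ N → ∀ m n → N ℕ.≤ m → N ℕ.≤ n → ℚ.∣ seq (x - z) m ℚ.- seq (x - z) n ∣ ℚ.< δ) →
         (∃ λ N → ∀ m n → N ℕ.≤ m → N ℕ.≤ n → ℚ.∣ seq (z - y) m ℚ.- seq (z - y) n ∣ ℚ.< δ) →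
         x # z ⊎ z # y
    go δ 0<δ 4δ≡ε (N₁ , h₁) (N₂ , h₂) = decide (_ ℚ.≤? _) (_ ℚ.≤? _)
      where
      K = M ℕ.⊔ (N₁ ℕ.⊔ N₂)
      decide : Dec (δ ℚ.+ δ ℚ.≤ ℚ.∣ seq (x - z) K ∣) → Dec (δ ℚ.+ δ ℚ.≤ ℚ.∣ seq (z - y) K ∣) →
               x # z ⊎ z # y
      decide (yes p) _ = inj₁ (mk# δ 0<δ (stays-apart (x - z) δ N₁ h₁ K
        (ℕ.≤-trans (ℕ.m≤m⊔n N₁ N₂) (ℕ.m≤n⊔m M (N₁ ℕ.⊔ N₂))) p))
      decide (no _) (yes p) = inj₂ (mk# δ 0<δ (stays-apart (z - y) δ N₂ h₂ K
        (ℕ.≤-trans (ℕ.m≤n⊔m N₁ N₂) (ℕ.m≤n⊔m M (N₁ ℕ.⊔ N₂))) p))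
      decide (no p) (no q) = ⊥-elim (ℚ.<-asym (ap K (ℕ.m≤m⊔n M (N₁ ℕ.⊔ N₂)))
        (subst (ℚ.∣ seq x K ℚ.- seq y K ∣ ℚ.<_) 4δ≡ε (close δ K p q)))

  #-tight : ∀ {x y} → ¬ x # y → x ≈ y
  #-tight {x} {y} ¬# = mk≈ λ ε 0<ε →
    let δ , 0<δ , 4δ≡ε = quarter ε 0<ε
    in go ε δ 0<δ 4δ≡ε (cauchy (x - y) δ 0<δ)
    where
    go : ∀ ε δ → 0ℚ ℚ.< δ → (δ ℚ.+ δ) ℚ.+ (δ ℚ.+ δ) ≡ ε →
         (∃ λ N → ∀ m n → N ℕ.≤ m → N ℕ.≤ n → ℚ.∣ seq (x - y) m ℚ.- seq (x - y) n ∣ ℚ.< δ) →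
         Eventually (λ n → ℚ.∣ seq (x - y) n ∣ ℚ.< ε)
    go ε δ 0<δ 4δ≡ε (N , h) = decide (_ ℚ.≤? _)
      where
      δ<2δ : δ ℚ.< δ ℚ.+ δ
      δ<2δ = subst (ℚ._< δ ℚ.+ δ) (ℚ.+-identityˡ δ) (ℚ.+-monoˡ-< δ 0<δ)
      decide : Dec (δ ℚ.+ δ ℚ.≤ ℚ.∣ seq (x - y) N ∣) →
               Eventually (λ n → ℚ.∣ seq (x - y) n ∣ ℚ.< ε)
      decide (yes p) = ⊥-elim (¬# (mk# δ 0<δ (stays-apart (x - y) δ N h N ℕ.≤-refl p)))
      decide (no p)  = N , λ n N≤n → subst (ℚ.∣ seq (x - y) n ∣ ℚ.<_) 4δ≡ε
        (ℚ.≤-<-trans (∣∣-triangle (seq (x - y) n) (seq (x - y) N))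
          (ℚ.+-mono-< (ℚ.≰⇒> p) (ℚ.<-trans (h n N N≤n ℕ.≤-refl) δ<2δ)))

  #⇒-#0 : ∀ {x y} → x # y → x - y # 0#
  #⇒-#0 {x} {y} (mk# ε 0<ε ap) = mk# ε 0<ε (ev-map
    (λ n → subst (λ r → ε ℚ.< ℚ.∣ r ∣) (sym (ℚ.+-identityʳ (seq (x - y) n)))) ap)

  -#0⇒# : ∀ {x y} → x - y # 0# → x # y
  -#0⇒# {x} {y} (mk# ε 0<ε ap) = mk# ε 0<ε (ev-map
    (λ n → subst (λ r → ε ℚ.< ℚ.∣ r ∣) (ℚ.+-identityʳ (seq (x - y) n))) ap)

  #0-resp : ∀ {x y} → x ≈ y → x # 0# → y # 0#
  #0-resp {x} {y} x≈y x#0 =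
    [ (λ x#y → ⊥-elim (#-irrefl x≈y x#y)) , id ]′ (#-cotrans x#0 y)

  +#0 : ∀ {x y} → x + y # 0# → x # 0# ⊎ y # 0#
  +#0 {x} {y} x+y#0 = Sum.map₁
    (λ x+y#y → #0-resp (pointwise λ n → +-cancel (seq x n) (seq y n)) (#⇒-#0 x+y#y))
    (#-cotrans x+y#0 y)

  neg#0 : ∀ {x} → - x # 0# → x # 0#
  neg#0 {x} (mk# ε 0<ε ap) = mk# ε 0<ε (ev-map (λ n → subst (ε ℚ.<_) (begin
    ℚ.∣ ℚ.- seq x n ℚ.- 0ℚ ∣  ≡⟨ cong ℚ.∣_∣ (ℚ.+-identityʳ (ℚ.- seq x n)) ⟩
    ℚ.∣ ℚ.- seq x n ∣        ≡⟨ ℚ.∣-p∣≡∣p∣ (seq x n) ⟩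
    ℚ.∣ seq x n ∣            ≡⟨ cong ℚ.∣_∣ (sym (ℚ.+-identityʳ (seq x n))) ⟩
    ℚ.∣ seq x n ℚ.- 0ℚ ∣      ∎)) ap)
    where open ≡-Reasoning

  *#0 : ∀ {x y} → x * y # 0# → y # 0#
  *#0 {x} {y} (mk# ε 0<ε ap) =
    let B , 0<B , bx = bounded x
        δ , 0<δ , Bδ≡ε = divide ε 0<B 0<ε
    in mk# δ 0<δ (ev-zip (λ n a b → cancel B δ (seq x n) (seq y n) 0<B a
         (subst (ℚ._< ℚ.∣ seq x n ℚ.* seq y n ℚ.- 0ℚ ∣) (sym Bδ≡ε) b)) bx ap)
    where
    cancel : ∀ B δ u v → 0ℚ ℚ.< B → ℚ.∣ u ∣ ℚ.< B → B ℚ.* δ ℚ.< ℚ.∣ u ℚ.* v ℚ.- 0ℚ ∣ →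
             δ ℚ.< ℚ.∣ v ℚ.- 0ℚ ∣
    cancel B δ u v 0<B a b = subst (λ r → δ ℚ.< ℚ.∣ r ∣) (sym (ℚ.+-identityʳ v))
      (ℚ.*-cancelˡ-<-nonNeg B {{ℚ.nonNegative (ℚ.<⇒≤ 0<B)}} (begin-strict
        B ℚ.* δ              <⟨ b ⟩
        ℚ.∣ u ℚ.* v ℚ.- 0ℚ ∣  ≡⟨ cong ℚ.∣_∣ (ℚ.+-identityʳ (u ℚ.* v)) ⟩
        ℚ.∣ u ℚ.* v ∣        ≡⟨ ℚ.∣p*q∣≡∣p∣*∣q∣ u v ⟩
        ℚ.∣ u ∣ ℚ.* ℚ.∣ v ∣  ≤⟨ *-monoʳ-≤ (ℚ.0≤∣p∣ v) (ℚ.<⇒≤ a) ⟩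
        B ℚ.* ℚ.∣ v ∣        ∎))
      where open ℚ.≤-Reasoning

  -- The reciprocal, extended by 0 at 0.
  recip : ℚ → ℚ
  recip p with p ℚ.≟ 0ℚ
  ... | yes _  = 0ℚ
  ... | no p≢0 = ℚ.1/_ p {{ℚ.≢-nonZero p≢0}}

  private
    *-recip : ∀ p → p ≢ 0ℚ → p ℚ.* recip p ≡ 1ℚ
    *-recip p p≢0 with p ℚ.≟ 0ℚ
    ... | yes p≡0 = ⊥-elim (p≢0 p≡0)
    ... | no p≢0  = ℚ.*-inverseʳ p {{ℚ.≢-nonZero p≢0}}

    apart⇒≢0 : ∀ {ε p} → 0ℚ ℚ.< ε → ε ℚ.< ℚ.∣ p ∣ → p ≢ 0ℚ
    apart⇒≢0 0<ε h refl = ℚ.<-asym 0<ε h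

    apart₀ : ∀ {x} (p : x # 0#) → Eventually (λ n → _#_.gap p ℚ.< ℚ.∣ seq x n ∣)
    apart₀ {x} (mk# ε 0<ε ap) =
      ev-map (λ n → subst (λ r → ε ℚ.< ℚ.∣ r ∣) (ℚ.+-identityʳ (seq x n))) ap

    recip-bounded : ∀ {x} → x # 0# → Bounded (recip ∘ seq x)
    recip-bounded {x} p@(mk# ε 0<ε ap) =
      let B , 0<B , εB≡1 = divide 1ℚ 0<ε 0<1
      in B , 0<B , ev-map (λ n → bound B εB≡1 n) (apart₀ p)
      where
      bound : ∀ B → ε ℚ.* B ≡ 1ℚ → ∀ n → ε ℚ.< ℚ.∣ seq x n ∣ → ℚ.∣ recip (seq x n) ∣ ℚ.< B
      bound B εB≡1 n h = ℚ.*-cancelˡ-<-nonNeg ε {{ℚ.nonNegative (ℚ.<⇒≤ 0<ε)}} (begin-strict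
        ε ℚ.* ℚ.∣ r ∣           <⟨ ℚ.*-monoˡ-<-pos ℚ.∣ r ∣ {{ℚ.positive 0<∣r∣}} h ⟩
        ℚ.∣ u ∣ ℚ.* ℚ.∣ r ∣     ≡⟨ sym (ℚ.∣p*q∣≡∣p∣*∣q∣ u r) ⟩
        ℚ.∣ u ℚ.* r ∣           ≡⟨ cong ℚ.∣_∣ ur≡1 ⟩
        1ℚ                      ≡⟨ sym εB≡1 ⟩
        ε ℚ.* B                 ∎)
        where
        open ℚ.≤-Reasoning
        u = seq x n
        r = recip u
        ur≡1 : u ℚ.* r ≡ 1ℚ
        ur≡1 = *-recip u (apart⇒≢0 0<ε h)
        0<∣r∣ : 0ℚ ℚ.< ℚ.∣ r ∣
        0<∣r∣ with ℚ.∣ r ∣ ℚ.≤? 0ℚ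
        ... | no ∣r∣≰0 = ℚ.≰⇒> ∣r∣≰0
        ... | yes ∣r∣≤0 = ⊥-elim (1≢0 (trans (sym ur≡1) (trans (cong (u ℚ.*_) r≡0) (ℚ.*-zeroʳ u))))
          where
          r≡0 : r ≡ 0ℚ
          r≡0 = ℚ.∣p∣≡0⇒p≡0 r (ℚ.≤-antisym ∣r∣≤0 (ℚ.0≤∣p∣ r))
          1≢0 : 1ℚ ≢ 0ℚ
          1≢0 ()

  inv : ∀ x → x # 0# → ℝ
  inv x x#0 .seq n = recip (seq x n)
  inv x x#0@(mk# ε 0<ε _) .cauchy = null⇒cauchy (recip ∘ seq x) (Pairs.null-ext difference
    (Pairs.null-* (Pairs.bounded-* (fst-bounded b) (snd-bounded b))
      (Pairs.null-neg (cauchy⇒null (seq x) (cauchy x)))))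
    where
    b = recip-bounded x#0
    difference : Pairs.Eventually (λ (m , n) → recip (seq x m) ℚ.- recip (seq x n)
      ≡ recip (seq x m) ℚ.* recip (seq x n) ℚ.* ℚ.- (seq x m ℚ.- seq x n))
    difference with apart₀ x#0
    ... | N , h = N , λ (m , n) N≤ → eq (seq x m) (seq x n)
        (*-recip (seq x m) (apart⇒≢0 0<ε (h m (ℕ.≤-trans N≤ (ℕ.m⊓n≤m m n)))))
        (*-recip (seq x n) (apart⇒≢0 0<ε (h n (ℕ.≤-trans N≤ (ℕ.m⊓n≤n m n)))))
      where
      open ≡-Reasoning
      eq : ∀ u v → u ℚ.* recip u ≡ 1ℚ → v ℚ.* recip v ≡ 1ℚ →
           recip u ℚ.- recip v ≡ recip u ℚ.* recip v ℚ.* ℚ.- (u ℚ.- v)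
      eq u v uu⁻¹ vv⁻¹ = sym (begin
        recip u ℚ.* recip v ℚ.* ℚ.- (u ℚ.- v)
          ≡⟨ inv-difference u v (recip u) (recip v) ⟩
        recip u ℚ.* (v ℚ.* recip v) ℚ.- recip v ℚ.* (u ℚ.* recip u)
          ≡⟨ cong₂ (λ s t → recip u ℚ.* s ℚ.- recip v ℚ.* t) vv⁻¹ uu⁻¹ ⟩
        recip u ℚ.* 1ℚ ℚ.- recip v ℚ.* 1ℚ
          ≡⟨ cong₂ ℚ._-_ (ℚ.*-identityʳ (recip u)) (ℚ.*-identityʳ (recip v)) ⟩
        recip u ℚ.- recip v ∎)

  *-inv : ∀ {x} (p : x # 0#) → x * inv x p ≈ 1#
  *-inv {x} p@(mk# ε 0<ε _) = mk≈ (null-ext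
    (ev-map (λ n h → trans (cong (ℚ._- 1ℚ) (*-recip (seq x n) (apart⇒≢0 0<ε h))) refl) (apart₀ p))
    (null-0 {λ _ → 0ℚ} λ _ → refl))

  1#0 : 1# # 0#
  1#0 = mk# ½ 0<½ (always λ _ → 0<-⇒< 0<½)

  sqrtApprox-null : ∀ p → Bounded p → (∀ n → 0ℚ ℚ.≤ p n) →
    Null (λ n → SquareRoot.sqrtApprox (p n) n ℚ.* SquareRoot.sqrtApprox (p n) n ℚ.- p n)
  sqrtApprox-null p bp 0≤p = null-dom
    {g = λ n → (p n ℚ.+ 1ℚ) ℚ.* ((p n ℚ.+ 1ℚ) ℚ.+ (p n ℚ.+ 1ℚ)) ℚ.* SquareRoot.halves n}
    (always λ n → SquareRoot.error (p n) (0≤p n) n)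
    (null-* (bounded-* bp+1 (bounded-+ bp+1 bp+1)) SquareRoot.halves-null)
    where
    bp+1 : Bounded (λ n → p n ℚ.+ 1ℚ)
    bp+1 = bounded-+ bp (bounded-const 1ℚ)

module Complex where

  open Real using (ℝ; seq; cauchy; pointwise; Eventually; ev-map; ev-zip; always)
  open +-*-Solver using (solve; _:=_; _:+_; _:*_; _:-_; :-_)

  record ℂ : Set where
    no-eta-equality
    constructor mkℂ
    field
      re im : ℝ

  open ℂ public

  infix  4 _≈_ _#_
  infixl 6 _+_ _-_
  infixl 7 _*_ _/_[_]
  infix  8 -_

  record _≈_ (z w : ℂ) : Set where
    constructor mk≈
    field
      re≈ : re z Real.≈ re w
      im≈ : im z Real.≈ im w

  data _#_ (z w : ℂ) : Set where
    re# : re z Real.# re w → z # w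
    im# : im z Real.# im w → z # w

  0# 1# : ℂ
  0# = mkℂ Real.0# Real.0#
  1# = mkℂ Real.1# Real.0#

  _+_ : ℂ → ℂ → ℂ
  (z + w) .re = re z Real.+ re w
  (z + w) .im = im z Real.+ im w

  -_ : ℂ → ℂ
  (- z) .re = Real.- re z
  (- z) .im = Real.- im z

  _-_ : ℂ → ℂ → ℂ
  z - w = z + - w

  _*_ : ℂ → ℂ → ℂ
  (z * w) .re = re z Real.* re w Real.- im z Real.* im w
  (z * w) .im = re z Real.* im w Real.+ im z Real.* re w

  normSq : ℂ → ℝ
  normSq z = re z Real.* re z Real.+ im z Real.* im z

  -- |z| = √(normSq z): bisect the square root of the n-th rational
  -- approximation n times.
  ∣_∣ : ℂ → ℝ
  ∣ z ∣ .seq n = SquareRoot.sqrtApprox (seq (normSq z) n) n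
  ∣ z ∣ .cauchy = Real.null⇒cauchy s (Pairs.null-square
    (Pairs.null-dom {g = λ (m , n) → s m ℚ.* s m ℚ.- s n ℚ.* s n}
      (Pairs.always λ (m , n) → ℚ.≤-trans
        (ℚ.≤-reflexive (ℚ.∣p*q∣≡∣p∣*∣q∣ (s m ℚ.- s n) (s m ℚ.- s n)))
        (∣a-b∣²≤∣a²-b²∣ (0≤s m) (0≤s n)))
      (Pairs.null-≡ (λ (m , n) → regroup₄ (s m ℚ.* s m) (s n ℚ.* s n) (p m) (p n))
        (Pairs.null-+
          (Pairs.null-+ (Real.fst-null e-null) (Pairs.null-neg (Real.snd-null e-null)))
          (Real.cauchy⇒null p (cauchy (normSq z)))))))
    where
    module Pairs = Real.Pairs
    p = seq (normSq z)
    s : ℕ → ℚ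
    s n = SquareRoot.sqrtApprox (p n) n
    0≤p : ∀ n → 0ℚ ℚ.≤ p n
    0≤p n = 0≤normℚ (seq (re z) n) (seq (im z) n)
    0≤s : ∀ n → 0ℚ ℚ.≤ s n
    0≤s n = SquareRoot.Bracket.0≤s (SquareRoot.bracket (p n) (0≤p n) n)
    e-null : Real.Null (λ n → s n ℚ.* s n ℚ.- p n)
    e-null = Real.sqrtApprox-null p (Real.bounded (normSq z)) 0≤p

  private
    sqrt-error : ∀ z → Real.Null (λ n → seq (∣ z ∣ Real.* ∣ z ∣) n ℚ.- seq (normSq z) n)
    sqrt-error z = Real.sqrtApprox-null (seq (normSq z)) (Real.bounded (normSq z))
      (λ n → 0≤normℚ (seq (re z) n) (seq (im z) n))

  ∣∣² : ∀ z → ∣ z ∣ Real.* ∣ z ∣ Real.≈ normSq z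
  ∣∣² z = Real.mk≈ (sqrt-error z)

  0≤∣∣ : ∀ z n → 0ℚ ℚ.≤ seq ∣ z ∣ n
  0≤∣∣ z n = SquareRoot.Bracket.0≤s (SquareRoot.bracket (seq (normSq z) n)
    (0≤normℚ (seq (re z) n) (seq (im z) n)) n)

  ≈-refl : ∀ {z} → z ≈ z
  ≈-refl = mk≈ Real.≈-refl Real.≈-refl

  ≈-sym : ∀ {z w} → z ≈ w → w ≈ z
  ≈-sym (mk≈ h k) = mk≈ (Real.≈-sym h) (Real.≈-sym k)

  ≈-trans : ∀ {z w v} → z ≈ w → w ≈ v → z ≈ v
  ≈-trans (mk≈ h k) (mk≈ h′ k′) = mk≈ (Real.≈-trans h h′) (Real.≈-trans k k′)

  +-cong : ∀ {z z′ w w′} → z ≈ z′ → w ≈ w′ → z + w ≈ z′ + w′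
  +-cong (mk≈ h k) (mk≈ h′ k′) = mk≈ (Real.+-cong h h′) (Real.+-cong k k′)

  -‿cong : ∀ {z w} → z ≈ w → - z ≈ - w
  -‿cong (mk≈ h k) = mk≈ (Real.-‿cong h) (Real.-‿cong k)

  *-cong : ∀ {z z′ w w′} → z ≈ z′ → w ≈ w′ → z * w ≈ z′ * w′
  *-cong (mk≈ h k) (mk≈ h′ k′) = mk≈
    (Real.+-cong (Real.*-cong h h′) (Real.-‿cong (Real.*-cong k k′)))
    (Real.+-cong (Real.*-cong h k′) (Real.*-cong k h′))

  pointwise≈ : ∀ {z w} → (∀ n → seq (re z) n ≡ seq (re w) n) →
               (∀ n → seq (im z) n ≡ seq (im w) n) → z ≈ w
  pointwise≈ h k = mk≈ (pointwise h) (pointwise k)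

  open Algebra.Structures _≈_ using (IsCommutativeRing)

  isCommutativeRing : IsCommutativeRing _+_ _*_ -_ 0# 1#
  isCommutativeRing = record
    { isRing = record
      { +-isAbelianGroup = record
        { isGroup = record
          { isMonoid = record
            { isSemigroup = record
              { isMagma = record
                { isEquivalence = record { refl = ≈-refl ; sym = ≈-sym ; trans = ≈-trans }
                ; ∙-cong = +-cong
                }
              ; assoc = λ z w v → mk≈ (ℝ-ring.+-assoc (re z) (re w) (re v)) (ℝ-ring.+-assoc (im z) (im w) (im v))
              }
            ; identity = (λ z → mk≈ (ℝ-ring.+-identityˡ (re z)) (ℝ-ring.+-identityˡ (im z)))
                       , (λ z → mk≈ (ℝ-ring.+-identityʳ (re z)) (ℝ-ring.+-identityʳ (im z)))
            }
          ; inverse = (λ z → mk≈ (ℝ-ring.-‿inverseˡ (re z)) (ℝ-ring.-‿inverseˡ (im z)))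
                    , (λ z → mk≈ (ℝ-ring.-‿inverseʳ (re z)) (ℝ-ring.-‿inverseʳ (im z)))
          ; ⁻¹-cong = -‿cong
          }
        ; comm = λ z w → mk≈ (ℝ-ring.+-comm (re z) (re w)) (ℝ-ring.+-comm (im z) (im w))
        }
      ; *-cong = *-cong
      ; *-assoc = *-assoc
      ; *-identity = *-identityˡ , λ z → ≈-trans (*-comm z 1#) (*-identityˡ z)
      ; distrib = distribˡ
                , λ z w v → ≈-trans (*-comm (w + v) z) (≈-trans (distribˡ z w v)
                              (+-cong (*-comm z w) (*-comm z v)))
      }
    ; *-comm = *-comm
    }
    where
    module ℝ-ring = CommutativeRing Real.commutativeRing

    *-assoc : ∀ z w v → (z * w) * v ≈ z * (w * v)
    *-assoc z w v = pointwise≈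
      (λ n → *-assoc-re (seq (re z) n) (seq (im z) n) (seq (re w) n) (seq (im w) n) (seq (re v) n) (seq (im v) n))
      (λ n → *-assoc-im (seq (re z) n) (seq (im z) n) (seq (re w) n) (seq (im w) n) (seq (re v) n) (seq (im v) n))

    *-comm : ∀ z w → z * w ≈ w * z
    *-comm z w = pointwise≈
      (λ n → *-comm-re (seq (re z) n) (seq (im z) n) (seq (re w) n) (seq (im w) n))
      (λ n → *-comm-im (seq (re z) n) (seq (im z) n) (seq (re w) n) (seq (im w) n))

    *-identityˡ : ∀ z → 1# * z ≈ z
    *-identityˡ z = pointwise≈
      (λ n → *-identity-re (seq (re z) n) (seq (im z) n))
      (λ n → *-identity-im (seq (re z) n) (seq (im z) n))

    distribˡ : ∀ z w v → z * (w + v) ≈ z * w + z * v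
    distribˡ z w v = pointwise≈
      (λ n → distrib-re (seq (re z) n) (seq (im z) n) (seq (re w) n) (seq (im w) n) (seq (re v) n) (seq (im v) n))
      (λ n → distrib-im (seq (re z) n) (seq (im z) n) (seq (re w) n) (seq (im w) n) (seq (re v) n) (seq (im v) n))

  commutativeRing : CommutativeRing 0ℓ 0ℓ
  commutativeRing = record { isCommutativeRing = isCommutativeRing }

  normSq#0 : ∀ {z} → z # 0# → normSq z Real.# Real.0#
  normSq#0 {z} (re# (Real.mk# ε 0<ε ap)) = Real.mk# (ε ℚ.* ε) (0<* 0<ε 0<ε)
    (ev-map (λ n h → subst (λ r → ε ℚ.* ε ℚ.< ℚ.∣ r ∣) (sym (ℚ.+-identityʳ (seq (normSq z) n)))
      (normℚ-apartˡ (seq (re z) n) (seq (im z) n) 0<ε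
        (subst (λ r → ε ℚ.< ℚ.∣ r ∣) (ℚ.+-identityʳ (seq (re z) n)) h))) ap)
  normSq#0 {z} (im# (Real.mk# ε 0<ε ap)) = Real.mk# (ε ℚ.* ε) (0<* 0<ε 0<ε)
    (ev-map (λ n h → subst (λ r → ε ℚ.* ε ℚ.< ℚ.∣ r ∣) (sym (ℚ.+-identityʳ (seq (normSq z) n)))
      (normℚ-apartʳ (seq (re z) n) (seq (im z) n) 0<ε
        (subst (λ r → ε ℚ.< ℚ.∣ r ∣) (ℚ.+-identityʳ (seq (im z) n)) h))) ap)

  inv : ∀ z → z # 0# → ℂ
  inv z z#0 .re = re z Real.* Real.inv (normSq z) (normSq#0 z#0)
  inv z z#0 .im = Real.- im z Real.* Real.inv (normSq z) (normSq#0 z#0)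

  _/_[_] : (z w : ℂ) → w # 0# → ℂ
  z / w [ w#0 ] = z * inv w w#0

  *-inv : ∀ {z} (p : z # 0#) → z * inv z p ≈ 1#
  *-inv {z} p = mk≈
    (Real.≈-trans (pointwise λ n → inv-re (seq (re z) n) (seq (im z) n) (seq r n))
      (Real.*-inv (normSq#0 p)))
    (pointwise λ n → inv-im (seq (re z) n) (seq (im z) n) (seq r n))
    where r = Real.inv (normSq z) (normSq#0 p)

  private

    #⇒-#0 : ∀ {z w} → z # w → z - w # 0#
    #⇒-#0 (re# p) = re# (Real.#⇒-#0 p)
    #⇒-#0 (im# p) = im# (Real.#⇒-#0 p)

    -#0⇒# : ∀ {z w} → z - w # 0# → z # w
    -#0⇒# (re# p) = re# (Real.-#0⇒# p)
    -#0⇒# (im# p) = im# (Real.-#0⇒# p)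

    *#0 : ∀ {z w} → re (z * w) Real.# Real.0# → w # 0#
    *#0 {z} {w} p = [ re# ∘ Real.*#0 , (λ q → im# (Real.*#0 (Real.neg#0 q))) ]′ (Real.+#0 p)

    #-cotrans : ∀ {z w} → z # w → ∀ v → z # v ⊎ v # w
    #-cotrans (re# p) v = Sum.map re# re# (Real.#-cotrans p (re v))
    #-cotrans (im# p) v = Sum.map im# im# (Real.#-cotrans p (im v))

    #-irrefl : ∀ {z w} → z ≈ w → ¬ z # w
    #-irrefl (mk≈ h k) (re# p) = Real.#-irrefl h p
    #-irrefl (mk≈ h k) (im# p) = Real.#-irrefl k p

    #-sym : ∀ {z w} → z # w → w # z
    #-sym (re# p) = re# (Real.#-sym p)
    #-sym (im# p) = im# (Real.#-sym p)

  heytingField : HeytingField 0ℓ 0ℓ 0ℓ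
  heytingField = record
    { Carrier = ℂ
    ; _≈_ = _≈_
    ; _#_ = _#_
    ; _+_ = _+_
    ; _*_ = _*_
    ; -_  = -_
    ; 0#  = 0#
    ; 1#  = 1#
    ; isHeytingField = record
      { isHeytingCommutativeRing = record
        { isCommutativeRing = isCommutativeRing
        ; isApartnessRelation = record { irrefl = #-irrefl ; sym = #-sym ; cotrans = #-cotrans }
        ; #⇒invertible = λ {z} {w} z#w → let d#0 = #⇒-#0 z#w in
            inv (z - w) d#0 , ≈-trans (*-comm (inv (z - w) d#0) (z - w)) (*-inv d#0) , *-inv d#0
        ; invertible⇒# = λ {z} {w} (u , u*d≈1 , _) → -#0⇒# (*#0 {u} {z - w}
            (Real.#0-resp (Real.≈-sym (_≈_.re≈ u*d≈1)) Real.1#0))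
        }
      ; tight = λ z w → (λ ¬z#w → mk≈ (Real.#-tight (¬z#w ∘ re#)) (Real.#-tight (¬z#w ∘ im#)))
                      , #-irrefl
      }
    }
    where open CommutativeRing commutativeRing using (*-comm)

  open HeytingField heytingField public using (heytingCommutativeRing)
  open HeytingProperties heytingCommutativeRing public using (1#0; x#0y#0→xy#0; #-congʳ; #-congˡ)

  open RawSemiringDefinitions (Semiring.rawSemiring (CommutativeRing.semiring commutativeRing)) public
    using (_^_; product)

  product#0 : ∀ {n} (f : Fin n → ℂ) → (∀ i → f i # 0#) → product f # 0#
  product#0 {zero}  f f#0 = 1#0
  product#0 {suc n} f f#0 = x#0y#0→xy#0 (f#0 zero) (product#0 (f ∘ suc) (f#0 ∘ suc))

  ∣∣<1⇒normSq<1 : ∀ {z} → ∣ z ∣ Real.< Real.1# → normSq z Real.< Real.1#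
  ∣∣<1⇒normSq<1 {z} (Real.mk< ε 0<ε ap) =
    let δ , 0<δ , 2δ≡ε = halve ε 0<ε
    in Real.mk< δ 0<δ (ev-zip
         (λ n a b → 1-s⇒1-p (0≤∣∣ z n) 2δ≡ε a b)
         ap (sqrt-error z δ 0<δ))

  normSq-^ : ∀ {z} → normSq z Real.< Real.1# → ∀ k → normSq (z ^ suc k) Real.< Real.1#
  normSq-^ {z} (Real.mk< ε 0<ε ap) k = Real.mk< ε 0<ε
    (ev-map (λ n h → ℚ.<-≤-trans h (ℚ.+-monoʳ-≤ 1ℚ (ℚ.neg-antimono-≤ (shrink n (p≤1 n h) k)))) ap)
    where
    N : ℂ → ℕ → ℚ
    N w n = seq (normSq w) n
    0≤N : ∀ w n → 0ℚ ℚ.≤ N w n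
    0≤N w n = 0≤normℚ (seq (re w) n) (seq (im w) n)
    p≤1 : ∀ n → ε ℚ.< 1ℚ ℚ.- N z n → N z n ℚ.≤ 1ℚ
    p≤1 n h = ℚ.<⇒≤ (0<-⇒< (ℚ.<-trans 0<ε h))
    N-* : ∀ w n → N (z * w) n ≡ N z n ℚ.* N w n
    N-* w n = normℚ-* (seq (re z) n) (seq (im z) n) (seq (re w) n) (seq (im w) n)
    shrink : ∀ n → N z n ℚ.≤ 1ℚ → ∀ k → N (z ^ suc k) n ℚ.≤ N z n
    power≤1 : ∀ n → N z n ℚ.≤ 1ℚ → ∀ k → N (z ^ k) n ℚ.≤ 1ℚ
    shrink n h k = subst₂ ℚ._≤_ (sym (N-* (z ^ k) n)) (ℚ.*-identityʳ (N z n))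
      (*-monoˡ-≤ (0≤N z n) (power≤1 n h k))
    power≤1 n h zero    = ℚ.≤-refl
    power≤1 n h (suc k) = ℚ.≤-trans (shrink n h k) h

  1-#0 : ∀ {z} → normSq z Real.< Real.1# → 1# - z # 0#
  1-#0 {z} (Real.mk< ε 0<ε ap) =
    let δ , 0<δ , 2δ≡ε = halve ε 0<ε
    in re# (Real.mk# δ 0<δ (ev-map
         (λ n h → subst (λ r → δ ℚ.< ℚ.∣ r ∣) (sym (ℚ.+-identityʳ (1ℚ ℚ.- seq (re z) n)))
           (1-norm⇒1-re (seq (re z) n) (seq (im z) n) 2δ≡ε h)) ap))

open Complex public
  using (ℂ; 0#; 1#; _+_; -_; _-_; _*_; _/_[_]; _^_; _≈_; _#_; ∣_∣; product; x#0y#0→xy#0)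
open Complex
  using (commutativeRing; ≈-sym; ≈-trans; -‿cong; 1#0; #-congʳ; product#0; 1-#0; normSq-^; ∣∣<1⇒normSq<1)

-- Unconditional summation: f summed over the indices satisfying P converges to
-- S along the net of finite sets of such indices.
HasSum : {I : Set} → (I → Set) → (I → ℂ) → ℂ → Set
HasSum {I} P f S = ∀ ε → Real.0# Real.< ε →
  ∃ λ (F₀ : List I) → All P F₀ ×
    (∀ (F : List I) → Unique F → All P F → F₀ ⊆ F →
      ∣ foldr _+_ 0# (map f F) - S ∣ Real.< ε)

-- (x ; q)_n
pochhammer : ℂ → ℂ → ℕ → ℂ
pochhammer x q n = product λ (j : Fin n) → 1# - x * q ^ toℕ j

-- Is the factor indexed by (j , k) left out of the denominator for a?  Here
-- lookup a j is a_{j+1}; of two coinciding factors (i-1 , m) and (i , 0) the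
-- second is left out.  Leaving out a factor is replacing it by 1 (see factor).
omitted : ∀ {n} → Vec ℕ n → Fin n → ℕ → Bool
omitted a zero    zero    = does (lookup a zero ℕ.≟ 0)
omitted a (suc i) zero    = does (lookup a (suc i) ℕ.≟ lookup a (inject₁ i))
omitted a j       (suc k) = false

factor : ∀ (q b : ℂ) (m : ℕ) {n} → Vec ℕ n → Fin n → ℕ → ℂ
factor q b m a j k =
  if omitted a j k then 1# else 1# + b * q ^ (toℕ j ℕ.* m ℕ.+ k ℕ.+ lookup a j)

denominator : ∀ (q b : ℂ) (m : ℕ) {n} → Vec ℕ n → ℂ
denominator q b m {n} a =
  product λ (j : Fin n) → product λ (k : Fin (suc m)) → factor q b m a j (toℕ k)

-- b ≠ - q ^ (- N) for all positive N, multiplied out so that q = 0 makes sense.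
-- ≠ is apartness: without it the quotients below cannot be formed constructively.
NonSingular : ℂ → ℂ → Set
NonSingular q b = ∀ N → .{{_ : NonZero N}} → 1# + b * q ^ N # 0#

factor#0 : ∀ {q b} m .{{_ : NonZero m}} → NonSingular q b →
           ∀ {n} (a : Vec ℕ n) j k → factor q b m a j k # 0#
factor#0 {q} {b} m ns a zero zero = if-elim (_# 0#) (lookup a zero ℕ.≟ 0)
  (λ _ → 1#0) (λ a≢0 → ns (lookup a zero) {{ℕ.≢-nonZero a≢0}})
factor#0 {q} {b} m ns a (suc i) zero =
  if-elim (_# 0#) (lookup a (suc i) ℕ.≟ lookup a (inject₁ i))
    (λ _ → 1#0) (λ _ → ns (suc (toℕ i) ℕ.* m ℕ.+ 0 ℕ.+ lookup a (suc i)) {{positive}})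
  where
  positive : NonZero (suc (toℕ i) ℕ.* m ℕ.+ 0 ℕ.+ lookup a (suc i))
  positive = ℕ.>-nonZero (ℕ.m≤n⇒m≤n+o (lookup a (suc i)) (ℕ.m≤n⇒m≤n+o 0
    (ℕ.m≤n⇒m≤n+o (toℕ i ℕ.* m) (ℕ.>-nonZero⁻¹ m))))
factor#0 {q} {b} m ns a zero (suc k) = ns (suc k ℕ.+ lookup a zero) {{ℕ.>-nonZero (ℕ.s≤s ℕ.z≤n)}}
factor#0 {q} {b} m ns a j@(suc _) (suc k) = ns (toℕ j ℕ.* m ℕ.+ suc k ℕ.+ lookup a j) {{positive}}
  where
  positive : NonZero (toℕ j ℕ.* m ℕ.+ suc k ℕ.+ lookup a j)
  positive = ℕ.>-nonZero (ℕ.m≤n⇒m≤n+o (lookup a j)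
    (ℕ.m≤n⇒m≤o+n (toℕ j ℕ.* m) (ℕ.s≤s ℕ.z≤n)))

denominator#0 : ∀ {q b} m .{{_ : NonZero m}} → NonSingular q b →
                ∀ {n} (a : Vec ℕ n) → denominator q b m a # 0#
denominator#0 m ns {n} a = product#0 {n} _ λ j → product#0 {suc m} _ λ k → factor#0 m ns a j (toℕ k)

pochhammer-q#0 : ∀ {q} → ∣ q ∣ Real.< Real.1# → ∀ m .{{_ : NonZero m}} n →
                 pochhammer (q ^ m) (q ^ m) n # 0#
pochhammer-q#0 {q} ∣q∣<1 (suc m) n = product#0 {n} _ λ j →
  1-#0 (normSq-^ {q ^ suc m} (normSq-^ {q} (∣∣<1⇒normSq<1 {q} ∣q∣<1) m) (toℕ j))

pochhammer-bq#0 : ∀ {q b} → NonSingular q b → ∀ n → pochhammer (- b * q) q n # 0#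
pochhammer-bq#0 {q} {b} ns n = product#0 {n} _ λ j →
  #-congʳ (rearrange (q ^ toℕ j)) (ns (suc (toℕ j)))
  where
  open CommutativeRing commutativeRing using (ring; +-congˡ; *-assoc)
  open import Algebra.Properties.Ring ring using (-‿distribˡ-*; -‿involutive)
  rearrange : ∀ w → 1# + b * (q * w) ≈ 1# - - b * q * w
  rearrange w = +-congˡ (≈-sym (≈-trans (-‿cong (≈-trans (*-assoc (- b) q w) (≈-sym (-‿distribˡ-* b (q * w)))))
    (-‿involutive (b * (q * w)))))

{-# OPTIONS --safe #-}

-- Put a₀ = 0, so that the factor (j , 0) is left out exactly when a_{j+1} = a_j.
-- Summing over a₁ = x first leaves a sum of the same shape in n - 1 variables, with
-- b replaced by b q^(m + x); by induction the sum over a₁ is, up to a constant,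
--   ∑_x q^(mnx) / ∏_{0 ≤ k ≤ mn} (1 + b q^(x+k)),
-- without the factor k = 0 at x = 0, and this telescopes.  Cutting the sums off at
-- entries below k gives an exact remainder, which is O(σᵏ) for some σ < 1.  The sum
-- converges absolutely because the factors 1 + b q^N are bounded away from 0, so that
-- the summand at a is O(σ^(2 ∑ a)); the summands with ∑ a ≥ k then contribute
-- O(σᵏ) by comparison with the n-th power of a geometric series.
module Submission where

open import Defs
open import Algebra.Bundles using (CommutativeMonoid; CommutativeRing; Semiring)
import Algebra.Properties.CommutativeSemiring.Exp as CommutativeExp
import Algebra.Properties.Monoid.Sum as MonoidSum
import Algebra.Properties.Ring as RingProperties
import Algebra.Properties.Semiring.Exp as Exp
import Algebra.Solver.Ring.NaturalCoefficients.Default as NatSolver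
open import Data.Bool.Base using (if_then_else_)
open import Data.Empty using (⊥-elim)
open import Data.Fin.Base using (Fin; zero; suc; toℕ)
import Data.Fin.Properties as Fin
import Data.Integer.Base as ℤ
import Data.Integer.Properties as ℤ
open import Data.List.Base
  using (List; []; _∷_; _++_; map; foldr; upTo; applyUpTo; cartesianProductWith)
open import Data.List.Membership.Propositional using (_∈_; _∉_)
open import Data.List.Membership.Propositional.Properties
  using (∈-∃++; ∈-++⁺ˡ; ∈-++⁺ʳ; ∈-map⁺; ∈-upTo⁺; ∈-cartesianProductWith⁺)
open import Data.List.Relation.Binary.Permutation.Propositional
  using (_↭_; prep; swap; ↭-refl; ↭-sym; ↭-trans; ↭⇒↭ₛ)
open import Data.List.Relation.Binary.Permutation.Propositional.Properties using (shift; ∈-resp-↭)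
import Data.List.Relation.Binary.Permutation.Setoid.Properties as SetoidPermutation
open import Data.List.Relation.Binary.Subset.Propositional using (_⊆_)
open import Data.List.Relation.Unary.All as All using (All; []; _∷_)
import Data.List.Relation.Unary.All.Properties as All
open import Data.List.Relation.Unary.AllPairs using ([]; _∷_)
open import Data.List.Relation.Unary.Any using (here; there)
open import Data.List.Relation.Unary.Unique.Propositional using (Unique)
import Data.List.Relation.Unary.Unique.Propositional.Properties as Unique
open import Data.Nat.Base as ℕ using (ℕ; zero; suc; NonZero; s≤s; z≤n)
import Data.Nat.ListAction as ℕ
import Data.Nat.Properties as ℕ
open import Data.Product.Base using (∃; _×_; _,_; proj₁; proj₂)
open import Data.Rational.Base as ℚ using (ℚ; 0ℚ; 1ℚ; ½)
import Data.Rational.Properties as ℚ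
open import Data.Rational.Solver using (module +-*-Solver)
import Data.Rational.Unnormalised.Base as ℚᵘ
import Data.Rational.Unnormalised.Properties as ℚᵘ
open import Data.Sum.Base using (_⊎_; inj₁; inj₂)
open import Data.Vec.Base as Vec using (Vec; []; _∷_; sum; lookup)
open import Data.Vec.Properties using (∷-injectiveʳ)
open import Data.Vec.Relation.Unary.Linked as Linked using (Linked; []; [-]; _∷_)
open import Function.Base using (id; _∘_)
open import Relation.Binary.PropositionalEquality as ≡
  using (_≡_; _≢_; refl; subst; subst₂; cong; cong₂)
open import Relation.Nullary using (¬_; Dec; yes; no; does; contradiction)
open import Relation.Nullary.Decidable using (from-yes)

open RationalFacts
open Complex using (re; im; inv; *-inv; normSq; re#; im#)
open Real using (seq; Eventually; ev-map; ev-zip; always)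
open Exp (CommutativeRing.semiring ℚ.+-*-commutativeRing) using ()
  renaming (_^_ to infixr 8 _^ℚ_; ^-homo-* to ^ℚ-homo-*)
open CommutativeExp (CommutativeRing.commutativeSemiring ℚ.+-*-commutativeRing) using ()
  renaming (^-distrib-* to ^ℚ-distrib-*)

-- The telescoping rests on one cancellation. Write M = m(n+1) and let w be the reciprocal of the
-- product of 1 + b q^(s+k) over 0 ≤ k ≤ M. Clearing the last factor gives w (1 + b q^(s+M));
-- clearing the first and multiplying by q^M gives w q^M (1 + b q^s). In the difference the terms in
-- b cancel and w (1 - q^M) is left, where 1 - q^M is the quotient of (q^m;q^m)_(n+1) by
-- (q^m;q^m)_n. The induction keeps b and q fixed and shifts exponents instead, so that one bound
-- for all 1 / (1 + b q^N) serves at every depth. Unconditional summation asks about arbitrary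
-- finite sets, while the recursion only knows boxes. A finite set containing a box is therefore
-- split: the box cancels exactly against the closed form, so that no infinite sum is ever formed.
-- Equality of numbers is equality up to a null sequence. Estimates are therefore made on squared
-- moduli of rational approximations, and passing to an equal number costs a strict inequality.

-- Finite sums over lists

module ListSum {c ℓ} (M : CommutativeMonoid c ℓ) where
  open CommutativeMonoid M hiding (refl) renaming (_≈_ to infix 4 _≋_)
  open import Algebra.Properties.CommutativeSemigroup commutativeSemigroup using (x∙yz≈y∙xz)

  ∑ : ∀ {a} {A : Set a} → List A → (A → Carrier) → Carrier
  ∑ xs f = foldr _∙_ ε (map f xs)

  module _ {a} {A : Set a} where

    ∑-++ : ∀ (xs ys : List A) f → ∑ (xs ++ ys) f ≋ ∑ xs f ∙ ∑ ys f
    ∑-++ []       ys f = sym (identityˡ (∑ ys f))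
    ∑-++ (x ∷ xs) ys f = trans (∙-congˡ (∑-++ xs ys f)) (sym (assoc (f x) (∑ xs f) (∑ ys f)))

    ∑-↭ : ∀ {xs ys : List A} → xs ↭ ys → ∀ f → ∑ xs f ≋ ∑ ys f
    ∑-↭ _↭_.refl        f = CommutativeMonoid.refl M
    ∑-↭ (prep x p)      f = ∙-congˡ (∑-↭ p f)
    ∑-↭ (swap x y p)    f = trans (∙-congˡ (∙-congˡ (∑-↭ p f))) (x∙yz≈y∙xz (f x) (f y) _)
    ∑-↭ (_↭_.trans p q) f = trans (∑-↭ p f) (∑-↭ q f)

    ∑-cong : ∀ {xs : List A} {f g} → All (λ x → f x ≋ g x) xs → ∑ xs f ≋ ∑ xs g
    ∑-cong []       = CommutativeMonoid.refl M
    ∑-cong (e ∷ es) = ∙-cong e (∑-cong es)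

  ∑-map : ∀ {a b} {A : Set a} {B : Set b} (g : A → B) xs f → ∑ (map g xs) f ≡ ∑ xs (λ x → f (g x))
  ∑-map g []       f = refl
  ∑-map g (x ∷ xs) f = ≡.cong (f (g x) ∙_) (∑-map g xs f)

module SemiringSum {c ℓ} (S : Semiring c ℓ) where
  open Semiring S hiding (refl) renaming (_+_ to _⊕_; _*_ to infixl 7 _⊛_; _≈_ to infix 4 _≋_)
  open ListSum +-commutativeMonoid

  ∑-distribˡ : ∀ {a} {A : Set a} (xs : List A) w f → ∑ xs (λ x → w ⊛ f x) ≋ w ⊛ ∑ xs f
  ∑-distribˡ []       w f = sym (zeroʳ w)
  ∑-distribˡ (x ∷ xs) w f = trans (+-congˡ (∑-distribˡ xs w f)) (sym (distribˡ w (f x) (∑ xs f)))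

-- Duplicate-free lists up to permutation

module _ {a} {A : Set a} where

  extract : ∀ {x : A} {xs} → x ∈ xs → ∃ λ ys → xs ↭ x ∷ ys
  extract {x} x∈xs with ys , zs , refl ← ∈-∃++ x∈xs = ys ++ zs , shift x ys zs

  -- Turns the inclusion of finite index sets into a splitting, along which sums separate by `∑-↭`
  -- and `∑-++`.
  ⊆⇒↭++ : ∀ {xs ys : List A} → Unique xs → xs ⊆ ys → ∃ λ zs → ys ↭ xs ++ zs
  ⊆⇒↭++ {[]}     {ys} _                _     = ys , ↭-refl
  ⊆⇒↭++ {x ∷ xs} (x∉xs ∷ xs!) xs⊆ys =
    let ys′ , ys↭ = extract (xs⊆ys (here refl))
        zs  , p   = ⊆⇒↭++ xs! λ {y} y∈xs →
          drop-head (λ x≡y → All.lookup x∉xs y∈xs x≡y) (∈-resp-↭ ys↭ (xs⊆ys (there y∈xs)))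
    in zs , ↭-trans ys↭ (prep x p)
    where
    drop-head : ∀ {y zs} → x ≢ y → y ∈ x ∷ zs → y ∈ zs
    drop-head x≢y (here y≡x) = ⊥-elim (x≢y (≡.sym y≡x))
    drop-head x≢y (there y∈) = y∈

  Unique-resp-↭ : ∀ {xs ys : List A} → xs ↭ ys → Unique xs → Unique ys
  Unique-resp-↭ p = SetoidPermutation.Unique-resp-↭ (≡.setoid A) (↭⇒↭ₛ p)

  unique-++ʳ : ∀ (xs : List A) {ys} → Unique (xs ++ ys) → Unique ys
  unique-++ʳ []       ys!        = ys!
  unique-++ʳ (x ∷ xs) (_ ∷ xys!) = unique-++ʳ xs xys!

  unique-++-disjoint : ∀ (xs : List A) {ys} → Unique (xs ++ ys) → ∀ {y} → y ∈ ys → y ∉ xs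
  unique-++-disjoint (x ∷ xs) (x∉ ∷ _)   y∈ys (here refl)  = All.lookup x∉ (∈-++⁺ʳ xs y∈ys) refl
  unique-++-disjoint (x ∷ xs) (_ ∷ xys!) y∈ys (there y∈xs) = unique-++-disjoint xs xys! y∈ys y∈xs

-- Boxes and cubes of vectors

relax-head : ∀ {p p′ n} {a : Vec ℕ n} → p ℕ.≤ p′ → Linked ℕ._≤_ (p′ ∷ a) → Linked ℕ._≤_ (p ∷ a)
relax-head p≤p′ [-]       = [-]
relax-head p≤p′ (r ∷ rs) = ℕ.≤-trans p≤p′ r ∷ rs

-- The weakly increasing vectors with entries in [p , p + k).
box : ∀ n → ℕ → ℕ → List (Vec ℕ n)
box zero    p k       = [] ∷ []
box (suc n) p zero    = []
box (suc n) p (suc k) = map (p ∷_) (box n p (suc k)) ++ box (suc n) (suc p) k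

box-linked : ∀ n p k → All (λ a → Linked ℕ._≤_ (p ∷ a)) (box n p k)
box-linked zero    p k       = [-] ∷ []
box-linked (suc n) p zero    = []
box-linked (suc n) p (suc k) = All.++⁺
  (All.map⁺ (All.map (ℕ.≤-refl ∷_) (box-linked n p (suc k))))
  (All.map (relax-head (ℕ.n≤1+n p)) (box-linked (suc n) (suc p) k))

box-unique : ∀ n p k → Unique (box n p k)
box-unique zero    p k       = [] ∷ []
box-unique (suc n) p zero    = []
box-unique (suc n) p (suc k) = Unique.++⁺
  (Unique.map⁺ ∷-injectiveʳ (box-unique n p (suc k)))
  (box-unique (suc n) (suc p) k)
  λ (∈₁ , ∈₂) → head≢
    (All.lookup (All.map⁺ {P = λ a → Vec.head a ≡ p} (All.universal (λ _ → refl) (box n p (suc k)))) ∈₁)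
    (All.lookup (box-linked (suc n) (suc p) k) ∈₂)
  where
  head≢ : ∀ {a : Vec ℕ (suc n)} → Vec.head a ≡ p → ¬ Linked ℕ._≤_ (suc p ∷ a)
  head≢ {x ∷ a} refl (r ∷ _) = ℕ.<-irrefl refl r

-- Used in contrapositive form at p = 0: a weakly increasing vector outside the box has sum at least
-- k, hence a small summand. The recursion is that of `box`, along which the upper end p + k does
-- not change.
sum<⇒∈-box : ∀ {n} p k {a : Vec ℕ n} → Linked ℕ._≤_ (p ∷ a) → Vec.sum a ℕ.< p ℕ.+ k → a ∈ box n p k
sum<⇒∈-box p k {[]} _ _ = here refl
sum<⇒∈-box p zero {x ∷ a} (p≤x ∷ _) s< = ⊥-elim (ℕ.<-irrefl refl (ℕ.<-≤-trans s<
  (ℕ.≤-trans (ℕ.≤-reflexive (ℕ.+-identityʳ p)) (ℕ.≤-trans p≤x (ℕ.m≤m+n x (Vec.sum a))))))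
sum<⇒∈-box {suc n} p (suc k) {x ∷ a} (p≤x ∷ rs) s< with ℕ.m≤n⇒m<n∨m≡n p≤x
... | inj₁ p<x  = ∈-++⁺ʳ (map (p ∷_) (box n p (suc k)))
                    (sum<⇒∈-box (suc p) k (p<x ∷ rs) (≡.subst (x ℕ.+ Vec.sum a ℕ.<_) (ℕ.+-suc p k) s<))
... | inj₂ refl = ∈-++⁺ˡ (∈-map⁺ (p ∷_)
                    (sum<⇒∈-box p (suc k) rs (ℕ.≤-<-trans (ℕ.m≤n+m (Vec.sum a) x) s<)))

cube : ∀ n → ℕ → List (Vec ℕ n)
cube zero    K = [] ∷ []
cube (suc n) K = cartesianProductWith _∷_ (upTo K) (cube n K)

sum<⇒∈-cube : ∀ {n K} (a : Vec ℕ n) → Vec.sum a ℕ.< K → a ∈ cube n K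
sum<⇒∈-cube []      _  = here refl
sum<⇒∈-cube (x ∷ a) s< = ∈-cartesianProductWith⁺ _∷_
  (∈-upTo⁺ (ℕ.≤-<-trans (ℕ.m≤m+n x (Vec.sum a)) s<))
  (sum<⇒∈-cube a (ℕ.≤-<-trans (ℕ.m≤n+m (Vec.sum a) x) s<))

⊆-cube : ∀ {n} (as : List (Vec ℕ n)) → ∃ λ K → as ⊆ cube n K
⊆-cube {n} as = suc total , λ {a} a∈as → sum<⇒∈-cube a (s≤s (bound as a∈as))
  where
  total = ℕ.sum (map Vec.sum as)
  bound : ∀ as {a : Vec ℕ n} → a ∈ as → Vec.sum a ℕ.≤ ℕ.sum (map Vec.sum as)
  bound (a ∷ as) (here refl)  = ℕ.m≤m+n (Vec.sum a) _
  bound (b ∷ as) (there a∈as) = ℕ.≤-trans (bound as a∈as) (ℕ.m≤n+m _ (Vec.sum b))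

-- Rational bounds on the absolute values of complex numbers

square-cancel-≤ : ∀ {p q} → 0ℚ ℚ.≤ q → p ℚ.* p ℚ.≤ q ℚ.* q → p ℚ.≤ q
square-cancel-≤ {p} {q} 0≤q p²≤q² with p ℚ.≤? q
... | yes p≤q = p≤q
... | no  p≰q = ⊥-elim (ℚ.<-irrefl refl (begin-strict
  p ℚ.* p  ≤⟨ p²≤q² ⟩
  q ℚ.* q  ≤⟨ *-monoʳ-≤ 0≤q (ℚ.<⇒≤ q<p) ⟩
  p ℚ.* q  <⟨ *-monoˡ-< (ℚ.≤-<-trans 0≤q q<p) q<p ⟩
  p ℚ.* p  ∎))
  where
  open ℚ.≤-Reasoning
  q<p = ℚ.≰⇒> p≰q

*-mono-≤ : ∀ {p q r s} → 0ℚ ℚ.≤ p → p ℚ.≤ q → 0ℚ ℚ.≤ r → r ℚ.≤ s → p ℚ.* r ℚ.≤ q ℚ.* s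
*-mono-≤ 0≤p p≤q 0≤r r≤s =
  ℚ.≤-trans (*-monoʳ-≤ 0≤r p≤q) (*-monoˡ-≤ (ℚ.≤-trans 0≤p p≤q) r≤s)

square-mono-≤ : ∀ {p q} → 0ℚ ℚ.≤ p → p ℚ.≤ q → p ℚ.* p ℚ.≤ q ℚ.* q
square-mono-≤ 0≤p p≤q = *-mono-≤ 0≤p p≤q 0≤p p≤q

square-mono-< : ∀ {p q} → 0ℚ ℚ.≤ p → p ℚ.< q → p ℚ.* p ℚ.< q ℚ.* q
square-mono-< {p} {q} 0≤p p<q = ℚ.≤-<-trans (*-monoˡ-≤ 0≤p (ℚ.<⇒≤ p<q))
  (subst₂ ℚ._<_ (ℚ.*-comm q p) refl (*-monoˡ-< (ℚ.≤-<-trans 0≤p p<q) p<q))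

∣p∣²≡p² : ∀ p → ℚ.∣ p ∣ ℚ.* ℚ.∣ p ∣ ≡ p ℚ.* p
∣p∣²≡p² p = ≡.trans (≡.sym (ℚ.∣p*q∣≡∣p∣*∣q∣ p p)) (ℚ.0≤p⇒∣p∣≡p (0≤p² p))

-- The squared form spares a root. In the expansion only the mixed term 2x, twice an inner product,
-- needs an argument.
normℚ-+ : ∀ {r s} a b c d → 0ℚ ℚ.≤ r → 0ℚ ℚ.≤ s →
  normℚ a b ℚ.≤ r ℚ.* r → normℚ c d ℚ.≤ s ℚ.* s →
  normℚ (a ℚ.+ c) (b ℚ.+ d) ℚ.≤ (r ℚ.+ s) ℚ.* (r ℚ.+ s)
normℚ-+ {r} {s} a b c d 0≤r 0≤s ab≤ cd≤ = begin
  normℚ (a ℚ.+ c) (b ℚ.+ d)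
    ≡⟨ solve 4 (λ a b c d → (a :+ c) :* (a :+ c) :+ (b :+ d) :* (b :+ d)
         := (a :* a :+ b :* b) :+ (c :* c :+ d :* d) :+ ((a :* c :+ b :* d) :+ (a :* c :+ b :* d))) refl a b c d ⟩
  normℚ a b ℚ.+ normℚ c d ℚ.+ (x ℚ.+ x)
    ≤⟨ ℚ.+-mono-≤ (ℚ.+-mono-≤ ab≤ cd≤) (ℚ.+-mono-≤ x≤rs x≤rs) ⟩
  r ℚ.* r ℚ.+ s ℚ.* s ℚ.+ (r ℚ.* s ℚ.+ r ℚ.* s)
    ≡⟨ solve 2 (λ r s → r :* r :+ s :* s :+ (r :* s :+ r :* s) := (r :+ s) :* (r :+ s)) refl r s ⟩
  (r ℚ.+ s) ℚ.* (r ℚ.+ s) ∎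
  where
  open ℚ.≤-Reasoning
  open +-*-Solver
  x = a ℚ.* c ℚ.+ b ℚ.* d
  y = a ℚ.* d ℚ.- b ℚ.* c
  -- Cauchy–Schwarz from Lagrange's identity.
  x≤rs : x ℚ.≤ r ℚ.* s
  x≤rs = square-cancel-≤ (0≤* 0≤r 0≤s) (begin
    x ℚ.* x                          ≡⟨ ≡.sym (ℚ.+-identityʳ _) ⟩
    x ℚ.* x ℚ.+ 0ℚ                   ≤⟨ ℚ.+-monoʳ-≤ (x ℚ.* x) (0≤p² y) ⟩
    x ℚ.* x ℚ.+ y ℚ.* y
      ≡⟨ solve 4 (λ a b c d →
           (a :* c :+ b :* d) :* (a :* c :+ b :* d) :+ (a :* d :- b :* c) :* (a :* d :- b :* c)
           := (a :* a :+ b :* b) :* (c :* c :+ d :* d)) refl a b c d ⟩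
    normℚ a b ℚ.* normℚ c d          ≤⟨ *-mono-≤ (0≤normℚ a b) ab≤ (0≤normℚ c d) cd≤ ⟩
    (r ℚ.* r) ℚ.* (s ℚ.* s)
      ≡⟨ solve 2 (λ r s → (r :* r) :* (s :* s) := (r :* s) :* (r :* s)) refl r s ⟩
    (r ℚ.* s) ℚ.* (r ℚ.* s)          ∎)

-- Both coordinates move by less than δ, so the difference has squared modulus at most 2δ² ≤ (2δ)² =
-- (s - r)², and the triangle inequality applies.
normℚ-close : ∀ {r s δ} a b a′ b′ → 0ℚ ℚ.≤ r → r ℚ.< s → δ ℚ.+ δ ≡ s ℚ.- r → normℚ a b ℚ.≤ r ℚ.* r →
  ℚ.∣ a′ ℚ.- a ∣ ℚ.< δ → ℚ.∣ b′ ℚ.- b ∣ ℚ.< δ → normℚ a′ b′ ℚ.≤ s ℚ.* s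
normℚ-close {r} {s} {δ} a b a′ b′ 0≤r r<s 2δ≡ ab≤ a′-a< b′-b< = subst₂ ℚ._≤_
  (cong₂ normℚ (add-sub a a′) (add-sub b b′))
  (cong (λ t → t ℚ.* t) (add-sub r s))
  (normℚ-+ a b (a′ ℚ.- a) (b′ ℚ.- b) 0≤r (≤⇒0≤- (ℚ.<⇒≤ r<s)) ab≤ (begin
    normℚ x y                              ≤⟨ ℚ.+-mono-≤ (square x a′-a<) (square y b′-b<) ⟩
    δ ℚ.* δ ℚ.+ δ ℚ.* δ                    ≡⟨ ≡.sym (ℚ.+-identityʳ _) ⟩
    δ ℚ.* δ ℚ.+ δ ℚ.* δ ℚ.+ 0ℚ             ≤⟨ ℚ.+-monoʳ-≤ (δ ℚ.* δ ℚ.+ δ ℚ.* δ) (0≤+ (0≤p² δ) (0≤p² δ)) ⟩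
    δ ℚ.* δ ℚ.+ δ ℚ.* δ ℚ.+ (δ ℚ.* δ ℚ.+ δ ℚ.* δ)
      ≡⟨ solve 1 (λ d → d :* d :+ d :* d :+ (d :* d :+ d :* d) := (d :+ d) :* (d :+ d)) refl δ ⟩
    (δ ℚ.+ δ) ℚ.* (δ ℚ.+ δ)                ≡⟨ cong (λ t → t ℚ.* t) 2δ≡ ⟩
    (s ℚ.- r) ℚ.* (s ℚ.- r)                ∎))
  where
  open ℚ.≤-Reasoning
  open +-*-Solver
  x = a′ ℚ.- a
  y = b′ ℚ.- b
  add-sub : ∀ x y → x ℚ.+ (y ℚ.- x) ≡ y
  add-sub = solve 2 (λ x y → x :+ (y :- x) := y) refl
  square : ∀ x → ℚ.∣ x ∣ ℚ.< δ → x ℚ.* x ℚ.≤ δ ℚ.* δ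
  square x h = subst (ℚ._≤ δ ℚ.* δ) (∣p∣²≡p² x) (square-mono-≤ (ℚ.0≤∣p∣ x) (ℚ.<⇒≤ h))

square-above : ∀ B → 0ℚ ℚ.≤ B → ∃ λ r → 0ℚ ℚ.≤ r × (∀ x → ℚ.∣ x ∣ ℚ.< B → x ℚ.≤ r ℚ.* r)
square-above B 0≤B = 1ℚ ℚ.+ B , 0≤+ {1ℚ} {B} (ℚ.<⇒≤ 0<1) 0≤B , λ x h → (begin
  x                                    ≤⟨ p≤∣p∣ x ⟩
  ℚ.∣ x ∣                              ≤⟨ ℚ.<⇒≤ h ⟩
  B                                    ≡⟨ ≡.sym (ℚ.+-identityʳ B) ⟩
  B ℚ.+ 0ℚ                             ≤⟨ ℚ.+-monoʳ-≤ B (0≤+ {1ℚ ℚ.+ B} {B ℚ.* B} (0≤+ {1ℚ} {B} (ℚ.<⇒≤ 0<1) 0≤B) (0≤p² B)) ⟩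
  B ℚ.+ (1ℚ ℚ.+ B ℚ.+ B ℚ.* B)         ≡⟨ solve 1 (λ b → b :+ (con 1ℚ :+ b :+ b :* b)
                                            := (con 1ℚ :+ b) :* (con 1ℚ :+ b)) refl B ⟩
  (1ℚ ℚ.+ B) ℚ.* (1ℚ ℚ.+ B)            ∎)
  where
  open ℚ.≤-Reasoning
  open +-*-Solver

root-bound : ∀ {r s} x y → 0ℚ ℚ.≤ r → y ℚ.≤ s ℚ.* s →
  ℚ.∣ x ℚ.* x ℚ.- y ∣ ℚ.< r ℚ.* r ℚ.- s ℚ.* s → x ℚ.< r
root-bound {r} {s} x y 0≤r h k = square-cancel-< 0≤r (subst₂ ℚ._<_
  (solve 2 (λ x y → y :+ (x :* x :- y) := x :* x) refl x y)
  (solve 2 (λ s r → s :* s :+ (r :* r :- s :* s) := r :* r) refl s r)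
  (ℚ.+-mono-≤-< h (ℚ.≤-<-trans (p≤∣p∣ (x ℚ.* x ℚ.- y)) k)))
  where open +-*-Solver

gap-left : ∀ {r g} → r ℚ.+ r ≡ g → ∀ e x → g ℚ.< e ℚ.- 0ℚ → x ℚ.< r → r ℚ.< e ℚ.- x
gap-left {r} refl e x h k = 0<-⇒< (subst (0ℚ ℚ.<_)
  (solve 3 (λ e r x → (e :- con 0ℚ :- (r :+ r)) :+ (r :- x) := e :- x :- r) refl e r x)
  (0<+ (<⇒0<- h) (<⇒0<- k)))
  where open +-*-Solver

normℚ-largeˡ : ∀ {c} a b → 0ℚ ℚ.< c → c ℚ.< ℚ.∣ a ∣ → c ℚ.* c ℚ.≤ normℚ a b
normℚ-largeˡ {c} a b 0<c h = ℚ.<⇒≤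
  (subst (c ℚ.* c ℚ.<_) (ℚ.0≤p⇒∣p∣≡p (0≤normℚ a b)) (normℚ-apartˡ a b 0<c h))

normℚ-largeʳ : ∀ {c} a b → 0ℚ ℚ.< c → c ℚ.< ℚ.∣ b ∣ → c ℚ.* c ℚ.≤ normℚ a b
normℚ-largeʳ {c} a b 0<c h = ℚ.<⇒≤
  (subst (c ℚ.* c ℚ.<_) (ℚ.0≤p⇒∣p∣≡p (0≤normℚ a b)) (normℚ-apartʳ a b 0<c h))

normℚ-neg : ∀ a b → normℚ (ℚ.- a) (ℚ.- b) ≡ normℚ a b
normℚ-neg = solve 2 (λ a b → (:- a) :* (:- a) :+ (:- b) :* (:- b) := a :* a :+ b :* b) refl
  where open +-*-Solver

-- `1-norm⇒1-re`, applied to the negated number with ½ < 1 - ¼, keeps the real part of the sum above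
-- ¼ in absolute value. The best constant is ½, but any positive one is enough.
normℚ-1+ : ∀ a b → normℚ a b ℚ.≤ ½ ℚ.* ½ → ½ ℚ.* ½ ℚ.* (½ ℚ.* ½) ℚ.≤ normℚ (1ℚ ℚ.+ a) (0ℚ ℚ.+ b)
normℚ-1+ a b h = normℚ-largeˡ (1ℚ ℚ.+ a) (0ℚ ℚ.+ b) (0<* 0<½ 0<½)
  (subst (λ t → ½ ℚ.* ½ ℚ.< ℚ.∣ t ∣)
    (solve 1 (λ a → con 1ℚ :- (:- a) := con 1ℚ :+ a) refl a)
    (1-norm⇒1-re {½} (ℚ.- a) (ℚ.- b) refl
      (ℚ.<-≤-trans (from-yes (½ ℚ.<? 1ℚ ℚ.- ½ ℚ.* ½))
        (ℚ.+-monoʳ-≤ 1ℚ (ℚ.neg-antimono-≤ (subst (ℚ._≤ ½ ℚ.* ½) (≡.sym (normℚ-neg a b)) h))))))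
  where open +-*-Solver

cofactor-bound : ∀ {c d t} → c ℚ.* d ≡ 1ℚ → ∀ x y → 0ℚ ℚ.≤ y → c ℚ.* c ℚ.≤ x → x ℚ.* y ℚ.≤ t ℚ.* t →
  y ℚ.≤ (t ℚ.* d) ℚ.* (t ℚ.* d)
cofactor-bound {c} {d} {t} cd≡1 x y 0≤y c²≤x xy≤t² = begin
  y                                    ≡⟨ ≡.sym (ℚ.*-identityˡ y) ⟩
  1ℚ ℚ.* 1ℚ ℚ.* y                      ≡⟨ cong (λ t → t ℚ.* t ℚ.* y) (≡.sym cd≡1) ⟩
  (c ℚ.* d) ℚ.* (c ℚ.* d) ℚ.* y
    ≡⟨ solve 3 (λ c d y → (c :* d) :* (c :* d) :* y := c :* c :* y :* (d :* d)) refl c d y ⟩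
  c ℚ.* c ℚ.* y ℚ.* (d ℚ.* d)          ≤⟨ *-monoʳ-≤ (0≤p² d) (*-monoʳ-≤ 0≤y c²≤x) ⟩
  x ℚ.* y ℚ.* (d ℚ.* d)                ≤⟨ *-monoʳ-≤ (0≤p² d) xy≤t² ⟩
  t ℚ.* t ℚ.* (d ℚ.* d)
    ≡⟨ solve 2 (λ t d → t :* t :* (d :* d) := t :* d :* (t :* d)) refl t d ⟩
  (t ℚ.* d) ℚ.* (t ℚ.* d)              ∎
  where
  open ℚ.≤-Reasoning
  open +-*-Solver

normSqAt : ℂ → ℕ → ℚ
normSqAt z n = normℚ (seq (re z) n) (seq (im z) n)

infix 4 _≼_ _≽_

-- A rational bound |z| ≤ r that holds for all late approximations, and hence
-- is inherited by sums and products without any loss.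
record _≼_ (z : ℂ) (r : ℚ) : Set where
  constructor mk≼
  field
    0≤bound : 0ℚ ℚ.≤ r
    bound   : Eventually (λ n → normSqAt z n ℚ.≤ r ℚ.* r)

open _≼_ using (0≤bound)

≼-weaken : ∀ {z r s} → r ℚ.≤ s → z ≼ r → z ≼ s
≼-weaken r≤s (mk≼ 0≤r ev) = mk≼ (ℚ.≤-trans 0≤r r≤s)
  (ev-map (λ _ h → ℚ.≤-trans h (square-mono-≤ 0≤r r≤s)) ev)

0≼ : ∀ {r} → 0ℚ ℚ.≤ r → 0# ≼ r
0≼ {r} 0≤r = mk≼ 0≤r (always λ _ → 0≤p² r)

1≼ : 1# ≼ 1ℚ
1≼ = mk≼ (ℚ.<⇒≤ 0<1) (always λ _ → ℚ.≤-refl)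

≼-+ : ∀ {z w r s} → z ≼ r → w ≼ s → z + w ≼ r ℚ.+ s
≼-+ {z} {w} (mk≼ 0≤r hz) (mk≼ 0≤s hw) = mk≼ (0≤+ 0≤r 0≤s) (ev-zip
  (λ n → normℚ-+ (seq (re z) n) (seq (im z) n) (seq (re w) n) (seq (im w) n) 0≤r 0≤s) hz hw)

normSqAt-* : ∀ z w n → normSqAt (z * w) n ≡ normSqAt z n ℚ.* normSqAt w n
normSqAt-* z w n = normℚ-* (seq (re z) n) (seq (im z) n) (seq (re w) n) (seq (im w) n)

≼-* : ∀ {z w r s} → z ≼ r → w ≼ s → z * w ≼ r ℚ.* s
≼-* {z} {w} {r} {s} (mk≼ 0≤r hz) (mk≼ 0≤s hw) = mk≼ (0≤* 0≤r 0≤s) (ev-zip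
  (λ n a b → subst₂ ℚ._≤_ (≡.sym (normSqAt-* z w n))
    (solve 2 (λ r s → (r :* r) :* (s :* s) := (r :* s) :* (r :* s)) refl r s)
    (*-mono-≤ (0≤normℚ (seq (re z) n) (seq (im z) n)) a
              (0≤normℚ (seq (re w) n) (seq (im w) n)) b)) hz hw)
  where open +-*-Solver

≼-neg : ∀ {z r} → z ≼ r → - z ≼ r
≼-neg {z} {r} (mk≼ 0≤r h) = mk≼ 0≤r (ev-map
  (λ n → subst (ℚ._≤ r ℚ.* r) (≡.sym (normℚ-neg (seq (re z) n) (seq (im z) n)))) h)

≼-^ : ∀ {z r} → z ≼ r → ∀ n → z ^ n ≼ r ^ℚ n
≼-^ z≼r zero    = 1≼
≼-^ z≼r (suc n) = ≼-* z≼r (≼-^ z≼r n)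

-- Approximations of equal numbers only come close eventually, so the bound has to grow strictly;
-- the gap s - r absorbs the difference.
≼-resp-≈ : ∀ {z w r s} → z ≈ w → r ℚ.< s → z ≼ r → w ≼ s
≼-resp-≈ {z} {w} {r} {s} z≈w r<s (mk≼ 0≤r hz) = go (Complex.≈-sym {z} {w} z≈w) (halve (s ℚ.- r) (<⇒0<- r<s))
  where
  go : w ≈ z → (∃ λ δ → 0ℚ ℚ.< δ × δ ℚ.+ δ ≡ s ℚ.- r) → w ≼ s
  go (Complex.mk≈ (Real.mk≈ re≈) (Real.mk≈ im≈)) (δ , 0<δ , 2δ≡) = mk≼ (ℚ.≤-trans 0≤r (ℚ.<⇒≤ r<s))
    (ev-zip (λ n h (k , l) → normℚ-close (seq (re z) n) (seq (im z) n) (seq (re w) n) (seq (im w) n)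
        0≤r r<s 2δ≡ h k l)
      hz (ev-zip (λ _ → _,_) (re≈ δ 0<δ) (im≈ δ 0<δ)))

≼-bounded : ∀ z → ∃ λ r → z ≼ r
≼-bounded z =
  let B , 0<B , ev = Real.bounded (normSq z)
      r , 0≤r , r² = square-above B (ℚ.<⇒≤ 0<B)
  in r , mk≼ 0≤r (ev-map (λ n → r² (normSqAt z n)) ev)

-- `∣∣²` controls only the square of the modulus, so s < r is passed to s² < r². Half of the gap of
-- ε bounds the modulus, the other half witnesses the strict inequality.
∣∣<-from-≼ : ∀ {ε} (0<ε : Real.0# Real.< ε) → ∃ λ r → 0ℚ ℚ.< r × (∀ {z s} → s ℚ.< r → z ≼ s → ∣ z ∣ Real.< ε)
∣∣<-from-≼ {ε} (Real.mk< g 0<g ap) = go (halve g 0<g)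
  where
  go : (∃ λ δ → 0ℚ ℚ.< δ × δ ℚ.+ δ ≡ g) → ∃ λ r → 0ℚ ℚ.< r × (∀ {z s} → s ℚ.< r → z ≼ s → ∣ z ∣ Real.< ε)
  go (r , 0<r , 2r≡g) = r , 0<r , λ {z} {s} s<r (mk≼ 0≤s hz) → Real.mk< r 0<r
    (ev-zip (λ n → gap-left {r} {g} 2r≡g (seq ε n) (seq (∣ z ∣) n)) ap
      (ev-zip (λ n → root-bound {r} {s} (seq (∣ z ∣) n) (normSqAt z n) (ℚ.<⇒≤ 0<r)) hz
        (Real._≈_.null (Complex.∣∣² z) (r ℚ.* r ℚ.- s ℚ.* s) (<⇒0<- (square-mono-< 0≤s s<r)))))

record _≽_ (z : ℂ) (c : ℚ) : Set where
  constructor mk≽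
  field bound : Eventually (λ n → c ℚ.* c ℚ.≤ normSqAt z n)

≽-weaken : ∀ {z c d} → 0ℚ ℚ.≤ d → d ℚ.≤ c → z ≽ c → z ≽ d
≽-weaken 0≤d d≤c (mk≽ h) = mk≽ (ev-map (λ _ → ℚ.≤-trans (square-mono-≤ 0≤d d≤c)) h)

#0⇒≽ : ∀ {z} → z # 0# → ∃ λ c → 0ℚ ℚ.< c × z ≽ c
#0⇒≽ {z} (re# (Real.mk# c 0<c ap)) = c , 0<c , mk≽ (ev-map
  (λ n h → normℚ-largeˡ (seq (re z) n) (seq (im z) n) 0<c
    (subst (λ t → c ℚ.< ℚ.∣ t ∣) (ℚ.+-identityʳ (seq (re z) n)) h)) ap)
#0⇒≽ {z} (im# (Real.mk# c 0<c ap)) = c , 0<c , mk≽ (ev-map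
  (λ n h → normℚ-largeʳ (seq (re z) n) (seq (im z) n) 0<c
    (subst (λ t → c ℚ.< ℚ.∣ t ∣) (ℚ.+-identityʳ (seq (im z) n)) h)) ap)

1+≽ : ∀ {z} → z ≼ ½ → 1# + z ≽ ½ ℚ.* ½
1+≽ {z} (mk≼ _ h) = mk≽ (ev-map (λ n → normℚ-1+ (seq (re z) n) (seq (im z) n)) h)

-- The product `z * inv z z#0` equals 1 only up to a null sequence, hence the bound 2 for it and B =
-- 2 / c. As B depends on c alone, it serves all exponents at once in `u-bounded`.
inv-≼ : ∀ {c} → 0ℚ ℚ.< c → ∃ λ B → ∀ {z} (z#0 : z # 0#) → z ≽ c → inv z z#0 ≼ B
inv-≼ {c} 0<c = go (divide 1ℚ 0<c 0<1)
  where
  1<2 : 1ℚ ℚ.< 1ℚ ℚ.+ 1ℚ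
  1<2 = ℚ.+-monoʳ-< 1ℚ 0<1
  go : (∃ λ d → 0ℚ ℚ.< d × c ℚ.* d ≡ 1ℚ) → ∃ λ B → ∀ {z} (z#0 : z # 0#) → z ≽ c → inv z z#0 ≼ B
  go (d , 0<d , cd≡1) = (1ℚ ℚ.+ 1ℚ) ℚ.* d , λ {z} z#0 (mk≽ hz) →
    bound {z} (inv z z#0) hz (≼-resp-≈ (Complex.≈-sym {z * inv z z#0} (*-inv z#0)) 1<2 1≼)
    where
    bound : ∀ {z} w → Eventually (λ n → c ℚ.* c ℚ.≤ normSqAt z n) →
            z * w ≼ 1ℚ ℚ.+ 1ℚ → w ≼ (1ℚ ℚ.+ 1ℚ) ℚ.* d
    bound {z} w hz (mk≼ 0≤2 hp) = mk≼ (0≤* 0≤2 (ℚ.<⇒≤ 0<d)) (ev-zip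
      (λ n a b → cofactor-bound {c} {d} {1ℚ ℚ.+ 1ℚ} cd≡1 (normSqAt z n) (normSqAt w n)
        (0≤normℚ (seq (re w) n) (seq (im w) n)) a
        (subst (ℚ._≤ (1ℚ ℚ.+ 1ℚ) ℚ.* (1ℚ ℚ.+ 1ℚ)) (normSqAt-* z w n) b)) hz hp)

-- Powers of a ratio below 1

fromℕ : ℕ → ℚ
fromℕ zero    = 0ℚ
fromℕ (suc n) = 1ℚ ℚ.+ fromℕ n

toℚᵘ-fromℕ : ∀ n → ℚ.toℚᵘ (fromℕ n) ℚᵘ.≃ ℚᵘ.mkℚᵘ (ℤ.+ n) 0
toℚᵘ-fromℕ zero    = ℚᵘ.≃-refl
toℚᵘ-fromℕ (suc n) = begin
  ℚ.toℚᵘ (1ℚ ℚ.+ fromℕ n)               ≈⟨ ℚ.toℚᵘ-homo-+ 1ℚ (fromℕ n) ⟩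
  ℚᵘ.1ℚᵘ ℚᵘ.+ ℚ.toℚᵘ (fromℕ n)          ≈⟨ ℚᵘ.+-congʳ ℚᵘ.1ℚᵘ (toℚᵘ-fromℕ n) ⟩
  ℚᵘ.1ℚᵘ ℚᵘ.+ ℚᵘ.mkℚᵘ (ℤ.+ n) 0         ≈⟨ ℚᵘ.*≡* (≡.trans (ℤ.*-identityʳ _)
    (≡.trans (cong (ℤ._+_ (ℤ.+ 1)) (ℤ.*-identityʳ (ℤ.+ n))) (≡.sym (ℤ.*-identityʳ (ℤ.+ suc n))))) ⟩
  ℚᵘ.mkℚᵘ (ℤ.+ suc n) 0                 ∎
  where
  open ℚᵘ.≃-Reasoning

≤-fromℕ : ∀ p → ∃ λ n → p ℚ.≤ fromℕ n
≤-fromℕ p@(ℚ.mkℚ ℤ.-[1+ _ ] _ _) = 0 , ℚ.*≤* ℤ.-≤+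
≤-fromℕ p@(ℚ.mkℚ (ℤ.+ n) d c) = n , ℚ.toℚᵘ-cancel-≤ (ℚᵘ.≤-respʳ-≃ (ℚᵘ.≃-sym (toℚᵘ-fromℕ n))
  (ℚᵘ.*≤* (subst₂ ℤ._≤_ (ℤ.pos-* n 1) (ℤ.pos-* n (suc d)) (ℤ.+≤+ (ℕ.*-monoʳ-≤ n (s≤s z≤n))))))

common-lower : ∀ {p q} → 0ℚ ℚ.< p → 0ℚ ℚ.< q → ∃ λ r → 0ℚ ℚ.< r × r ℚ.≤ p × r ℚ.≤ q
common-lower {p} {q} 0<p 0<q with ℚ.≤-total p q
... | inj₁ p≤q = p , 0<p , ℚ.≤-refl , p≤q
... | inj₂ q≤p = q , 0<q , q≤p , ℚ.≤-refl

common-upper : ∀ p q → ∃ λ r → p ℚ.≤ r × q ℚ.≤ r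
common-upper p q with ℚ.≤-total p q
... | inj₁ p≤q = q , p≤q , ℚ.≤-refl
... | inj₂ q≤p = p , ℚ.≤-refl , q≤p

p≤p+q : ∀ p {q} → 0ℚ ℚ.≤ q → p ℚ.≤ p ℚ.+ q
p≤p+q p {q} 0≤q = subst (ℚ._≤ p ℚ.+ q) (ℚ.+-identityʳ p) (ℚ.+-monoʳ-≤ p 0≤q)

p<p+q : ∀ p {q} → 0ℚ ℚ.< q → p ℚ.< p ℚ.+ q
p<p+q p {q} 0<q = subst (ℚ._< p ℚ.+ q) (ℚ.+-identityʳ p) (ℚ.+-monoʳ-< p 0<q)

0≤fromℕ : ∀ n → 0ℚ ℚ.≤ fromℕ n
0≤fromℕ zero    = ℚ.≤-refl
0≤fromℕ (suc n) = 0≤+ {1ℚ} {fromℕ n} (ℚ.<⇒≤ 0<1) (0≤fromℕ n)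

0≤^ : ∀ {p} → 0ℚ ℚ.≤ p → ∀ n → 0ℚ ℚ.≤ p ^ℚ n
0≤^ 0≤p zero    = ℚ.<⇒≤ 0<1
0≤^ 0≤p (suc n) = 0≤* 0≤p (0≤^ 0≤p n)

-- A ratio σ = 1 - θ of a convergent geometric series.
record Ratio : Set where
  field
    σ θ   : ℚ
    0<σ   : 0ℚ ℚ.< σ
    0<θ   : 0ℚ ℚ.< θ
    σ+θ≡1 : σ ℚ.+ θ ≡ 1ℚ

  0≤σ : 0ℚ ℚ.≤ σ
  0≤σ = ℚ.<⇒≤ 0<σ

  σ≤1 : σ ℚ.≤ 1ℚ
  σ≤1 = subst (σ ℚ.≤_) σ+θ≡1 (p≤p+q σ (ℚ.<⇒≤ 0<θ))

  σ*σ≤σ : σ ℚ.* σ ℚ.≤ σ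
  σ*σ≤σ = subst (σ ℚ.* σ ℚ.≤_) (ℚ.*-identityʳ σ) (*-monoˡ-≤ 0≤σ σ≤1)

  0<σ^ : ∀ n → 0ℚ ℚ.< σ ^ℚ n
  0<σ^ zero    = 0<1
  0<σ^ (suc n) = 0<* 0<σ (0<σ^ n)

  0≤σ^ : ∀ n → 0ℚ ℚ.≤ σ ^ℚ n
  0≤σ^ n = ℚ.<⇒≤ (0<σ^ n)

  σ^≤1 : ∀ n → σ ^ℚ n ℚ.≤ 1ℚ
  σ^≤1 zero    = ℚ.≤-refl
  σ^≤1 (suc n) = subst (σ ^ℚ suc n ℚ.≤_) (ℚ.*-identityˡ 1ℚ) (*-mono-≤ 0≤σ σ≤1 (0≤σ^ n) (σ^≤1 n))

  σ^-antitone : ∀ {m n} → m ℕ.≤ n → σ ^ℚ n ℚ.≤ σ ^ℚ m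
  σ^-antitone {m} {n} m≤n with k , refl ← ℕ.m≤n⇒∃[o]m+o≡n m≤n = subst₂ ℚ._≤_
    (≡.sym (^ℚ-homo-* σ m k)) (ℚ.*-identityʳ (σ ^ℚ m)) (*-monoˡ-≤ (0≤σ^ m) (σ^≤1 k))

  -- Bernoulli's inequality in product form: (1 + (n+1)θ)(1 - θ) falls short of 1 + nθ by (n+1)θ²,
  -- which times `s` is the term added in the first step.
  bernoulli : ∀ n → (1ℚ ℚ.+ fromℕ n ℚ.* θ) ℚ.* σ ^ℚ n ℚ.≤ 1ℚ
  bernoulli zero    = ℚ.≤-reflexive (≡.trans (ℚ.*-identityʳ (1ℚ ℚ.+ 0ℚ ℚ.* θ))
    (≡.trans (cong (1ℚ ℚ.+_) (ℚ.*-zeroˡ θ)) (ℚ.+-identityʳ 1ℚ)))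
  bernoulli (suc n) = begin
    (1ℚ ℚ.+ (1ℚ ℚ.+ f) ℚ.* θ) ℚ.* (σ ℚ.* s)
      ≤⟨ p≤p+q ((1ℚ ℚ.+ (1ℚ ℚ.+ f) ℚ.* θ) ℚ.* (σ ℚ.* s)) (0≤* (0≤* 0≤θ (0≤+ 0≤θ (0≤* (0≤fromℕ n) 0≤θ))) (0≤σ^ n)) ⟩
    (1ℚ ℚ.+ (1ℚ ℚ.+ f) ℚ.* θ) ℚ.* (σ ℚ.* s) ℚ.+ θ ℚ.* (θ ℚ.+ f ℚ.* θ) ℚ.* s
      ≡⟨ cong (λ r → (1ℚ ℚ.+ (1ℚ ℚ.+ f) ℚ.* θ) ℚ.* (r ℚ.* s) ℚ.+ θ ℚ.* (θ ℚ.+ f ℚ.* θ) ℚ.* s) σ≡1-θ ⟩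
    (1ℚ ℚ.+ (1ℚ ℚ.+ f) ℚ.* θ) ℚ.* ((1ℚ ℚ.- θ) ℚ.* s) ℚ.+ θ ℚ.* (θ ℚ.+ f ℚ.* θ) ℚ.* s
      ≡⟨ solve 3 (λ f t x → (con 1ℚ :+ (con 1ℚ :+ f) :* t) :* ((con 1ℚ :- t) :* x) :+ t :* (t :+ f :* t) :* x
            := (con 1ℚ :+ f :* t) :* x) refl f θ s ⟩
    (1ℚ ℚ.+ f ℚ.* θ) ℚ.* s
      ≤⟨ bernoulli n ⟩
    1ℚ ∎
    where
    open ℚ.≤-Reasoning
    open +-*-Solver
    f = fromℕ n
    s = σ ^ℚ n
    0≤θ = ℚ.<⇒≤ 0<θ
    σ≡1-θ : σ ≡ 1ℚ ℚ.- θ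
    σ≡1-θ = ≡.trans (solve 2 (λ s t → s := s :+ t :- t) refl σ θ) (cong (ℚ._- θ) σ+θ≡1)

  σ^-vanishes : ∀ C {η} → 0ℚ ℚ.≤ C → 0ℚ ℚ.< η → ∃ λ k → C ℚ.* σ ^ℚ k ℚ.< η
  σ^-vanishes C {η} 0≤C 0<η =
    -- C may be 0, whereas `divide` asks for a positive number; hence D = C + 1. The exponent k is
    -- any natural number above D / (ηθ).
    let D , 0<D , C≤D = above
        X , _ , ηθX≡D = divide {η ℚ.* θ} D (0<* 0<η 0<θ) 0<D
        k , X≤k       = ≤-fromℕ X
    in k , small k C≤D ηθX≡D X≤k
    where
    open ℚ.≤-Reasoning
    open +-*-Solver
    above : ∃ λ D → 0ℚ ℚ.< D × C ℚ.≤ D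
    above = C ℚ.+ 1ℚ , ℚ.≤-<-trans 0≤C (p<p+q C 0<1) , p≤p+q C (ℚ.<⇒≤ 0<1)
    small : ∀ k {D X} → C ℚ.≤ D → η ℚ.* θ ℚ.* X ≡ D → X ℚ.≤ fromℕ k → C ℚ.* σ ^ℚ k ℚ.< η
    small k {D} {X} C≤D ηθX≡D X≤k = begin-strict
      C ℚ.* s                            ≤⟨ *-monoʳ-≤ (0≤σ^ k) C≤D ⟩
      D ℚ.* s                            ≡⟨ cong (ℚ._* s) (≡.sym ηθX≡D) ⟩
      η ℚ.* θ ℚ.* X ℚ.* s                ≤⟨ *-monoʳ-≤ (0≤σ^ k) (*-monoˡ-≤ (ℚ.<⇒≤ (0<* 0<η 0<θ)) X≤k) ⟩
      η ℚ.* θ ℚ.* f ℚ.* s                <⟨ p<p+q (η ℚ.* θ ℚ.* f ℚ.* s) (0<* 0<η (0<σ^ k)) ⟩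
      η ℚ.* θ ℚ.* f ℚ.* s ℚ.+ η ℚ.* s    ≡⟨ solve 4 (λ e t f s → e :* t :* f :* s :+ e :* s
                                               := e :* ((con 1ℚ :+ f :* t) :* s)) refl η θ f s ⟩
      η ℚ.* ((1ℚ ℚ.+ f ℚ.* θ) ℚ.* s)     ≤⟨ *-monoˡ-≤ (ℚ.<⇒≤ 0<η) (bernoulli k) ⟩
      η ℚ.* 1ℚ                           ≡⟨ ℚ.*-identityʳ η ⟩
      η                                  ∎
      where
      f = fromℕ k
      s = σ ^ℚ k

  -- D is the sum of the geometric series; the equation says that removing its first term multiplies
  -- it by σ.
  1/θ : ∃ λ D → 0ℚ ℚ.< D × 1ℚ ℚ.+ D ℚ.* σ ≡ D
  1/θ with divide 1ℚ 0<θ 0<1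
  ... | D , 0<D , θD≡1 = D , 0<D , (begin
    1ℚ ℚ.+ D ℚ.* σ       ≡⟨ cong (ℚ._+ D ℚ.* σ) (≡.sym θD≡1) ⟩
    θ ℚ.* D ℚ.+ D ℚ.* σ  ≡⟨ solve 3 (λ t d s → t :* d :+ d :* s := d :* (s :+ t)) refl θ D σ ⟩
    D ℚ.* (σ ℚ.+ θ)      ≡⟨ cong (D ℚ.*_) σ+θ≡1 ⟩
    D ℚ.* 1ℚ             ≡⟨ ℚ.*-identityʳ D ⟩
    D                    ∎)
    where
    open ≡.≡-Reasoning
    open +-*-Solver

-- Bounds for the powers of q and for the factors of the denominator

≼-σ^ : ∀ (R : Ratio) {q} → let open Ratio R in q ≼ σ → ∀ {m n} → m ℕ.≤ n → q ^ n ≼ σ ^ℚ m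
≼-σ^ R q≼σ {n = n} m≤n = ≼-weaken (Ratio.σ^-antitone R m≤n) (≼-^ q≼σ n)

-- Because 1 - 4θ ≤ (1 - 2θ)² and 0 ≤ 1 - 2θ ≤ (1 - θ)². The fourth power arises as x is a squared
-- modulus to be compared with (σ²)².
1-4θ≤[1-θ]⁴ : ∀ {θ} x → 0ℚ ℚ.≤ θ → (θ ℚ.+ θ) ℚ.+ (θ ℚ.+ θ) ℚ.≤ 1ℚ → (θ ℚ.+ θ) ℚ.+ (θ ℚ.+ θ) ℚ.≤ 1ℚ ℚ.- x →
  let σ = 1ℚ ℚ.- θ in x ℚ.≤ (σ ℚ.* σ) ℚ.* (σ ℚ.* σ)
1-4θ≤[1-θ]⁴ {θ} x 0≤θ 4θ≤1 4θ≤1-x = begin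
  x
    ≤⟨ p≤p+q x (0≤+ (≤⇒0≤- 4θ≤1-x) (0≤p² (θ ℚ.+ θ))) ⟩
  x ℚ.+ (1ℚ ℚ.- x ℚ.- ((θ ℚ.+ θ) ℚ.+ (θ ℚ.+ θ)) ℚ.+ (θ ℚ.+ θ) ℚ.* (θ ℚ.+ θ))
    ≡⟨ solve 2 (λ x t → x :+ (con 1ℚ :- x :- ((t :+ t) :+ (t :+ t)) :+ (t :+ t) :* (t :+ t))
         := (con 1ℚ :- (t :+ t)) :* (con 1ℚ :- (t :+ t))) refl x θ ⟩
  τ ℚ.* τ
    ≤⟨ square-mono-≤ 0≤τ τ≤σ² ⟩
  (σ ℚ.* σ) ℚ.* (σ ℚ.* σ) ∎
  where
  open ℚ.≤-Reasoning
  open +-*-Solver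
  σ = 1ℚ ℚ.- θ
  τ = 1ℚ ℚ.- (θ ℚ.+ θ)
  0≤τ : 0ℚ ℚ.≤ τ
  0≤τ = ≤⇒0≤- (ℚ.≤-trans (p≤p+q (θ ℚ.+ θ) (0≤+ 0≤θ 0≤θ)) 4θ≤1)
  τ≤σ² : τ ℚ.≤ σ ℚ.* σ
  τ≤σ² = subst (τ ℚ.≤_) (solve 1 (λ t → con 1ℚ :- (t :+ t) :+ t :* t := (con 1ℚ :- t) :* (con 1ℚ :- t)) refl θ)
    (p≤p+q τ (0≤p² θ))

<1-x⇒<1 : ∀ {p} x → 0ℚ ℚ.≤ x → p ℚ.< 1ℚ ℚ.- x → p ℚ.< 1ℚ
<1-x⇒<1 {p} x 0≤x p<1-x = ℚ.<-≤-trans p<1-x (subst (1ℚ ℚ.- x ℚ.≤_)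
  (solve 1 (λ x → con 1ℚ :- x :+ x := con 1ℚ) refl x) (p≤p+q (1ℚ ℚ.- x) 0≤x))
  where open +-*-Solver

quarter-ratio : ∀ {θ} → 0ℚ ℚ.< θ → (θ ℚ.+ θ) ℚ.+ (θ ℚ.+ θ) ℚ.< 1ℚ → Ratio
quarter-ratio {θ} 0<θ 4θ<1 = record
  { σ     = 1ℚ ℚ.- θ
  ; θ     = θ
  ; 0<σ   = <⇒0<- {θ} {1ℚ} (ℚ.<-trans (ℚ.<-trans (p<p+q θ 0<θ) (p<p+q (θ ℚ.+ θ) (0<+ 0<θ 0<θ))) 4θ<1)
  ; 0<θ   = 0<θ
  ; σ+θ≡1 = solve 1 (λ t → con 1ℚ :- t :+ t := con 1ℚ) refl θ
  }
  where open +-*-Solver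

∣∣<1⇒ratio : ∀ {q} → ∣ q ∣ Real.< Real.1# → ∃ λ (R : Ratio) → let open Ratio R in q ≼ σ ℚ.* σ
∣∣<1⇒ratio {q} ∣q∣<1 = go (Complex.∣∣<1⇒normSq<1 {q} ∣q∣<1)
  where
  go : normSq q Real.< Real.1# → ∃ λ (R : Ratio) → let open Ratio R in q ≼ σ ℚ.* σ
  go (Real.mk< δ 0<δ (n₀ , gap)) = θ-bound (quarter δ 0<δ)
    where
    δ<1 : δ ℚ.< 1ℚ
    δ<1 = <1-x⇒<1 (normSqAt q n₀) (0≤normℚ (seq (re q) n₀) (seq (im q) n₀)) (gap n₀ ℕ.≤-refl)
    θ-bound : (∃ λ θ → 0ℚ ℚ.< θ × (θ ℚ.+ θ) ℚ.+ (θ ℚ.+ θ) ≡ δ) →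
              ∃ λ (R : Ratio) → let open Ratio R in q ≼ σ ℚ.* σ
    θ-bound (θ , 0<θ , 4θ≡δ) = quarter-ratio 0<θ 4θ<1 , mk≼ (0≤p² (1ℚ ℚ.- θ))
      (n₀ , λ n n₀≤n → 1-4θ≤[1-θ]⁴ (normSqAt q n) (ℚ.<⇒≤ 0<θ) (ℚ.<⇒≤ 4θ<1)
        (ℚ.≤-trans (ℚ.≤-reflexive 4θ≡δ) (ℚ.<⇒≤ (gap n n₀≤n))))
      where
      4θ<1 : (θ ℚ.+ θ) ℚ.+ (θ ℚ.+ θ) ℚ.< 1ℚ
      4θ<1 = ℚ.≤-<-trans (ℚ.≤-reflexive 4θ≡δ) δ<1

-- From some k on, b q^n has modulus at most ½ and the constant ¼ works. Below k there are finitely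
-- many exponents, each with a constant of its own by `NonSingular`, and a common lower bound is
-- taken.
1+bq^-≽ : ∀ {q b} (R : Ratio) → let open Ratio R in q ≼ σ → NonSingular q b →
  ∃ λ c → 0ℚ ℚ.< c × (∀ n → .{{_ : NonZero n}} → 1# + b * q ^ n ≽ c)
1+bq^-≽ {q} {b} R q≼σ ns =
  let β , b≼β             = ≼-bounded b
      k , βσ^k<½          = σ^-vanishes β (0≤bound b≼β) 0<½
      c₁ , 0<c₁ , small   = first k
      c , 0<c , c≤c₁ , c≤ = common-lower 0<c₁ (0<* 0<½ 0<½)
  in c , 0<c , combine 0<c c≤c₁ c≤ small
       (λ m k≤m → ≼-weaken (ℚ.<⇒≤ βσ^k<½) (≼-* b≼β (≼-σ^ R q≼σ k≤m)))
  where
  open Ratio R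
  first : ∀ k → ∃ λ c → 0ℚ ℚ.< c × (∀ n → .{{_ : NonZero n}} → n ℕ.< k → 1# + b * q ^ n ≽ c)
  first zero            = 1ℚ , 0<1 , λ n ()
  -- The exponent 0 is excluded, as 1 + b may vanish; so no exponent is left and any constant will
  -- do.
  first (suc zero)      = 1ℚ , 0<1 , λ { (suc n) (s≤s ()) }
  first (suc k@(suc _)) =
    let c₁ , 0<c₁ , h         = first k
        c₂ , 0<c₂ , l         = #0⇒≽ (ns k)
        c , 0<c , c≤c₁ , c≤c₂ = common-lower 0<c₁ 0<c₂
    in c , 0<c , λ n n<1+k → extend (ℚ.<⇒≤ 0<c) c≤c₁ c≤c₂ h l n (ℕ.m<1+n⇒m<n∨m≡n n<1+k)
    where
    extend : ∀ {c c₁ c₂} → 0ℚ ℚ.≤ c → c ℚ.≤ c₁ → c ℚ.≤ c₂ →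
      (∀ n → .{{_ : NonZero n}} → n ℕ.< k → 1# + b * q ^ n ≽ c₁) → 1# + b * q ^ k ≽ c₂ →
      ∀ n → .{{_ : NonZero n}} → n ℕ.< k ⊎ n ≡ k → 1# + b * q ^ n ≽ c
    extend 0≤c c≤c₁ c≤c₂ h l n (inj₁ n<k)  = ≽-weaken 0≤c c≤c₁ (h n n<k)
    extend 0≤c c≤c₁ c≤c₂ h l n (inj₂ refl) = ≽-weaken 0≤c c≤c₂ l
  combine : ∀ {k c c₁} → 0ℚ ℚ.< c → c ℚ.≤ c₁ → c ℚ.≤ ½ ℚ.* ½ →
    (∀ n → .{{_ : NonZero n}} → n ℕ.< k → 1# + b * q ^ n ≽ c₁) → (∀ n → k ℕ.≤ n → b * q ^ n ≼ ½) →
    ∀ n → .{{_ : NonZero n}} → 1# + b * q ^ n ≽ c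
  combine {k} 0<c c≤c₁ c≤ small large n with n ℕ.<? k
  ... | yes n<k = ≽-weaken (ℚ.<⇒≤ 0<c) c≤c₁ (small n n<k)
  ... | no  n≮k = ≽-weaken (ℚ.<⇒≤ 0<c) c≤ (1+≽ (large n (ℕ.≮⇒≥ n≮k)))

+-cancel-difference : ∀ x y z → x + y - (x + z) ≈ y - z
+-cancel-difference x y z = Complex.pointwise≈
  (λ n → cancel (seq (re x) n) (seq (re y) n) (seq (re z) n))
  (λ n → cancel (seq (im x) n) (seq (im y) n) (seq (im z) n))
  where
  open +-*-Solver
  cancel : ∀ p q r → (p ℚ.+ q) ℚ.- (p ℚ.+ r) ≡ q ℚ.- r
  cancel = solve 3 (λ p q r → (p :+ q) :- (p :+ r) := q :- r) refl

open ListSum (CommutativeRing.+-commutativeMonoid Complex.commutativeRing) using (∑)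
open ListSum ℚ.+-0-commutativeMonoid using ()
  renaming (∑ to ∑ℚ; ∑-++ to ∑ℚ-++; ∑-↭ to ∑ℚ-↭)
open SemiringSum (CommutativeRing.semiring ℚ.+-*-commutativeRing) using ()
  renaming (∑-distribˡ to ∑ℚ-distribˡ)

-- Comparison of finite sums with geometric series

∑-≼ : ∀ {A : Set} {xs : List A} {f w} → All (λ x → f x ≼ w x) xs → ∑ xs f ≼ ∑ℚ xs w
∑-≼ []       = 0≼ ℚ.≤-refl
∑-≼ (p ∷ ps) = ≼-+ p (∑-≼ ps)

module _ {A : Set} where

  0≤∑ℚ : ∀ (xs : List A) {w} → (∀ x → 0ℚ ℚ.≤ w x) → 0ℚ ℚ.≤ ∑ℚ xs w
  0≤∑ℚ []       0≤w = ℚ.≤-refl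
  0≤∑ℚ (x ∷ xs) 0≤w = 0≤+ (0≤w x) (0≤∑ℚ xs 0≤w)

  ∑ℚ-⊆ : ∀ {xs ys : List A} {w} → (∀ x → 0ℚ ℚ.≤ w x) → Unique xs → xs ⊆ ys → ∑ℚ xs w ℚ.≤ ∑ℚ ys w
  ∑ℚ-⊆ {xs} {ys} {w} 0≤w xs! xs⊆ys with zs , p ← ⊆⇒↭++ xs! xs⊆ys = subst (∑ℚ xs w ℚ.≤_)
    (≡.sym (≡.trans (∑ℚ-↭ p w) (∑ℚ-++ xs zs w))) (p≤p+q (∑ℚ xs w) (0≤∑ℚ zs 0≤w))

module Geometric (R : Ratio) where
  open Ratio R

  D : ℚ
  D = proj₁ 1/θ

  0≤D : 0ℚ ℚ.≤ D
  0≤D = ℚ.<⇒≤ (proj₁ (proj₂ 1/θ))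

  1+Dσ≡D : 1ℚ ℚ.+ D ℚ.* σ ≡ D
  1+Dσ≡D = proj₂ (proj₂ 1/θ)

  D-step : ∀ s → s ℚ.+ D ℚ.* (σ ℚ.* s) ≡ D ℚ.* s
  D-step s = ≡.trans (solve 3 (λ d σ s → s :+ d :* (σ :* s) := (con 1ℚ :+ d :* σ) :* s) refl D σ s)
    (cong (ℚ._* s) 1+Dσ≡D)
    where open +-*-Solver

  -- The tail of `upTo` is an `applyUpTo` of a shifted function, hence the general f. Each term is
  -- at most σ times its predecessor, and `D-step` closes the induction.
  ∑-powers : ∀ f n → (∀ i → σ ^ℚ f (suc i) ℚ.≤ σ ^ℚ suc (f i)) → ∑ℚ (applyUpTo f n) (σ ^ℚ_) ℚ.≤ D ℚ.* σ ^ℚ f 0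
  ∑-powers f zero    _    = 0≤* 0≤D (0≤σ^ (f 0))
  ∑-powers f (suc n) step = begin
    σ ^ℚ f 0 ℚ.+ ∑ℚ (applyUpTo (f ∘ suc) n) (σ ^ℚ_)
      ≤⟨ ℚ.+-monoʳ-≤ (σ ^ℚ f 0) (∑-powers (f ∘ suc) n (step ∘ suc)) ⟩
    σ ^ℚ f 0 ℚ.+ D ℚ.* σ ^ℚ f 1
      ≤⟨ ℚ.+-monoʳ-≤ (σ ^ℚ f 0) (*-monoˡ-≤ 0≤D (step 0)) ⟩
    σ ^ℚ f 0 ℚ.+ D ℚ.* (σ ℚ.* σ ^ℚ f 0)
      ≡⟨ D-step (σ ^ℚ f 0) ⟩
    D ℚ.* σ ^ℚ f 0 ∎
    where open ℚ.≤-Reasoning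

  weight : ∀ {n} → Vec ℕ n → ℚ
  weight a = σ ^ℚ Vec.sum a

  -- The weight is multiplicative in the entries, which makes a sum over a cube a product of
  -- truncated geometric series.
  ∑-product : ∀ {n} xs (as : List (Vec ℕ n)) →
    ∑ℚ (cartesianProductWith _∷_ xs as) weight ≡ ∑ℚ xs (σ ^ℚ_) ℚ.* ∑ℚ as weight
  ∑-product []       as = ≡.sym (ℚ.*-zeroˡ (∑ℚ as weight))
  ∑-product (x ∷ xs) as = begin
    ∑ℚ (map (x ∷_) as ++ cartesianProductWith _∷_ xs as) weight
      ≡⟨ ∑ℚ-++ (map (x ∷_) as) (cartesianProductWith _∷_ xs as) weight ⟩
    ∑ℚ (map (x ∷_) as) weight ℚ.+ ∑ℚ (cartesianProductWith _∷_ xs as) weight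
      ≡⟨ cong₂ ℚ._+_ (first as) (∑-product xs as) ⟩
    σ ^ℚ x ℚ.* ∑ℚ as weight ℚ.+ ∑ℚ xs (σ ^ℚ_) ℚ.* ∑ℚ as weight
      ≡⟨ ≡.sym (ℚ.*-distribʳ-+ (∑ℚ as weight) (σ ^ℚ x) (∑ℚ xs (σ ^ℚ_))) ⟩
    (σ ^ℚ x ℚ.+ ∑ℚ xs (σ ^ℚ_)) ℚ.* ∑ℚ as weight ∎
    where
    open ≡.≡-Reasoning
    first : ∀ as → ∑ℚ (map (x ∷_) as) weight ≡ σ ^ℚ x ℚ.* ∑ℚ as weight
    first []       = ≡.sym (ℚ.*-zeroʳ (σ ^ℚ x))
    first (a ∷ as) = ≡.trans (cong₂ ℚ._+_ (^ℚ-homo-* σ x (Vec.sum a)) (first as))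
      (≡.sym (ℚ.*-distribˡ-+ (σ ^ℚ x) (weight a) (∑ℚ as weight)))

  ∑-cube : ∀ n K → ∑ℚ (cube n K) weight ℚ.≤ D ^ℚ n
  ∑-cube zero    K = ℚ.≤-reflexive (ℚ.+-identityʳ 1ℚ)
  ∑-cube (suc n) K = subst (ℚ._≤ D ℚ.* D ^ℚ n) (≡.sym (∑-product (upTo K) (cube n K)))
    (*-mono-≤ (0≤∑ℚ (upTo K) 0≤σ^)
      (subst (∑ℚ (upTo K) (σ ^ℚ_) ℚ.≤_) (ℚ.*-identityʳ D) (∑-powers id K (λ _ → ℚ.≤-refl)))
      (0≤∑ℚ (cube n K) (λ a → 0≤σ^ (Vec.sum a))) (∑-cube n K))

  -- Finitely many vectors lie in some cube, the vectors added have nonnegative weight, and the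
  -- bound for cubes does not depend on their size.
  ∑-weight : ∀ {n} {as : List (Vec ℕ n)} → Unique as → ∑ℚ as weight ℚ.≤ D ^ℚ n
  ∑-weight {n} {as} as! with K , as⊆ ← ⊆-cube as =
    ℚ.≤-trans (∑ℚ-⊆ (λ a → 0≤σ^ (Vec.sum a)) as! as⊆) (∑-cube n K)

  ≼-^² : ∀ {q} → q ≼ σ ℚ.* σ → ∀ {m n} → m ℕ.≤ n → q ^ n ≼ σ ^ℚ m ℚ.* σ ^ℚ m
  ≼-^² {q} q≼ {m} {n} m≤n = ≼-weaken
    (ℚ.≤-trans (ℚ.≤-reflexive (^ℚ-distrib-* σ σ n)) (square-mono-≤ (0≤σ^ n) (σ^-antitone m≤n)))
    (≼-^ q≼ n)

-- Arithmetic of the constants in the estimates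

module _ where
  open +-*-Solver
  open ℚ.≤-Reasoning

  swap-last : ∀ p q r → p ℚ.* q ℚ.* r ≡ p ℚ.* r ℚ.* q
  swap-last = solve 3 (λ p q r → p :* q :* r := p :* r :* q) refl

  T-constants : ∀ b h k s w →
    b ℚ.* ((s ℚ.* s ℚ.* h) ℚ.* (k ℚ.* (w ℚ.* w))) ≡ b ℚ.* h ℚ.* k ℚ.* ((s ℚ.* w) ℚ.* (s ℚ.* w))
  T-constants = solve 5 (λ b h k s w →
    b :* ((s :* s :* h) :* (k :* (w :* w))) := b :* h :* k :* ((s :* w) :* (s :* w))) refl

  S-constants : ∀ {g s b} → 0ℚ ℚ.≤ g → 0ℚ ℚ.≤ b → s ℚ.* s ℚ.≤ s → g ℚ.* (s ℚ.* s) ℚ.* b ℚ.≤ s ℚ.* (g ℚ.* b)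
  S-constants {g} {s} {b} 0≤g 0≤b s²≤s = begin
    g ℚ.* (s ℚ.* s) ℚ.* b  ≤⟨ *-monoʳ-≤ 0≤b (*-monoˡ-≤ 0≤g s²≤s) ⟩
    g ℚ.* s ℚ.* b          ≡⟨ solve 3 (λ g s b → g :* s :* b := s :* (g :* b)) refl g s b ⟩
    s ℚ.* (g ℚ.* b)        ∎

  E⁺-constants : ∀ b s h c t c₀ d r → s ℚ.+ d ℚ.* (r ℚ.* s) ≡ d ℚ.* s →
    b ℚ.* ((s ℚ.* h) ℚ.* (c ℚ.* t)) ℚ.+ t ℚ.* (c₀ ℚ.+ b ℚ.* (h ℚ.* c) ℚ.* (d ℚ.* (r ℚ.* s)))
      ≡ t ℚ.* (c₀ ℚ.+ b ℚ.* (h ℚ.* c) ℚ.* (d ℚ.* s))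
  E⁺-constants b s h c t c₀ d r step = ≡.trans
    (solve 7 (λ b s h c t c₀ x →
      b :* ((s :* h) :* (c :* t)) :+ t :* (c₀ :+ b :* (h :* c) :* x)
        := t :* (c₀ :+ b :* (h :* c) :* (s :+ x))) refl b s h c t c₀ (d ℚ.* (r ℚ.* s)))
    (cong (λ x → t ℚ.* (c₀ ℚ.+ b ℚ.* (h ℚ.* c) ℚ.* x)) step)

  E-constants₀ : ∀ {c₀ c₁ d t} → 0ℚ ℚ.≤ c₁ → 0ℚ ℚ.≤ d → 0ℚ ℚ.≤ t →
    t ℚ.* c₀ ℚ.≤ (c₀ ℚ.+ c₁ ℚ.* d ℚ.+ c₁) ℚ.* t
  E-constants₀ {c₀} {c₁} {d} {t} 0≤c₁ 0≤d 0≤t = begin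
    t ℚ.* c₀                             ≡⟨ ℚ.*-comm t c₀ ⟩
    c₀ ℚ.* t                             ≤⟨ *-monoʳ-≤ 0≤t (p≤p+q c₀ (0≤+ (0≤* 0≤c₁ 0≤d) 0≤c₁)) ⟩
    (c₀ ℚ.+ (c₁ ℚ.* d ℚ.+ c₁)) ℚ.* t     ≡⟨ cong (ℚ._* t) (≡.sym (ℚ.+-assoc c₀ (c₁ ℚ.* d) c₁)) ⟩
    (c₀ ℚ.+ c₁ ℚ.* d ℚ.+ c₁) ℚ.* t       ∎

  p*q≤p : ∀ {p q} → 0ℚ ℚ.≤ p → q ℚ.≤ 1ℚ → p ℚ.* q ℚ.≤ p
  p*q≤p {p} {q} 0≤p q≤1 = subst (p ℚ.* q ℚ.≤_) (ℚ.*-identityʳ p) (*-monoˡ-≤ 0≤p q≤1)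

  E-constants : ∀ {h c c₀ c₁ d s s′ t} → 0ℚ ℚ.≤ c₁ → 0ℚ ℚ.≤ h ℚ.* c → h ℚ.* c ℚ.≤ c₁ → 0ℚ ℚ.≤ d → 0ℚ ℚ.≤ t →
    s ℚ.≤ 1ℚ → s′ ℚ.≤ 1ℚ →
    (s ℚ.* h) ℚ.* (c ℚ.* t) ℚ.+ t ℚ.* (c₀ ℚ.+ c₁ ℚ.* (d ℚ.* s′)) ℚ.≤ (c₀ ℚ.+ c₁ ℚ.* d ℚ.+ c₁) ℚ.* t
  E-constants {h} {c} {c₀} {c₁} {d} {s} {s′} {t} 0≤c₁ 0≤hc hc≤c₁ 0≤d 0≤t s≤1 s′≤1 = begin
    (s ℚ.* h) ℚ.* (c ℚ.* t) ℚ.+ t ℚ.* (c₀ ℚ.+ c₁ ℚ.* (d ℚ.* s′))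
      ≡⟨ solve 7 (λ s h c t c₀ c₁ x → (s :* h) :* (c :* t) :+ t :* (c₀ :+ c₁ :* x)
            := t :* (h :* c :* s :+ (c₀ :+ c₁ :* x))) refl s h c t c₀ c₁ (d ℚ.* s′) ⟩
    t ℚ.* (h ℚ.* c ℚ.* s ℚ.+ (c₀ ℚ.+ c₁ ℚ.* (d ℚ.* s′)))
      ≤⟨ *-monoˡ-≤ 0≤t (ℚ.+-mono-≤ (p*q≤p 0≤hc s≤1) (ℚ.+-monoʳ-≤ c₀ (*-monoˡ-≤ 0≤c₁ (p*q≤p 0≤d s′≤1)))) ⟩
    t ℚ.* (h ℚ.* c ℚ.+ (c₀ ℚ.+ c₁ ℚ.* d))
      ≤⟨ *-monoˡ-≤ 0≤t (ℚ.+-monoˡ-≤ (c₀ ℚ.+ c₁ ℚ.* d) hc≤c₁) ⟩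
    t ℚ.* (c₁ ℚ.+ (c₀ ℚ.+ c₁ ℚ.* d))
      ≡⟨ solve 4 (λ t c₁ c₀ d → t :* (c₁ :+ (c₀ :+ c₁ :* d)) := (c₀ :+ c₁ :* d :+ c₁) :* t) refl t c₁ c₀ d ⟩
    (c₀ ℚ.+ c₁ ℚ.* d ℚ.+ c₁) ℚ.* t ∎

open CommutativeRing Complex.commutativeRing using
  (ring; setoid; semiring; commutativeSemiring; *-monoid; +-commutativeMonoid; reflexive;
   +-cong; +-congˡ; +-congʳ; +-assoc; +-identityˡ; +-identityʳ; -‿cong; -‿inverseˡ;
   *-cong; *-congˡ; *-congʳ; *-assoc; *-comm; *-identityˡ; *-identityʳ; distribˡ)
  renaming (refl to ≈-refl; sym to ≈-sym; trans to ≈-trans)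
open RingProperties ring using (-‿distribˡ-*; -‿involutive)
open Exp semiring using (^-homo-*; ^-assocʳ)
open MonoidSum *-monoid using () renaming (sum-cong-≋ to product-cong; sum-init-last to product-init-last)
open import Relation.Binary.Reasoning.Setoid setoid
open NatSolver commutativeSemiring
open ListSum +-commutativeMonoid using (∑-++; ∑-↭; ∑-cong; ∑-map)
open SemiringSum semiring using (∑-distribˡ)

-- The iterated sum and its remainder

-- Here u n stands for 1 / (1 + b q^n) and c n for 1 / (q^m ; q^m)_n.  T e p a is the
-- summand at a when the exponents are shifted by e and the entry preceding a is p,
-- S n e p is its sum over all p ≤ a₁ ≤ … ≤ aₙ, and E n e p k is the part of that sum
-- lying outside box n p k.  The versions T⁺, S⁺, E⁺ retain the factor that is
-- otherwise left out when a₁ = p; E⁺ n belongs to vectors of length n + 1.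
module Series (q b : ℂ) (m : ℕ) (u c : ℕ → ℂ) where

  -- The reciprocal of (-b q^s; q)_l.
  W : ℕ → ℕ → ℂ
  W s zero    = 1#
  W s (suc l) = u s * W (suc s) l

  -- The share of an entry x that is the same whether or not its factor k = 0 is left out: the
  -- numerator and the factors 1 ≤ k ≤ m.
  h : ℕ → ℕ → ℂ
  h e x = q ^ (m ℕ.* x) * W (suc (e ℕ.+ x)) m

  T : ∀ {n} → ℕ → ℕ → Vec ℕ n → ℂ
  T e p []      = 1#
  T e p (x ∷ a) = (if does (x ℕ.≟ p) then 1# else u (e ℕ.+ x)) * (h e x * T (e ℕ.+ m) x a)

  T⁺ : ∀ {n} → ℕ → Vec ℕ (suc n) → ℂ
  T⁺ e (x ∷ a) = u (e ℕ.+ x) * (h e x * T (e ℕ.+ m) x a)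

  S : ℕ → ℕ → ℕ → ℂ
  S n e p = c n * q ^ (m ℕ.* n ℕ.* p) * W (suc (e ℕ.+ p)) (m ℕ.* n)

  S⁺ : ℕ → ℕ → ℕ → ℂ
  S⁺ n e p = c n * q ^ (m ℕ.* n ℕ.* p) * W (e ℕ.+ p) (m ℕ.* n)

  E : ℕ → ℕ → ℕ → ℕ → ℂ
  E⁺ : ℕ → ℕ → ℕ → ℕ → ℂ
  E zero    e p k       = 0#
  E (suc n) e p zero    = S (suc n) e p
  E (suc n) e p (suc k) = h e p * E n (e ℕ.+ m) p (suc k) + E⁺ n e (suc p) k
  E⁺ n e p zero    = S⁺ (suc n) e p
  E⁺ n e p (suc k) = u (e ℕ.+ p) * (h e p * E n (e ℕ.+ m) p (suc k)) + E⁺ n e (suc p) k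

  T-same : ∀ {n} e p (a : Vec ℕ n) → T e p (p ∷ a) ≈ h e p * T (e ℕ.+ m) p a
  T-same e p a = if-elim (λ z → z * (h e p * T (e ℕ.+ m) p a) ≈ h e p * T (e ℕ.+ m) p a) (p ℕ.≟ p)
    (λ _ → *-identityˡ _) (λ p≢p → contradiction refl p≢p)

  T-above : ∀ {n} e p {a : Vec ℕ (suc n)} → Linked ℕ._≤_ (suc p ∷ a) → T e p a ≈ T⁺ e a
  T-above e p {x ∷ a} (p<x ∷ _) = if-elim (λ z → z * (h e x * T (e ℕ.+ m) x a) ≈ T⁺ e (x ∷ a)) (x ℕ.≟ p)
    (λ x≡p → contradiction (≡.sym x≡p) (ℕ.<⇒≢ p<x)) (λ _ → ≈-refl)

  W-+ : ∀ s l l′ → W s (l ℕ.+ l′) ≈ W s l * W (s ℕ.+ l) l′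
  W-+ s zero    l′ = ≈-trans (reflexive (cong (λ t → W t l′) (≡.sym (ℕ.+-identityʳ s)))) (≈-sym (*-identityˡ _))
  W-+ s (suc l) l′ = ≈-trans (*-congˡ (W-+ (suc s) l l′)) (≈-trans (≈-sym (*-assoc (u s) _ _))
    (*-congˡ (reflexive (cong (λ t → W t l′) (≡.sym (ℕ.+-suc s l))))))

  W-snoc : ∀ s l → W s (suc l) ≈ W s l * u (s ℕ.+ l)
  W-snoc s l = ≈-trans (reflexive (cong (W s) (ℕ.+-comm 1 l)))
    (≈-trans (W-+ s l 1) (*-congˡ (*-identityʳ _)))

  module Recursion
    (u-inverse : ∀ n → .{{_ : NonZero n}} → u n * (1# + b * q ^ n) ≈ 1#)
    (c-zero : c zero ≈ 1#)
    (c-suc : ∀ n → c (suc n) ≈ c n + c (suc n) * q ^ (m ℕ.* suc n))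
    where

    -- The block of factors in `h e p` ends just where that of the closed form for the other n
    -- entries begins, so the two merge into one of length m(n+1).
    h*S : ∀ n e p → h e p * S n (e ℕ.+ m) p ≈
      c n * q ^ (m ℕ.* suc n ℕ.* p) * W (suc (e ℕ.+ p)) (m ℕ.* suc n)
    h*S n e p = begin
      q ^ (m ℕ.* p) * w * (c n * q ^ (m ℕ.* n ℕ.* p) * W (suc (e ℕ.+ m ℕ.+ p)) (m ℕ.* n))
        ≈⟨ solve 5 (λ x w c y v → x :* w :* (c :* y :* v) := c :* (x :* y) :* (w :* v)) ≈-refl
             (q ^ (m ℕ.* p)) w (c n) (q ^ (m ℕ.* n ℕ.* p)) (W (suc (e ℕ.+ m ℕ.+ p)) (m ℕ.* n)) ⟩
      c n * (q ^ (m ℕ.* p) * q ^ (m ℕ.* n ℕ.* p)) * (w * W (suc (e ℕ.+ m ℕ.+ p)) (m ℕ.* n))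
        ≈⟨ *-cong (*-congˡ (≈-trans (≈-sym (^-homo-* q (m ℕ.* p) (m ℕ.* n ℕ.* p))) (reflexive (cong (q ^_) exponent))))
             (*-congˡ (reflexive (cong (λ t → W (suc t) (m ℕ.* n)) e+m+p))) ⟩
      c n * q ^ (m ℕ.* suc n ℕ.* p) * (w * W (suc (e ℕ.+ p) ℕ.+ m) (m ℕ.* n))
        ≈⟨ *-congˡ (≈-trans (≈-sym (W-+ (suc (e ℕ.+ p)) m (m ℕ.* n)))
             (reflexive (cong (W (suc (e ℕ.+ p))) (≡.sym (ℕ.*-suc m n))))) ⟩
      c n * q ^ (m ℕ.* suc n ℕ.* p) * W (suc (e ℕ.+ p)) (m ℕ.* suc n) ∎
      where
      w = W (suc (e ℕ.+ p)) m
      exponent : m ℕ.* p ℕ.+ m ℕ.* n ℕ.* p ≡ m ℕ.* suc n ℕ.* p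
      exponent = ≡.trans (≡.sym (ℕ.*-distribʳ-+ p m (m ℕ.* n))) (cong (ℕ._* p) (≡.sym (ℕ.*-suc m n)))
      e+m+p : e ℕ.+ m ℕ.+ p ≡ e ℕ.+ p ℕ.+ m
      e+m+p = ≡.trans (ℕ.+-assoc e m p) (≡.trans (cong (e ℕ.+_) (ℕ.+-comm m p)) (≡.sym (ℕ.+-assoc e p m)))

    -- The right side is q^(mn) times `S n e p`: retaining the leading factor at p + 1 and leaving
    -- it out at p yield the same `W`.
    S⁺-suc : ∀ n e p → S⁺ n e (suc p) ≈
      c n * (q ^ (m ℕ.* n) * q ^ (m ℕ.* n ℕ.* p)) * W (suc (e ℕ.+ p)) (m ℕ.* n)
    S⁺-suc n e p = *-cong
      (*-congˡ (≈-trans (reflexive (cong (q ^_) (ℕ.*-suc (m ℕ.* n) p))) (^-homo-* q (m ℕ.* n) (m ℕ.* n ℕ.* p))))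
      (reflexive (cong (λ t → W t (m ℕ.* n)) (ℕ.+-suc e p)))

    -- All three terms share the same power of q and the same `W`, so the identity reduces to
    -- `c-suc`.
    S-suc : ∀ n e p → S (suc n) e p ≈ h e p * S n (e ℕ.+ m) p + S⁺ (suc n) e (suc p)
    S-suc n e p = begin
      c (suc n) * x * w                  ≈⟨ *-congʳ (*-congʳ (c-suc n)) ⟩
      (c n + c (suc n) * y) * x * w
        ≈⟨ solve 5 (λ c c′ x y w → (c :+ c′ :* y) :* x :* w := c :* x :* w :+ c′ :* (y :* x) :* w) ≈-refl
             (c n) (c (suc n)) x y w ⟩
      c n * x * w + c (suc n) * (y * x) * w
        ≈⟨ +-cong (≈-sym (h*S n e p)) (≈-sym (S⁺-suc (suc n) e p)) ⟩
      h e p * S n (e ℕ.+ m) p + S⁺ (suc n) e (suc p) ∎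
      where
      x = q ^ (m ℕ.* suc n ℕ.* p)
      y = q ^ (m ℕ.* suc n)
      w = W (suc (e ℕ.+ p)) (m ℕ.* suc n)

    -- W s l and W (s + 1) l are both the product W s (l + 1) with one factor
    -- cleared, the last and the first respectively.
    S⁺-rec : ∀ n e p → .{{_ : NonZero (e ℕ.+ p)}} →
      S⁺ (suc n) e p ≈ u (e ℕ.+ p) * (h e p * S n (e ℕ.+ m) p) + S⁺ (suc n) e (suc p)
    S⁺-rec n e p = begin
      c′ * x * W s M                      ≈⟨ *-congˡ clear-last ⟩
      c′ * x * (w * (1# + b * (z * y)))
        ≈⟨ solve 6 (λ c x w b z y → c :* x :* (w :* (con 1 :+ b :* (z :* y)))
             := c :* x :* w :+ c :* (y :* x) :* (w :* (b :* z))) ≈-refl c′ x w b z y ⟩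
      -- The part carrying b already has the factor y of the term at p + 1; splitting c′ in the
      -- other part supplies the 1 that completes it to 1 + b z.
      c′ * x * w + c′ * (y * x) * (w * (b * z))
        ≈⟨ +-congʳ (*-congʳ (*-congʳ (c-suc n))) ⟩
      (c n + c′ * y) * x * w + c′ * (y * x) * (w * (b * z))
        ≈⟨ solve 7 (λ c c′ x w b z y → (c :+ c′ :* y) :* x :* w :+ c′ :* (y :* x) :* (w :* (b :* z))
             := c :* x :* w :+ c′ :* (y :* x) :* (w :* (con 1 :+ b :* z))) ≈-refl (c n) c′ x w b z y ⟩
      c n * x * w + c′ * (y * x) * (w * (1# + b * z))
        ≈⟨ +-cong head (≈-trans (*-congˡ (≈-sym clear-first)) (≈-sym (S⁺-suc (suc n) e p))) ⟩
      u s * (h e p * S n (e ℕ.+ m) p) + S⁺ (suc n) e (suc p) ∎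
      where
      s = e ℕ.+ p
      M = m ℕ.* suc n
      c′ = c (suc n)
      x = q ^ (M ℕ.* p)
      y = q ^ M
      z = q ^ s
      w = W s (suc M)
      instance
        _ : NonZero (s ℕ.+ M)
        _ = ℕ.>-nonZero (ℕ.m≤n⇒m≤n+o M (ℕ.>-nonZero⁻¹ s))
      clear-last : W s M ≈ w * (1# + b * (z * y))
      clear-last = begin
        W s M                                        ≈⟨ ≈-sym (*-identityʳ _) ⟩
        W s M * 1#                                   ≈⟨ *-congˡ (≈-sym (u-inverse (s ℕ.+ M))) ⟩
        W s M * (u (s ℕ.+ M) * (1# + b * q ^ (s ℕ.+ M))) ≈⟨ ≈-sym (*-assoc _ _ _) ⟩
        W s M * u (s ℕ.+ M) * (1# + b * q ^ (s ℕ.+ M))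
          ≈⟨ *-cong (≈-sym (W-snoc s M)) (+-congˡ (*-congˡ (^-homo-* q s M))) ⟩
        w * (1# + b * (z * y))                       ∎
      clear-first : W (suc s) M ≈ w * (1# + b * z)
      clear-first = begin
        W (suc s) M                        ≈⟨ ≈-sym (*-identityˡ _) ⟩
        1# * W (suc s) M                   ≈⟨ *-congʳ (≈-sym (u-inverse s)) ⟩
        u s * (1# + b * z) * W (suc s) M
          ≈⟨ solve 3 (λ u d w → u :* d :* w := u :* w :* d) ≈-refl (u s) (1# + b * z) (W (suc s) M) ⟩
        w * (1# + b * z)                   ∎
      head : c n * x * w ≈ u s * (h e p * S n (e ℕ.+ m) p)
      head = begin
        c n * x * (u s * W (suc s) M)
          ≈⟨ solve 4 (λ c x u w → c :* x :* (u :* w) := u :* (c :* x :* w)) ≈-refl (c n) x (u s) (W (suc s) M) ⟩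
        u s * (c n * x * W (suc s) M)      ≈⟨ *-congˡ (≈-sym (h*S n e p)) ⟩
        u s * (h e p * S n (e ℕ.+ m) p)    ∎

    -- An exact identity, with no limit involved. Vectors beginning with p leave a shorter sum of
    -- the same kind; all others begin above p and so retain their leading factor, whence the mutual
    -- induction with `S⁺-partial`.
    S-partial : ∀ n e p k → S n e p ≈ ∑ (box n p k) (T e p) + E n e p k
    S⁺-partial : ∀ n e p k → .{{_ : NonZero (e ℕ.+ p)}} →
      S⁺ (suc n) e p ≈ ∑ (box (suc n) p k) (T⁺ e) + E⁺ n e p k

    S-partial zero e p k = begin
      c 0 * q ^ (m ℕ.* 0 ℕ.* p) * W (suc (e ℕ.+ p)) (m ℕ.* 0)
        ≈⟨ *-cong (*-cong c-zero (reflexive (cong (λ t → q ^ (t ℕ.* p)) (ℕ.*-zeroʳ m))))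
             (reflexive (cong (W (suc (e ℕ.+ p))) (ℕ.*-zeroʳ m))) ⟩
      1# * 1# * 1#
        ≈⟨ solve 0 (con 1 :* con 1 :* con 1 := con 1 :+ con 0 :+ con 0) ≈-refl ⟩
      1# + 0# + 0# ∎
    S-partial (suc n) e p zero    = ≈-sym (+-identityˡ _)
    S-partial (suc n) e p (suc k) = begin
      S (suc n) e p
        ≈⟨ S-suc n e p ⟩
      h e p * S n (e ℕ.+ m) p + S⁺ (suc n) e (suc p)
        ≈⟨ +-cong (*-congˡ (S-partial n (e ℕ.+ m) p (suc k)))
             (S⁺-partial n e (suc p) k {{ℕ.>-nonZero (ℕ.m≤n⇒m≤o+n e (s≤s z≤n))}}) ⟩
      h e p * (∑ B (T (e ℕ.+ m) p) + E n (e ℕ.+ m) p (suc k)) + (∑ B⁺ (T⁺ e) + E⁺ n e (suc p) k)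
        ≈⟨ solve 5 (λ h s r s⁺ r⁺ → h :* (s :+ r) :+ (s⁺ :+ r⁺) := (h :* s :+ s⁺) :+ (h :* r :+ r⁺)) ≈-refl
             (h e p) (∑ B (T (e ℕ.+ m) p)) (E n (e ℕ.+ m) p (suc k)) (∑ B⁺ (T⁺ e)) (E⁺ n e (suc p) k) ⟩
      (h e p * ∑ B (T (e ℕ.+ m) p) + ∑ B⁺ (T⁺ e)) + E (suc n) e p (suc k)
        ≈⟨ +-congʳ (+-cong (≈-sym first) (≈-sym rest)) ⟩
      (∑ (map (p ∷_) B) (T e p) + ∑ B⁺ (T e p)) + E (suc n) e p (suc k)
        ≈⟨ +-congʳ (≈-sym (∑-++ (map (p ∷_) B) B⁺ (T e p))) ⟩
      ∑ (box (suc n) p (suc k)) (T e p) + E (suc n) e p (suc k) ∎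
      where
      B = box n p (suc k)
      B⁺ = box (suc n) (suc p) k
      first : ∑ (map (p ∷_) B) (T e p) ≈ h e p * ∑ B (T (e ℕ.+ m) p)
      first = ≈-trans (reflexive (∑-map (p ∷_) B (T e p)))
        (≈-trans (∑-cong (All.universal (T-same e p) B)) (∑-distribˡ B (h e p) (T (e ℕ.+ m) p)))
      rest : ∑ B⁺ (T e p) ≈ ∑ B⁺ (T⁺ e)
      rest = ∑-cong (All.map (T-above e p) (box-linked (suc n) (suc p) k))

    S⁺-partial n e p zero    = ≈-sym (+-identityˡ _)
    S⁺-partial n e p (suc k) = begin
      S⁺ (suc n) e p
        ≈⟨ S⁺-rec n e p ⟩
      u (e ℕ.+ p) * (h e p * S n (e ℕ.+ m) p) + S⁺ (suc n) e (suc p)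
        ≈⟨ +-cong (*-congˡ (*-congˡ (S-partial n (e ℕ.+ m) p (suc k))))
             (S⁺-partial n e (suc p) k {{ℕ.>-nonZero (ℕ.m≤n⇒m≤o+n e (s≤s z≤n))}}) ⟩
      u (e ℕ.+ p) * (h e p * (∑ B (T (e ℕ.+ m) p) + E n (e ℕ.+ m) p (suc k))) + (∑ B⁺ (T⁺ e) + E⁺ n e (suc p) k)
        ≈⟨ solve 6 (λ u h s r s⁺ r⁺ → u :* (h :* (s :+ r)) :+ (s⁺ :+ r⁺)
              := (u :* (h :* s) :+ s⁺) :+ (u :* (h :* r) :+ r⁺)) ≈-refl
             (u (e ℕ.+ p)) (h e p) (∑ B (T (e ℕ.+ m) p)) (E n (e ℕ.+ m) p (suc k)) (∑ B⁺ (T⁺ e)) (E⁺ n e (suc p) k) ⟩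
      (u (e ℕ.+ p) * (h e p * ∑ B (T (e ℕ.+ m) p)) + ∑ B⁺ (T⁺ e)) + E⁺ n e p (suc k)
        ≈⟨ +-congʳ (+-congʳ (≈-sym first)) ⟩
      (∑ (map (p ∷_) B) (T⁺ e) + ∑ B⁺ (T⁺ e)) + E⁺ n e p (suc k)
        ≈⟨ +-congʳ (≈-sym (∑-++ (map (p ∷_) B) B⁺ (T⁺ e))) ⟩
      ∑ (box (suc n) p (suc k)) (T⁺ e) + E⁺ n e p (suc k) ∎
      where
      B = box n p (suc k)
      B⁺ = box (suc n) (suc p) k
      first : ∑ (map (p ∷_) B) (T⁺ e) ≈ u (e ℕ.+ p) * (h e p * ∑ B (T (e ℕ.+ m) p))
      first = ≈-trans (reflexive (∑-map (p ∷_) B (T⁺ e)))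
        (≈-trans (∑-distribˡ B (u (e ℕ.+ p)) (λ a → h e p * T (e ℕ.+ m) p a))
          (*-congˡ (∑-distribˡ B (h e p) (T (e ℕ.+ m) p))))

-- Estimates of the summands and the remainders

module Bounds (q b : ℂ) (m : ℕ) .{{_ : NonZero m}} (u c : ℕ → ℂ)
  (R : Ratio) (q≼ : q ≼ Ratio.σ R ℚ.* Ratio.σ R)
  {B : ℚ} (1≤B : 1ℚ ℚ.≤ B) (u≼B : ∀ n → u n ≼ B)
  where
  open Ratio R
  open Geometric R
  open Series q b m u c

  0≤B : 0ℚ ℚ.≤ B
  0≤B = ℚ.≤-trans (ℚ.<⇒≤ 0<1) 1≤B

  W≼ : ∀ s l → W s l ≼ B ^ℚ l
  W≼ s zero    = 1≼
  W≼ s (suc l) = ≼-* (u≼B s) (W≼ (suc s) l)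

  H : ℚ
  H = B ^ℚ m

  0≤H : 0ℚ ℚ.≤ H
  0≤H = 0≤bound (W≼ 0 m)

  σ^*σ^≤σ^ : ∀ n → σ ^ℚ n ℚ.* σ ^ℚ n ℚ.≤ σ ^ℚ n
  σ^*σ^≤σ^ n = subst (σ ^ℚ n ℚ.* σ ^ℚ n ℚ.≤_) (ℚ.*-identityʳ (σ ^ℚ n)) (*-monoˡ-≤ (0≤σ^ n) (σ^≤1 n))

  h≼² : ∀ e x → h e x ≼ σ ^ℚ x ℚ.* σ ^ℚ x ℚ.* H
  h≼² e x = ≼-* (≼-^² q≼ (ℕ.m≤n*m x m)) (W≼ (suc (e ℕ.+ x)) m)

  h≼ : ∀ e x → h e x ≼ σ ^ℚ x ℚ.* H
  h≼ e x = ≼-weaken (*-monoʳ-≤ 0≤H (σ^*σ^≤σ^ x)) (h≼² e x)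

  T≼ : ∀ {n} e p (a : Vec ℕ n) → T e p a ≼ (B ℚ.* H) ^ℚ n ℚ.* (weight a ℚ.* weight a)
  T≼ e p []      = ≼-weaken (ℚ.≤-reflexive (≡.sym (≡.trans (ℚ.*-identityˡ (1ℚ ℚ.* 1ℚ)) (ℚ.*-identityˡ 1ℚ)))) 1≼
  T≼ {suc n} e p (x ∷ a) = ≼-weaken (ℚ.≤-reflexive rearrange)
    (≼-* head (≼-* (h≼² e x) (T≼ (e ℕ.+ m) x a)))
    where
    -- A factor left out counts as 1, which is why B is taken to be at least 1.
    head = if-elim (_≼ B) (x ℕ.≟ p) (λ _ → ≼-weaken 1≤B 1≼) (λ _ → u≼B (e ℕ.+ x))
    K = (B ℚ.* H) ^ℚ n
    rearrange : B ℚ.* ((σ ^ℚ x ℚ.* σ ^ℚ x ℚ.* H) ℚ.* (K ℚ.* (weight a ℚ.* weight a))) ≡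
      B ℚ.* H ℚ.* K ℚ.* (weight (x ∷ a) ℚ.* weight (x ∷ a))
    rearrange = ≡.trans
      (T-constants B H K (σ ^ℚ x) (weight a))
      (cong (λ w → B ℚ.* H ℚ.* K ℚ.* (w ℚ.* w)) (≡.sym (^ℚ-homo-* σ x (Vec.sum a))))

  -- Of the two weights in `T≼`, one is at most σ^k and gives smallness; the other is summed by
  -- `∑-weight`. This is the reason for bounding q by σ² instead of σ.
  tail≼ : ∀ {n k} {as : List (Vec ℕ n)} → Unique as → All (λ a → k ℕ.≤ Vec.sum a) as →
    ∀ e p → ∑ as (T e p) ≼ ((B ℚ.* H) ^ℚ n ℚ.* D ^ℚ n) ℚ.* σ ^ℚ k
  tail≼ {n} {k} {as} as! k≤ e p = ≼-weaken bound (∑-≼ (All.map (λ {a} → term a) k≤))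
    where
    K = (B ℚ.* H) ^ℚ n
    0≤K : 0ℚ ℚ.≤ K
    0≤K = 0≤^ {B ℚ.* H} (0≤* 0≤B 0≤H) n
    term : ∀ a → k ℕ.≤ Vec.sum a → T e p a ≼ K ℚ.* σ ^ℚ k ℚ.* weight a
    term a k≤a = ≼-weaken (ℚ.≤-trans
      (*-monoˡ-≤ 0≤K (*-monoʳ-≤ (0≤σ^ (Vec.sum a)) (σ^-antitone k≤a)))
      (ℚ.≤-reflexive (≡.sym (ℚ.*-assoc K (σ ^ℚ k) (weight a))))) (T≼ e p a)
    bound : ∑ℚ as (λ a → K ℚ.* σ ^ℚ k ℚ.* weight a) ℚ.≤ (K ℚ.* D ^ℚ n) ℚ.* σ ^ℚ k
    bound = subst₂ ℚ._≤_ (≡.sym (∑ℚ-distribˡ as (K ℚ.* σ ^ℚ k) weight)) (swap-last K (σ ^ℚ k) (D ^ℚ n))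
      (*-monoˡ-≤ (0≤* 0≤K (0≤σ^ k)) (∑-weight as!))

  module Step (n : ℕ) {C γ : ℚ} (0≤C : 0ℚ ℚ.≤ C) (c≼γ : c (suc n) ≼ γ)
    (E≼C : ∀ e p k → E n e p k ≼ C ℚ.* σ ^ℚ (p ℕ.+ k)) where

    M : ℕ
    M = m ℕ.* suc n

    C₀ C₁ : ℚ
    C₀ = γ ℚ.* B ^ℚ M
    C₁ = B ℚ.* (H ℚ.* C)

    0≤C₀ : 0ℚ ℚ.≤ C₀
    0≤C₀ = 0≤* {γ} {B ^ℚ M} (0≤bound c≼γ) (0≤bound (W≼ 0 M))

    0≤C₁ : 0ℚ ℚ.≤ C₁
    0≤C₁ = 0≤* {B} {H ℚ.* C} 0≤B (0≤* {H} {C} 0≤H 0≤C)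

    S-value : ∀ p s → c (suc n) * q ^ (M ℕ.* p) * W s M ≼ σ ^ℚ p ℚ.* C₀
    S-value p s = ≼-weaken (S-constants (0≤bound c≼γ) (0≤bound (W≼ 0 M)) (σ^*σ^≤σ^ p))
      (≼-* (≼-* c≼γ (≼-^² q≼ (ℕ.m≤n*m p M {{ℕ.m*n≢0 m (suc n)}}))) (W≼ s M))

    S-value₀ : ∀ p s → c (suc n) * q ^ (M ℕ.* p) * W s M ≼ σ ^ℚ (p ℕ.+ 0) ℚ.* C₀
    S-value₀ p s = subst (λ t → c (suc n) * q ^ (M ℕ.* p) * W s M ≼ σ ^ℚ t ℚ.* C₀)
      (≡.sym (ℕ.+-identityʳ p)) (S-value p s)

    -- Along the recursion p + k is constant, so the power in front stays fixed. The step at p adds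
    -- at most C₁ σ^p to the bracket, and D σ^p = σ^p + D σ^(p+1) absorbs all these additions,
    -- however large k is.
    E⁺-bound : ∀ e p k → E⁺ n e p k ≼ σ ^ℚ (p ℕ.+ k) ℚ.* (C₀ ℚ.+ C₁ ℚ.* (D ℚ.* σ ^ℚ p))
    E⁺-bound e p zero    = ≼-weaken
      (*-monoˡ-≤ {σ ^ℚ (p ℕ.+ 0)} {C₀} (0≤σ^ (p ℕ.+ 0))
        (p≤p+q C₀ {C₁ ℚ.* (D ℚ.* σ ^ℚ p)} (0≤* {C₁} 0≤C₁ (0≤* {D} 0≤D (0≤σ^ p)))))
      (S-value₀ p (e ℕ.+ p))
    E⁺-bound e p (suc k) = ≼-weaken
      (ℚ.≤-reflexive (E⁺-constants B (σ ^ℚ p) H C (σ ^ℚ (p ℕ.+ suc k)) C₀ D σ (D-step (σ ^ℚ p))))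
      (≼-+ (≼-* (u≼B (e ℕ.+ p)) (≼-* (h≼ e p) (E≼C (e ℕ.+ m) p (suc k))))
        (subst (λ t → E⁺ n e (suc p) k ≼ σ ^ℚ t ℚ.* (C₀ ℚ.+ C₁ ℚ.* (D ℚ.* σ ^ℚ suc p)))
          (≡.sym (ℕ.+-suc p k)) (E⁺-bound e (suc p) k)))

    -- The last C₁ pays for the term `h e p * E n (e ℕ.+ m) p (suc k)`, as H C ≤ C₁ by 1 ≤ B; the
    -- rest comes from `E⁺-bound`.
    C′ : ℚ
    C′ = C₀ ℚ.+ C₁ ℚ.* D ℚ.+ C₁

    0≤C′ : 0ℚ ℚ.≤ C′
    0≤C′ = 0≤+ {C₀ ℚ.+ C₁ ℚ.* D} {C₁} (0≤+ {C₀} {C₁ ℚ.* D} 0≤C₀ (0≤* {C₁} {D} 0≤C₁ 0≤D)) 0≤C₁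

    E-bound : ∀ e p k → E (suc n) e p k ≼ C′ ℚ.* σ ^ℚ (p ℕ.+ k)
    E-bound e p zero    = ≼-weaken (E-constants₀ 0≤C₁ 0≤D (0≤σ^ (p ℕ.+ 0))) (S-value₀ p (suc (e ℕ.+ p)))
    E-bound e p (suc k) = ≼-weaken
      (E-constants {c₀ = C₀} 0≤C₁ (0≤* {H} {C} 0≤H 0≤C) HC≤C₁ 0≤D (0≤σ^ (p ℕ.+ suc k)) (σ^≤1 p) (σ^≤1 (suc p)))
      (≼-+ (≼-* (h≼ e p) (E≼C (e ℕ.+ m) p (suc k)))
        (subst (λ t → E⁺ n e (suc p) k ≼ σ ^ℚ t ℚ.* (C₀ ℚ.+ C₁ ℚ.* (D ℚ.* σ ^ℚ suc p)))
          (≡.sym (ℕ.+-suc p k)) (E⁺-bound e (suc p) k)))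
      where
      HC≤C₁ : H ℚ.* C ℚ.≤ C₁
      HC≤C₁ = subst (ℚ._≤ C₁) (ℚ.*-identityˡ (H ℚ.* C))
        (*-monoʳ-≤ {H ℚ.* C} {1ℚ} {B} (0≤* {H} {C} 0≤H 0≤C) 1≤B)

  -- Uniformity in e and p carries the induction on n, since the recursion changes both.
  E≼ : ∀ n → ∃ λ C → 0ℚ ℚ.≤ C × (∀ e p k → E n e p k ≼ C ℚ.* σ ^ℚ (p ℕ.+ k))
  E≼ zero    = 0ℚ , ℚ.≤-refl , λ e p k → 0≼ (ℚ.≤-reflexive (≡.sym (ℚ.*-zeroˡ (σ ^ℚ (p ℕ.+ k)))))
  E≼ (suc n) =
    let C , 0≤C , E≼C = E≼ n
        γ , c≼γ       = ≼-bounded (c (suc n))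
    in Step.C′ n 0≤C c≼γ E≼C , Step.0≤C′ n 0≤C c≼γ E≼C , Step.E-bound n 0≤C c≼γ E≼C

-- The summands and the value in terms of the series

/-unique : ∀ {t z w} (w#0 : w # 0#) → t * w ≈ z → z / w [ w#0 ] ≈ t
/-unique {t} {z} {w} w#0 tw≈z = begin
  z * inv w w#0        ≈⟨ *-congʳ (≈-sym tw≈z) ⟩
  t * w * inv w w#0    ≈⟨ *-assoc t w (inv w w#0) ⟩
  t * (w * inv w w#0)  ≈⟨ *-congˡ (*-inv w#0) ⟩
  t * 1#               ≈⟨ *-identityʳ t ⟩
  t                    ∎

-- `product` unfolds at its first factor, whereas the recursion in n appends a last one.
pochhammer-suc : ∀ x q n → pochhammer x q (suc n) ≈ pochhammer x q n * (1# - x * q ^ n)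
pochhammer-suc x q n = ≈-trans (product-init-last {n} (λ j → 1# - x * q ^ toℕ j)) (*-cong
  (product-cong {n} λ j → reflexive (cong (λ k → 1# - x * q ^ k) (Fin.toℕ-inject₁ j)))
  (reflexive (cong (λ k → 1# - x * q ^ k) (Fin.toℕ-fromℕ n))))

module Instance (q b : ℂ) (∣q∣<1 : ∣ q ∣ Real.< Real.1#) (b≠ : NonSingular q b) (m : ℕ) .{{_ : NonZero m}} where

  -- The value at 0 is a placeholder: 1 + b may vanish, and `u-inverse` asks for a positive
  -- exponent.
  u : ℕ → ℂ
  u zero      = 0#
  u n@(suc _) = inv (1# + b * q ^ n) (b≠ n)

  u-inverse : ∀ n → .{{_ : NonZero n}} → u n * (1# + b * q ^ n) ≈ 1#
  u-inverse n@(suc _) = ≈-trans (*-comm (u n) (1# + b * q ^ n)) (*-inv (b≠ n))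

  c : ℕ → ℂ
  c n = inv (pochhammer (q ^ m) (q ^ m) n) (pochhammer-q#0 {q} ∣q∣<1 m n)

  c-inverse : ∀ n → c n * pochhammer (q ^ m) (q ^ m) n ≈ 1#
  c-inverse n = ≈-trans (*-comm (c n) _) (*-inv (pochhammer-q#0 {q} ∣q∣<1 m n))

  c-zero : c zero ≈ 1#
  c-zero = ≈-trans (≈-sym (*-identityʳ (c zero))) (c-inverse zero)

  c-suc : ∀ n → c (suc n) ≈ c n + c (suc n) * q ^ (m ℕ.* suc n)
  c-suc n = begin
    c′                              ≈⟨ ≈-sym (*-identityʳ c′) ⟩
    c′ * 1#                         ≈⟨ *-congˡ (≈-sym d+y≈1) ⟩
    c′ * (d + y)                    ≈⟨ distribˡ c′ d y ⟩
    c′ * d + c′ * y                 ≈⟨ +-congʳ c′*d≈c ⟩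
    c n + c′ * y                    ∎
    where
    c′ = c (suc n)
    y = q ^ (m ℕ.* suc n)
    d = 1# - y
    P = pochhammer (q ^ m) (q ^ m)
    d+y≈1 : d + y ≈ 1#
    d+y≈1 = ≈-trans (+-assoc 1# (- y) y) (≈-trans (+-congˡ (-‿inverseˡ y)) (+-identityʳ 1#))
    P-suc : P (suc n) ≈ P n * d
    P-suc = ≈-trans (pochhammer-suc (q ^ m) (q ^ m) n)
      (*-congˡ (+-congˡ (-‿cong (^-assocʳ q m (suc n)))))
    c′*d≈c : c′ * d ≈ c n
    c′*d≈c = begin
      c′ * d                        ≈⟨ ≈-sym (*-identityʳ _) ⟩
      c′ * d * 1#                   ≈⟨ *-congˡ (≈-sym (c-inverse n)) ⟩
      c′ * d * (c n * P n)
        ≈⟨ solve 4 (λ c′ d c p → c′ :* d :* (c :* p) := c :* (c′ :* (p :* d))) ≈-refl c′ d (c n) (P n) ⟩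
      c n * (c′ * (P n * d))        ≈⟨ *-congˡ (*-congˡ (≈-sym P-suc)) ⟩
      c n * (c′ * P (suc n))        ≈⟨ *-congˡ (c-inverse (suc n)) ⟩
      c n * 1#                      ≈⟨ *-identityʳ (c n) ⟩
      c n                           ∎

  open Series q b m u c
  open Recursion u-inverse c-zero c-suc

  W-inverse : ∀ s l → .{{_ : NonZero s}} → W s l * product (λ (k : Fin l) → 1# + b * q ^ (s ℕ.+ toℕ k)) ≈ 1#
  W-inverse s zero    = *-identityˡ 1#
  W-inverse s (suc l) = begin
    u s * W (suc s) l * ((1# + b * q ^ (s ℕ.+ 0)) * product (λ (k : Fin l) → 1# + b * q ^ (s ℕ.+ suc (toℕ k))))
      ≈⟨ *-congˡ (*-cong (reflexive (cong (λ t → 1# + b * q ^ t) (ℕ.+-identityʳ s)))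
           (product-cong {l} λ k → reflexive (cong (λ t → 1# + b * q ^ t) (ℕ.+-suc s (toℕ k))))) ⟩
    u s * W (suc s) l * ((1# + b * q ^ s) * P)
      ≈⟨ solve 4 (λ u w d p → u :* w :* (d :* p) := (u :* d) :* (w :* p)) ≈-refl
           (u s) (W (suc s) l) (1# + b * q ^ s) P ⟩
    u s * (1# + b * q ^ s) * (W (suc s) l * P)
      ≈⟨ *-cong (u-inverse s) (W-inverse (suc s) l) ⟩
    1# * 1#
      ≈⟨ *-identityˡ 1# ⟩
    1# ∎
    where P = product (λ (k : Fin l) → 1# + b * q ^ (suc s ℕ.+ toℕ k))

  -- The factor (j , k) of a denominator whose exponents are shifted by e and in
  -- which the entry preceding a is p.
  factorFrom : ℕ → ℕ → ∀ {n} → Vec ℕ n → Fin n → ℕ → ℂ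
  factorFrom e p a j k =
    if omitted (p ∷ a) (suc j) k then 1# else 1# + b * q ^ (e ℕ.+ (toℕ j ℕ.* m ℕ.+ k ℕ.+ lookup a j))

  rowFrom : ℕ → ℕ → ∀ {n} → Vec ℕ n → Fin n → ℂ
  rowFrom e p a j = product (λ (k : Fin (suc m)) → factorFrom e p a j (toℕ k))

  -- Removing the first entry raises the exponents by m and makes that entry the predecessor, which
  -- is the change of arguments in the recursion of `T`.
  factorFrom-suc : ∀ {n} e p x (a : Vec ℕ n) j k → factorFrom e p (x ∷ a) (suc j) k ≡ factorFrom (e ℕ.+ m) x a j k
  factorFrom-suc e p x a j k = cong₂ (λ o t → if o then 1# else 1# + b * q ^ t) (same-omitted k) (exponent k)
    where
    same-omitted : ∀ k → omitted (p ∷ x ∷ a) (suc (suc j)) k ≡ omitted (x ∷ a) (suc j) k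
    same-omitted zero    = refl
    same-omitted (suc k) = refl
    exponent : ∀ k → e ℕ.+ (m ℕ.+ toℕ j ℕ.* m ℕ.+ k ℕ.+ lookup a j) ≡ e ℕ.+ m ℕ.+ (toℕ j ℕ.* m ℕ.+ k ℕ.+ lookup a j)
    exponent k = ≡.trans (cong (e ℕ.+_) (≡.trans
      (cong (ℕ._+ lookup a j) (ℕ.+-assoc m (toℕ j ℕ.* m) k)) (ℕ.+-assoc m _ (lookup a j))))
      (≡.sym (ℕ.+-assoc e m _))

  -- With an arbitrary decision in place of the equality test, one case split reduces both
  -- conditionals.
  head-cancel : ∀ {A : Set} (d : Dec A) n → (¬ A → NonZero n) →
    (if does d then 1# else u n) * (if does d then 1# else 1# + b * q ^ n) ≈ 1#
  head-cancel (yes _) n _  = *-identityˡ 1#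
  head-cancel (no ¬a) n nz = u-inverse n {{nz ¬a}}

  rowFrom-zero : ∀ {n} e p x (a : Vec ℕ n) → (x ≢ p → NonZero (e ℕ.+ x)) →
    (if does (x ℕ.≟ p) then 1# else u (e ℕ.+ x)) * W (suc (e ℕ.+ x)) m * rowFrom e p (x ∷ a) zero ≈ 1#
  rowFrom-zero e p x a nz = begin
    v * w * (f * product (λ (k : Fin m) → 1# + b * q ^ (e ℕ.+ (suc (toℕ k) ℕ.+ x))))
      ≈⟨ *-congˡ (*-congˡ (product-cong {m} λ k → reflexive (cong (λ t → 1# + b * q ^ t) (exponent (toℕ k))))) ⟩
    v * w * (f * P)
      ≈⟨ solve 4 (λ v w f p → v :* w :* (f :* p) := (v :* f) :* (w :* p)) ≈-refl v w f P ⟩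
    v * f * (w * P)
      ≈⟨ *-cong (head-cancel (x ℕ.≟ p) (e ℕ.+ x) nz) (W-inverse (suc (e ℕ.+ x)) m) ⟩
    1# * 1#
      ≈⟨ *-identityˡ 1# ⟩
    1# ∎
    where
    v = if does (x ℕ.≟ p) then 1# else u (e ℕ.+ x)
    w = W (suc (e ℕ.+ x)) m
    f = if does (x ℕ.≟ p) then 1# else 1# + b * q ^ (e ℕ.+ x)
    P = product (λ (k : Fin m) → 1# + b * q ^ (suc (e ℕ.+ x) ℕ.+ toℕ k))
    exponent : ∀ k → e ℕ.+ (suc k ℕ.+ x) ≡ suc (e ℕ.+ x) ℕ.+ k
    exponent k = ≡.trans (ℕ.+-suc e (k ℕ.+ x))
      (cong suc (≡.trans (cong (e ℕ.+_) (ℕ.+-comm k x)) (≡.sym (ℕ.+-assoc e x k))))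

  -- In multiplied-out form the reciprocals cancel row by row. The side condition concerns the first
  -- row, where e may be 0; in later rows the shift is at least m, hence positive.
  T*denominator : ∀ {n} e p (a : Vec ℕ n) → (∀ x → x ≢ p → NonZero (e ℕ.+ x)) →
    T e p a * product (rowFrom e p a) ≈ q ^ (m ℕ.* sum a)
  T*denominator e p []      _  = ≈-trans (*-identityˡ 1#) (reflexive (cong (q ^_) (≡.sym (ℕ.*-zeroʳ m))))
  T*denominator {suc n} e p (x ∷ a) nz = begin
    v * (q ^ (m ℕ.* x) * w * t) * (r * product (λ j → rowFrom e p (x ∷ a) (suc j)))
      ≈⟨ *-congˡ (*-congˡ (product-cong {n} λ j → product-cong {suc m} λ k →
           reflexive (factorFrom-suc e p x a j (toℕ k)))) ⟩
    v * (q ^ (m ℕ.* x) * w * t) * (r * R)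
      ≈⟨ solve 6 (λ v y w t r R → v :* (y :* w :* t) :* (r :* R) := (v :* w :* r) :* (y :* (t :* R))) ≈-refl
           v (q ^ (m ℕ.* x)) w t r R ⟩
    v * w * r * (q ^ (m ℕ.* x) * (t * R))
      ≈⟨ *-cong (rowFrom-zero e p x a (nz x)) (*-congˡ (T*denominator (e ℕ.+ m) x a λ y _ →
           ℕ.>-nonZero (ℕ.m≤n⇒m≤n+o y (ℕ.m≤n⇒m≤o+n e (ℕ.>-nonZero⁻¹ m))))) ⟩
    1# * (q ^ (m ℕ.* x) * q ^ (m ℕ.* sum a))
      ≈⟨ *-identityˡ _ ⟩
    q ^ (m ℕ.* x) * q ^ (m ℕ.* sum a)
      ≈⟨ ≈-sym (^-homo-* q (m ℕ.* x) (m ℕ.* sum a)) ⟩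
    q ^ (m ℕ.* x ℕ.+ m ℕ.* sum a)
      ≈⟨ reflexive (cong (q ^_) (≡.sym (ℕ.*-distribˡ-+ m x (sum a)))) ⟩
    q ^ (m ℕ.* sum (x ∷ a)) ∎
    where
    v = if does (x ℕ.≟ p) then 1# else u (e ℕ.+ x)
    w = W (suc (e ℕ.+ x)) m
    t = T (e ℕ.+ m) x a
    r = rowFrom e p (x ∷ a) zero
    R = product (rowFrom (e ℕ.+ m) x a)

  factor≡factorFrom : ∀ {n} (a : Vec ℕ n) j k → factor q b m a j k ≡ factorFrom 0 0 a j k
  factor≡factorFrom a zero    zero    = refl
  factor≡factorFrom a zero    (suc k) = refl
  factor≡factorFrom a (suc j) zero    = refl
  factor≡factorFrom a (suc j) (suc k) = refl

  denominator≈rows : ∀ {n} (a : Vec ℕ n) → denominator q b m a ≈ product (rowFrom 0 0 a)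
  denominator≈rows {n} a = product-cong {n} λ j → product-cong {suc m} λ k →
    reflexive (factor≡factorFrom a j (toℕ k))

  summand≈T : ∀ {n} (a : Vec ℕ n) w#0 → q ^ (m ℕ.* sum a) / denominator q b m a [ w#0 ] ≈ T 0 0 a
  summand≈T a w#0 = /-unique w#0
    (≈-trans (*-congˡ (denominator≈rows a)) (T*denominator 0 0 a λ x x≢0 → ℕ.≢-nonZero x≢0))

  value≈S : ∀ n w#0 →
    1# / (pochhammer (q ^ m) (q ^ m) n * pochhammer (- b * q) q (m ℕ.* n)) [ w#0 ] ≈ S n 0 0
  value≈S n w#0 = /-unique w#0 (begin
    c n * q ^ (m ℕ.* n ℕ.* 0) * W 1 (m ℕ.* n) * (P * pochhammer (- b * q) q (m ℕ.* n))
      ≈⟨ *-cong (*-congʳ (*-congˡ (reflexive (cong (q ^_) (ℕ.*-zeroʳ (m ℕ.* n))))))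
           (*-congˡ (product-cong {m ℕ.* n} λ j → ≈-sym (rearrange (q ^ toℕ j)))) ⟩
    c n * 1# * W 1 (m ℕ.* n) * (P * P′)
      ≈⟨ solve 4 (λ c w p p′ → c :* con 1 :* w :* (p :* p′) := (c :* p) :* (w :* p′)) ≈-refl
           (c n) (W 1 (m ℕ.* n)) P P′ ⟩
    c n * P * (W 1 (m ℕ.* n) * P′)
      ≈⟨ *-cong (c-inverse n) (W-inverse 1 (m ℕ.* n)) ⟩
    1# * 1#
      ≈⟨ *-identityˡ 1# ⟩
    1# ∎)
    where
    P = pochhammer (q ^ m) (q ^ m) n
    P′ = product (λ (j : Fin (m ℕ.* n)) → 1# + b * q ^ (1 ℕ.+ toℕ j))
    rearrange : ∀ w → 1# + b * (q * w) ≈ 1# - - b * q * w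
    rearrange w = +-congˡ (≈-sym (≈-trans (-‿cong (≈-trans (*-assoc (- b) q w) (≈-sym (-‿distribˡ-* b (q * w)))))
      (-‿involutive (b * (q * w)))))

  -- The sum over the box occurs in the partial sum and, by `S-partial`, in the value; it cancels,
  -- and two small terms are left.
  remainder : ∀ n k {as bs : List (Vec ℕ n)} {f v} → as ↭ box n 0 k ++ bs →
    (∀ a → f a ≈ T 0 0 a) → v ≈ S n 0 0 → ∑ as f - v ≈ ∑ bs (T 0 0) - E n 0 0 k
  remainder n k {as} {bs} {f} {v} p f≈T v≈S = begin
    ∑ as f - v
      ≈⟨ +-cong (≈-trans (∑-cong (All.universal f≈T as))
           (≈-trans (∑-↭ p (T 0 0)) (∑-++ (box n 0 k) bs (T 0 0))))
           (-‿cong (≈-trans v≈S (S-partial n 0 0 k))) ⟩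
    ∑ (box n 0 k) (T 0 0) + ∑ bs (T 0 0) - (∑ (box n 0 k) (T 0 0) + E n 0 0 k)
      ≈⟨ +-cancel-difference (∑ (box n 0 k) (T 0 0)) (∑ bs (T 0 0)) (E n 0 0 k) ⟩
    ∑ bs (T 0 0) - E n 0 0 k ∎

  u-bounded : ∀ (R : Ratio) → q ≼ Ratio.σ R → ∃ λ B → 1ℚ ℚ.≤ B × (∀ n → u n ≼ B)
  u-bounded R q≼σ =
    let d , 0<d , lower = 1+bq^-≽ R q≼σ b≠
        B₀ , inv≼B₀     = inv-≼ 0<d
        B , B₀≤B , 1≤B  = common-upper B₀ 1ℚ
    in B , 1≤B , u≼ 1≤B B₀≤B lower inv≼B₀
    where
    u≼ : ∀ {B B₀ d} → 1ℚ ℚ.≤ B → B₀ ℚ.≤ B → (∀ n → .{{_ : NonZero n}} → 1# + b * q ^ n ≽ d) →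
      (∀ {z} (z#0 : z # 0#) → z ≽ d → inv z z#0 ≼ B₀) → ∀ n → u n ≼ B
    u≼ 1≤B _    _     _      zero      = 0≼ (ℚ.≤-trans (ℚ.<⇒≤ 0<1) 1≤B)
    u≼ _   B₀≤B lower inv≼B₀ n@(suc _) = ≼-weaken B₀≤B (inv≼B₀ (b≠ n) (lower n))

  tail-bound : ∀ n {δ} → 0ℚ ℚ.< δ → ∃ λ k → ∀ {as : List (Vec ℕ n)} → Unique as → All (λ a → k ℕ.≤ sum a) as →
    ∑ as (T 0 0) - E n 0 0 k ≼ δ
  tail-bound n {δ} 0<δ =
    let R , q≼σ² = ∣∣<1⇒ratio {q} ∣q∣<1
        q≼σ = ≼-weaken (Ratio.σ*σ≤σ R) q≼σ²
        B , 1≤B , u≼B = u-bounded R q≼σ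
    in bound R q≼σ² 1≤B u≼B
    where
    bound : ∀ (R : Ratio) → q ≼ Ratio.σ R ℚ.* Ratio.σ R → ∀ {B} → 1ℚ ℚ.≤ B → (∀ n → u n ≼ B) →
      ∃ λ k → ∀ {as : List (Vec ℕ n)} → Unique as → All (λ a → k ℕ.≤ sum a) as → ∑ as (T 0 0) - E n 0 0 k ≼ δ
    bound R q≼σ² {B} 1≤B u≼B =
      let C , 0≤C , E≤ = E≼ n
          -- K σ^k bounds the contribution of the vectors outside the box, C σ^k that of the
          -- remainder.
          k , small    = σ^-vanishes (K ℚ.+ C) (0≤+ {K} {C} 0≤K 0≤C) 0<δ
      in k , λ as! k≤ → ≼-weaken
           (ℚ.≤-trans (ℚ.≤-reflexive (≡.sym (ℚ.*-distribʳ-+ (σ ^ℚ k) K C))) (ℚ.<⇒≤ small))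
           (≼-+ (tail≼ as! k≤ 0 0) (≼-neg (E≤ 0 0 k)))
      where
      open Ratio R
      open Geometric R
      open Bounds q b m u c R q≼σ² 1≤B u≼B
      K = (B ℚ.* H) ^ℚ n ℚ.* D ^ℚ n
      0≤K : 0ℚ ℚ.≤ K
      0≤K = 0≤* {(B ℚ.* H) ^ℚ n} {D ^ℚ n} (0≤^ (0≤* {B} {H} 0≤B 0≤H) n) (0≤^ 0≤D n)

-- Unconditional convergence

linked-0∷ : ∀ {n} {a : Vec ℕ n} → Linked ℕ._≤_ a → Linked ℕ._≤_ (0 ∷ a)
linked-0∷ {a = []}    []  = [-]
linked-0∷ {a = _ ∷ _} rs  = z≤n ∷ rs

outside-box : ∀ {n k} {as bs : List (Vec ℕ n)} → as ↭ box n 0 k ++ bs → Unique as → All (Linked ℕ._≤_) as →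
  Unique bs × All (λ a → k ℕ.≤ sum a) bs
outside-box {n} {k} {as} {bs} p as! as↗ = unique-++ʳ (box n 0 k) all! , All.tabulate λ a∈bs →
  ℕ.≮⇒≥ λ sum<k → unique-++-disjoint (box n 0 k) all! a∈bs
    (sum<⇒∈-box 0 k (linked-0∷ (All.lookup as↗ (∈-resp-↭ (↭-sym p) (∈-++⁺ʳ (box n 0 k) a∈bs)))) sum<k)
  where
  all! = Unique-resp-↭ p as!

lemma5 : (q b : ℂ) (∣q∣<1 : ∣ q ∣ Real.< Real.1#) (b≠ : NonSingular q b)
    (m n : ℕ) .{{_ : NonZero m}} .{{_ : NonZero n}} →
    HasSum {Vec ℕ n} (Linked ℕ._≤_)
    (λ a → q ^ (m ℕ.* sum a) / denominator q b m a [ denominator#0 {q} {b} m b≠ a ])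
    (1# / (pochhammer (q ^ m) (q ^ m) n * pochhammer (- b * q) q (m ℕ.* n))
    [ x#0y#0→xy#0 (pochhammer-q#0 {q} ∣q∣<1 m n) (pochhammer-bq#0 {q} {b} b≠ (m ℕ.* n)) ])
lemma5 q b ∣q∣<1 b≠ m n ε 0<ε =
  -- Halving twice provides δ < η < r: one strict step is spent on passing to an equal number in
  -- `≼-resp-≈`, the other on passing to the modulus.
  let r , 0<r , ≼⇒<ε = ∣∣<-from-≼ {ε} 0<ε
      η , 0<η , 2η≡r = halve r 0<r
      δ , 0<δ , 2δ≡η = halve η 0<η
      k , tail≼δ     = tail-bound n 0<δ
  in box n 0 k , All.map Linked.tail (box-linked n 0 k) , λ as as! as↗ box⊆as →
    let bs , p   = ⊆⇒↭++ (box-unique n 0 k) box⊆as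
        bs! , k≤ = outside-box p as! as↗
        rest≈    = ≈-sym (remainder n k p (λ a → summand≈T a _) (value≈S n _))
    in ≼⇒<ε (double-< 0<η 2η≡r) (≼-resp-≈ rest≈ (double-< 0<δ 2δ≡η) (tail≼δ bs! k≤))
  where
  open Instance q b ∣q∣<1 b≠ m
  double-< : ∀ {p r} → 0ℚ ℚ.< p → p ℚ.+ p ≡ r → p ℚ.< r
  double-< {p} 0<p refl = p<p+q p 0<p
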